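{- Let $k$ be an integer, and let $G$ be a graph of order $n$. (1) If $\delta(G)\geq k\geq 0$ and $q(G)\geq q(\underline{N}_n^k)$, where $n\geq\max\{6k+10,(3k^2+9k+8)/2\}$, then $G$ is traceable unless $G=\underline{N}_n^k$. (2) If $\delta(G)\geq k\geq 1$ and $q(G)\geq q(N_n^k)$, where $n\geq\max\{6k+5,(3k^2+5k+4)/2\}$, then $G$ is Hamiltonian unless $G=N_n^k$.
   Context: All graphs are finite and simple; equality of graphs means isomorphism. $\delta(G)$ is the minimum degree of $G$. $q(G)$ is the signless Laplacian spectral radius, i.e. the largest eigenvalue of $Q=A+D$, where $A$ is the adjacency matrix and $D$ the diagonal degree matrix of $G$. A graph is Hamiltonian (traceable) if it contains a cycle (path) through all its vertices. $G_1+G_2$ denotes the disjoint union of graphs, $kG$ the disjoint union of $k$ copies of $G$, and $G_1\vee G_2$ the join (the disjoint union together with all edges between $V(G_1)$ and $V(G_2)$). For $1\leq k\leq (n-1)/2$, $N_n^k=K_k\vee(K_{n-2k}+kK_1)$. For $0\leq k\leq n/2-1$, $\underline{N}_n^k=K_k\vee(K_{n-2k-1}+(k+1)K_1)$ (for $k=0$ this is $K_{n-1}+K_1$). -}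

module Defs where

open import Data.Bool.Base using (Bool; true; false; not; if_then_else_)
open import Data.Nat.Base as ℕ using (ℕ; zero; suc)
import Data.Nat.Properties as ℕ
open import Data.Integer.Base using (+_)
open import Data.Rational as ℚ using (ℚ; 0ℚ; 1ℚ; ∣_∣)
import Data.Rational.Properties as ℚ
open import Data.Rational.Solver using (module +-*-Solver)
open import Data.Fin.Base using (Fin; toℕ; splitAt)
open import Data.Fin.Properties using (_≟_)
import Data.Fin.Subset as Subset
open import Data.List.Base using (allFin; map)
open import Data.List.Extrema.Nat using (min)
open import Data.Product.Base using (∃; ∃₂; Σ-syntax; _×_; _,_)
open import Data.Sum.Base using (_⊎_; inj₁; inj₂)
import Data.Vec.Base as Vec
import Data.Vec.Functional as Vector
open import Function.Base using (_∘_)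
open import Function.Bundles using (_↔_; Inverse)
open import Function.Definitions using (Injective; StrictlySurjective)
open import Relation.Binary.PropositionalEquality
open import Relation.Nullary using (¬_; does; yes; no; contradiction)

-- Real numbers are Cauchy sequences of rationals, with equality _≈_
-- meaning that the difference is a null sequence.

IsCauchy : (ℕ → ℚ) → Set
IsCauchy x = ∀ ε → 0ℚ ℚ.< ε →
  ∃ λ N → ∀ m n → N ℕ.≤ m → N ℕ.≤ n → ∣ x m ℚ.- x n ∣ ℚ.≤ ε

record ℝ : Set where
  constructor mkℝ
  field
    seq    : ℕ → ℚ
    cauchy : IsCauchy seq

open ℝ public

infix  4 _≈_ _≤ᴿ_
infixl 6 _+ᴿ_
infixl 7 _*ᴿ_

_≈_ : ℝ → ℝ → Set
x ≈ y = ∀ ε → 0ℚ ℚ.< ε →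
  ∃ λ N → ∀ n → N ℕ.≤ n → ∣ seq x n ℚ.- seq y n ∣ ℚ.≤ ε

_≤ᴿ_ : ℝ → ℝ → Set
x ≤ᴿ y = ∀ ε → 0ℚ ℚ.< ε →
  ∃ λ N → ∀ n → N ℕ.≤ n → seq x n ℚ.≤ seq y n ℚ.+ ε

fromℚ : ℚ → ℝ
fromℚ p = mkℝ (λ _ → p) λ ε 0<ε → 0 , λ _ _ _ _ →
  subst (λ d → ∣ d ∣ ℚ.≤ ε) (sym (ℚ.+-inverseʳ p)) (ℚ.<⇒≤ 0<ε)

fromℕ : ℕ → ℝ
fromℕ n = fromℚ (+ n ℚ./ 1)

0ᴿ 1ᴿ : ℝ
0ᴿ = fromℕ 0
1ᴿ = fromℕ 1

private
  module _ where
    open +-*-Solver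

    split-diff : ∀ a b → a ≡ (a ℚ.- b) ℚ.+ b
    split-diff = solve 2 (λ a b → a := (a :- b) :+ b) refl

    swap-* : ∀ a b c → a ℚ.* (b ℚ.* c) ≡ b ℚ.* (a ℚ.* c)
    swap-* = solve 3 (λ a b c → a :* (b :* c) := b :* (a :* c)) refl

    diff-+ : ∀ a b c d →
      (a ℚ.+ b) ℚ.- (c ℚ.+ d) ≡ (a ℚ.- c) ℚ.+ (b ℚ.- d)
    diff-+ = solve 4 (λ a b c d →
      (a :+ b) :- (c :+ d) := (a :- c) :+ (b :- d)) refl

    diff-* : ∀ a b c d →
      a ℚ.* b ℚ.- c ℚ.* d ≡ a ℚ.* (b ℚ.- d) ℚ.+ d ℚ.* (a ℚ.- c)
    diff-* = solve 4 (λ a b c d →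
      a :* b :- c :* d := a :* (b :- d) :+ d :* (a :- c)) refl

  0<+ : ∀ {p q} → 0ℚ ℚ.< p → 0ℚ ℚ.≤ q → 0ℚ ℚ.< p ℚ.+ q
  0<+ {p} {q} 0<p 0≤q = subst (ℚ._< p ℚ.+ q) (ℚ.+-identityʳ 0ℚ)
                          (ℚ.+-mono-<-≤ 0<p 0≤q)

  0<1 : 0ℚ ℚ.< 1ℚ
  0<1 = ℚ.positive⁻¹ 1ℚ

  -- δ = ε / (B + C)
  tolerance : ∀ {ε B C} → 0ℚ ℚ.< ε → 0ℚ ℚ.< B → 0ℚ ℚ.< C →
              ∃ λ δ → (0ℚ ℚ.< δ) × (B ℚ.* δ ℚ.+ C ℚ.* δ ≡ ε)
  tolerance {ε} {B} {C} 0<ε 0<B 0<C = ε ℚ.* D⁻¹ , ℚ.positive⁻¹ _ , (begin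
    B ℚ.* (ε ℚ.* D⁻¹) ℚ.+ C ℚ.* (ε ℚ.* D⁻¹)
      ≡⟨ sym (ℚ.*-distribʳ-+ (ε ℚ.* D⁻¹) B C) ⟩
    D ℚ.* (ε ℚ.* D⁻¹) ≡⟨ swap-* D ε D⁻¹ ⟩
    ε ℚ.* (D ℚ.* D⁻¹) ≡⟨ cong (ε ℚ.*_) (ℚ.*-inverseʳ D) ⟩
    ε ℚ.* 1ℚ          ≡⟨ ℚ.*-identityʳ ε ⟩
    ε                 ∎)
    where
    open ≡-Reasoning
    D : ℚ
    D = B ℚ.+ C
    instance
      posε = ℚ.positive 0<ε
      posD = ℚ.positive (0<+ 0<B (ℚ.<⇒≤ 0<C))
      nzD  = ℚ.pos⇒nonZero D
    D⁻¹ : ℚ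
    D⁻¹ = ℚ.1/ D
    instance
      posD⁻¹  = ℚ.1/pos⇒pos D
      posεD⁻¹ = ℚ.pos*pos⇒pos ε D⁻¹

  half : ∀ {ε} → 0ℚ ℚ.< ε → ∃ λ δ → (0ℚ ℚ.< δ) × (δ ℚ.+ δ ≡ ε)
  half 0<ε = let δ , 0<δ , eq = tolerance 0<ε 0<1 0<1 in
    δ , 0<δ , trans (sym (cong₂ ℚ._+_ (ℚ.*-identityˡ δ) (ℚ.*-identityˡ δ))) eq

  ∣a∣≤ : ∀ a b {r} → ∣ a ℚ.- b ∣ ℚ.≤ r → ∣ a ∣ ℚ.≤ r ℚ.+ ∣ b ∣
  ∣a∣≤ a b {r} a-b≤r = begin
    ∣ a ∣                   ≡⟨ cong ∣_∣ (split-diff a b) ⟩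
    ∣ (a ℚ.- b) ℚ.+ b ∣     ≤⟨ ℚ.∣p+q∣≤∣p∣+∣q∣ (a ℚ.- b) b ⟩
    ∣ a ℚ.- b ∣ ℚ.+ ∣ b ∣   ≤⟨ ℚ.+-monoˡ-≤ ∣ b ∣ a-b≤r ⟩
    r ℚ.+ ∣ b ∣             ∎
    where open ℚ.≤-Reasoning

  diff-+-≤ : ∀ a b c d {r s} → ∣ a ℚ.- c ∣ ℚ.≤ r → ∣ b ℚ.- d ∣ ℚ.≤ s →
             ∣ (a ℚ.+ b) ℚ.- (c ℚ.+ d) ∣ ℚ.≤ r ℚ.+ s
  diff-+-≤ a b c d {r} {s} ac bd = begin
    ∣ (a ℚ.+ b) ℚ.- (c ℚ.+ d) ∣     ≡⟨ cong ∣_∣ (diff-+ a b c d) ⟩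
    ∣ (a ℚ.- c) ℚ.+ (b ℚ.- d) ∣     ≤⟨ ℚ.∣p+q∣≤∣p∣+∣q∣ (a ℚ.- c) (b ℚ.- d) ⟩
    ∣ a ℚ.- c ∣ ℚ.+ ∣ b ℚ.- d ∣     ≤⟨ ℚ.+-mono-≤ ac bd ⟩
    r ℚ.+ s                         ∎
    where open ℚ.≤-Reasoning

  ∣*∣-≤ : ∀ a b {r s} → 0ℚ ℚ.≤ r → ∣ a ∣ ℚ.≤ r → ∣ b ∣ ℚ.≤ s →
          ∣ a ℚ.* b ∣ ℚ.≤ r ℚ.* s
  ∣*∣-≤ a b {r} {s} 0≤r a≤r b≤s = begin
    ∣ a ℚ.* b ∣       ≡⟨ ℚ.∣p*q∣≡∣p∣*∣q∣ a b ⟩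
    ∣ a ∣ ℚ.* ∣ b ∣   ≤⟨ ℚ.*-monoʳ-≤-nonNeg ∣ b ∣
                           {{ℚ.nonNegative (ℚ.0≤∣p∣ b)}} a≤r ⟩
    r ℚ.* ∣ b ∣       ≤⟨ ℚ.*-monoˡ-≤-nonNeg r {{ℚ.nonNegative 0≤r}} b≤s ⟩
    r ℚ.* s           ∎
    where open ℚ.≤-Reasoning

  diff-*-≤ : ∀ a b c d {B C δ} → 0ℚ ℚ.≤ B → 0ℚ ℚ.≤ C →
             ∣ a ∣ ℚ.≤ B → ∣ d ∣ ℚ.≤ C →
             ∣ a ℚ.- c ∣ ℚ.≤ δ → ∣ b ℚ.- d ∣ ℚ.≤ δ →
             ∣ a ℚ.* b ℚ.- c ℚ.* d ∣ ℚ.≤ B ℚ.* δ ℚ.+ C ℚ.* δ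
  diff-*-≤ a b c d {B} {C} {δ} 0≤B 0≤C a≤B d≤C ac bd = begin
    ∣ a ℚ.* b ℚ.- c ℚ.* d ∣
      ≡⟨ cong ∣_∣ (diff-* a b c d) ⟩
    ∣ a ℚ.* (b ℚ.- d) ℚ.+ d ℚ.* (a ℚ.- c) ∣
      ≤⟨ ℚ.∣p+q∣≤∣p∣+∣q∣ (a ℚ.* (b ℚ.- d)) (d ℚ.* (a ℚ.- c)) ⟩
    ∣ a ℚ.* (b ℚ.- d) ∣ ℚ.+ ∣ d ℚ.* (a ℚ.- c) ∣
      ≤⟨ ℚ.+-mono-≤ (∣*∣-≤ a (b ℚ.- d) 0≤B a≤B bd)
                    (∣*∣-≤ d (a ℚ.- c) 0≤C d≤C ac) ⟩
    B ℚ.* δ ℚ.+ C ℚ.* δ ∎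
    where open ℚ.≤-Reasoning

  bounded : ∀ {x} → IsCauchy x → ∃₂ λ B N → (0ℚ ℚ.< B) ×
            (∀ n → N ℕ.≤ n → ∣ x n ∣ ℚ.≤ B)
  bounded {x} x-cauchy =
    let N , close = x-cauchy 1ℚ 0<1 in
    1ℚ ℚ.+ ∣ x N ∣ , N , 0<+ 0<1 (ℚ.0≤∣p∣ (x N)) ,
    λ n N≤n → ∣a∣≤ (x n) (x N) (close n N N≤n ℕ.≤-refl)

  -- Abstract, so that normalising a real does not unfold its modulus.
  abstract
    +-cauchy : ∀ x y → IsCauchy x → IsCauchy y →
               IsCauchy (λ n → x n ℚ.+ y n)
    +-cauchy x y x-cauchy y-cauchy ε 0<ε =
      let δ , 0<δ , δ+δ≡ε = half 0<ε
          M , closeˣ = x-cauchy δ 0<δ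
          N , closeʸ = y-cauchy δ 0<δ
      in M ℕ.⊔ N , λ m n m≥ n≥ →
      ℚ.≤-trans
        (diff-+-≤ (x m) (y m) (x n) (y n)
          (closeˣ m n (ℕ.m⊔n≤o⇒m≤o M N m≥) (ℕ.m⊔n≤o⇒m≤o M N n≥))
          (closeʸ m n (ℕ.m⊔n≤o⇒n≤o M N m≥) (ℕ.m⊔n≤o⇒n≤o M N n≥)))
        (ℚ.≤-reflexive δ+δ≡ε)

    *-cauchy : ∀ x y → IsCauchy x → IsCauchy y →
               IsCauchy (λ n → x n ℚ.* y n)
    *-cauchy x y x-cauchy y-cauchy ε 0<ε =
      let B , K , 0<B , boundˣ = bounded x-cauchy
          C , L , 0<C , boundʸ = bounded y-cauchy
          δ , 0<δ , Bδ+Cδ≡ε = tolerance 0<ε 0<B 0<C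
          M , closeˣ = x-cauchy δ 0<δ
          N , closeʸ = y-cauchy δ 0<δ
          ≥KL : ∀ {i} → (K ℕ.⊔ L) ℕ.⊔ (M ℕ.⊔ N) ℕ.≤ i → K ℕ.⊔ L ℕ.≤ i
          ≥KL = ℕ.m⊔n≤o⇒m≤o (K ℕ.⊔ L) (M ℕ.⊔ N)
          ≥MN : ∀ {i} → (K ℕ.⊔ L) ℕ.⊔ (M ℕ.⊔ N) ℕ.≤ i → M ℕ.⊔ N ℕ.≤ i
          ≥MN = ℕ.m⊔n≤o⇒n≤o (K ℕ.⊔ L) (M ℕ.⊔ N)
      in (K ℕ.⊔ L) ℕ.⊔ (M ℕ.⊔ N) , λ m n m≥ n≥ →
      ℚ.≤-trans
        (diff-*-≤ (x m) (y m) (x n) (y n) (ℚ.<⇒≤ 0<B) (ℚ.<⇒≤ 0<C)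
          (boundˣ m (ℕ.m⊔n≤o⇒m≤o K L (≥KL m≥)))
          (boundʸ n (ℕ.m⊔n≤o⇒n≤o K L (≥KL n≥)))
          (closeˣ m n (ℕ.m⊔n≤o⇒m≤o M N (≥MN m≥)) (ℕ.m⊔n≤o⇒m≤o M N (≥MN n≥)))
          (closeʸ m n (ℕ.m⊔n≤o⇒n≤o M N (≥MN m≥)) (ℕ.m⊔n≤o⇒n≤o M N (≥MN n≥))))
        (ℚ.≤-reflexive Bδ+Cδ≡ε)

_+ᴿ_ : ℝ → ℝ → ℝ
x +ᴿ y = mkℝ (λ n → seq x n ℚ.+ seq y n)
  (+-cauchy (seq x) (seq y) (cauchy x) (cauchy y))

_*ᴿ_ : ℝ → ℝ → ℝ
x *ᴿ y = mkℝ (λ n → seq x n ℚ.* seq y n)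
  (*-cauchy (seq x) (seq y) (cauchy x) (cauchy y))

Matrix : ℕ → Set
Matrix n = Fin n → Fin n → ℝ

∑ : ∀ {n} → (Fin n → ℝ) → ℝ
∑ = Vector.foldr _+ᴿ_ 0ᴿ

_·_ : ∀ {n} → Matrix n → (Fin n → ℝ) → (Fin n → ℝ)
(M · x) i = ∑ λ j → M i j *ᴿ x j

IsEigenvalue : ∀ {n} → Matrix n → ℝ → Set
IsEigenvalue {n} M λ′ = Σ[ x ∈ (Fin n → ℝ) ]
  ¬ (∀ i → x i ≈ 0ᴿ) × (∀ i → (M · x) i ≈ λ′ *ᴿ x i)

IsLargestEigenvalue : ∀ {n} → Matrix n → ℝ → Set
IsLargestEigenvalue M λ′ =
  IsEigenvalue M λ′ × (∀ μ → IsEigenvalue M μ → μ ≤ᴿ λ′)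

record Graph (n : ℕ) : Set where
  field
    adj    : Fin n → Fin n → Bool
    irrefl : ∀ u → adj u u ≡ false
    symm   : ∀ u v → adj u v ≡ adj v u

  Adj : Fin n → Fin n → Set
  Adj u v = adj u v ≡ true

open Graph public

infix 4 _≅_

_≅_ : ∀ {m n} → Graph m → Graph n → Set
_≅_ {m} {n} G H = Σ[ f ∈ Fin m ↔ Fin n ]
  (∀ u v → adj G u v ≡ adj H (Inverse.to f u) (Inverse.to f v))

degree : ∀ {n} → Graph n → Fin n → ℕ
degree G v = Subset.∣ Vec.tabulate (adj G v) ∣

-- The default value n is attained only for n ≡ 0, as degrees are
-- below n.
δ : ∀ {n} → Graph n → ℕ
δ {n} G = min n (map (degree G) (allFin n))

adjacencyMatrix degreeMatrix signlessLaplacian : ∀ {n} → Graph n → Matrix n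
adjacencyMatrix G i j   = if adj G i j then 1ᴿ else 0ᴿ
degreeMatrix G i j      = if does (i ≟ j) then fromℕ (degree G i) else 0ᴿ
signlessLaplacian G i j = adjacencyMatrix G i j +ᴿ degreeMatrix G i j

-- `Is-q G λ′` says that λ′ is the number q(G). The largest eigenvalue
-- is unique up to _≈_, since _≤ᴿ_ is antisymmetric up to _≈_.
Is-q : ∀ {n} → Graph n → ℝ → Set
Is-q G = IsLargestEigenvalue (signlessLaplacian G)

IsPath : ∀ {n l} → Graph n → (Fin l → Fin n) → Set
IsPath G p = Injective _≡_ _≡_ p ×
  (∀ i j → toℕ j ≡ suc (toℕ i) → Adj G (p i) (p j))

IsCycle : ∀ {n l} → Graph n → (Fin l → Fin n) → Set
IsCycle {l = l} G p = 3 ℕ.≤ l × IsPath G p ×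
  (∀ i j → toℕ i ≡ 0 → suc (toℕ j) ≡ l → Adj G (p j) (p i))

Traceable : ∀ {n} → Graph n → Set
Traceable {n} G = ∃ λ l → Σ[ p ∈ (Fin l → Fin n) ]
  IsPath G p × StrictlySurjective _≡_ p

Hamiltonian : ∀ {n} → Graph n → Set
Hamiltonian {n} G = ∃ λ l → Σ[ p ∈ (Fin l → Fin n) ]
  IsCycle G p × StrictlySurjective _≡_ p

K : ∀ n → Graph n
adj    (K n) u v = not (does (u ≟ v))
irrefl (K n) u with u ≟ u
... | yes _   = refl
... | no  u≢u = contradiction refl u≢u
symm   (K n) u v with u ≟ v | v ≟ u
... | yes _   | yes _   = refl
... | no  _   | no  _   = refl
... | yes u≡v | no  v≢u = contradiction (sym u≡v) v≢u
... | no  u≢v | yes v≡u = contradiction (sym v≡u) u≢v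

-- Vertices of G followed by those of H; b is the common adjacency value
-- of all pairs with one vertex in each.
combine : ∀ {m n} → Bool → Graph m → Graph n → Graph (m ℕ.+ n)
combine {m} {n} b G H = record
  { adj    = λ u v → adj′ (splitAt m u) (splitAt m v)
  ; irrefl = λ u → irrefl′ (splitAt m u)
  ; symm   = λ u v → symm′ (splitAt m u) (splitAt m v)
  }
  where
  adj′ : Fin m ⊎ Fin n → Fin m ⊎ Fin n → Bool
  adj′ (inj₁ u) (inj₁ v) = adj G u v
  adj′ (inj₂ u) (inj₂ v) = adj H u v
  adj′ (inj₁ _) (inj₂ _) = b
  adj′ (inj₂ _) (inj₁ _) = b

  irrefl′ : ∀ u → adj′ u u ≡ false
  irrefl′ (inj₁ u) = irrefl G u
  irrefl′ (inj₂ u) = irrefl H u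

  symm′ : ∀ u v → adj′ u v ≡ adj′ v u
  symm′ (inj₁ u) (inj₁ v) = symm G u v
  symm′ (inj₂ u) (inj₂ v) = symm H u v
  symm′ (inj₁ _) (inj₂ _) = refl
  symm′ (inj₂ _) (inj₁ _) = refl

infixr 6 _∪_
infixr 5 _∨_

_∪_ _∨_ : ∀ {m n} → Graph m → Graph n → Graph (m ℕ.+ n)
_∪_ = combine false
_∨_ = combine true

copies : ∀ k {n} → Graph n → Graph (k ℕ.* n)
copies zero    G = K 0
copies (suc k) G = G ∪ copies k G

-- The orders below are written as they arise from the construction;
-- they equal n when k ≤ (n - 1)/2 for N, resp. k ≤ n/2 - 1 for N̲.
N : ∀ n k → Graph (k ℕ.+ ((n ℕ.∸ 2 ℕ.* k) ℕ.+ k ℕ.* 1))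
N n k = K k ∨ (K (n ℕ.∸ 2 ℕ.* k) ∪ copies k (K 1))

N̲ : ∀ n k → Graph (k ℕ.+ ((n ℕ.∸ 2 ℕ.* k ℕ.∸ 1) ℕ.+ suc k ℕ.* 1))
N̲ n k = K k ∨ (K (n ℕ.∸ 2 ℕ.* k ℕ.∸ 1) ∪ copies (suc k) (K 1))

{-# OPTIONS --safe #-}
-- If G has no Hamiltonian cycle, then Chvátal's theorem gives an i such that the
-- degree sequence of G is dominated by that of N n i; for paths one passes to the
-- cone over G. Put weights w, increasing with the degree, on the three degree
-- classes of N n i, and on vertices of G accordingly. Degree domination alone
-- implies that the signless Laplacian Q of G satisfies Q w ≤ h w if that of N n i
-- does. Pairing with |x| for an eigenvector x of eigenvalue q ≥ h (Collatz-Wielandt)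
-- forces x to vanish at every vertex at which the inequality is strict, and then
-- on the neighbours of such a vertex.
-- For i > k, degree weights work with h = 2(n - k - 1), twice the degree in the
-- clique of N n k, which is at most q(N n k). For i = k, take w to be the Perron
-- vector of N n k, given by the largest root h of a cubic, which bisection
-- constructs; if G ≠ N n k, some vertex is strict and x vanishes altogether.
module Submission where

open import Defs
open import Data.Nat
  using (ℕ; zero; suc; pred; _+_; _*_; _∸_; _^_; _≤_; _<_; _≤ᵇ_; _⊔_; _/_; z≤n; s≤s; NonZero; >-nonZero)
open import Data.Product using (_×_; _,_; proj₁; proj₂; ∃; ∃₂; Σ-syntax)
open import Data.Sum using (_⊎_; inj₁; inj₂; [_,_]′)
open import Data.Bool.Base using (Bool; true; false; not; if_then_else_)
import Data.Bool.Base as 𝔹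
open import Data.Empty using (⊥; ⊥-elim)
open import Data.Fin.Base using (Fin; zero; suc; toℕ; splitAt; punchIn; _↑ˡ_; _↑ʳ_)
import Data.Fin.Base as Fin
import Data.Fin.Properties as Fin
import Data.Bool.Properties as Bool
open import Data.Fin.Permutation using (Permutation; _⟨$⟩ʳ_; insert; insert-punchIn) renaming (id to idᵖ)
open import Function.Bundles using (Inverse; Equivalence)
import Data.Fin.Subset as Subset
import Data.Vec.Base as Vec
import Data.Integer.Base as ℤ
import Data.Integer.Properties as ℤ
import Data.Nat.Properties as ℕ
import Data.Nat.DivMod as ℕ
open import Data.Nat.Tactic.RingSolver using () renaming (solve-∀ to solve-ℕ)
open import Data.Rational as ℚ using (ℚ; 0ℚ; 1ℚ; ∣_∣)
  renaming (_+_ to _+ℚ_; _*_ to _*ℚ_; _-_ to _-ℚ_; -_ to -ℚ_; _≤_ to _≤ℚ_; _<_ to _<ℚ_)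
import Data.Rational.Properties as ℚ
import Data.Rational.Unnormalised.Base as ℚᵘ
import Data.Rational.Unnormalised.Properties as ℚᵘ
open import Data.List.Base using (List; []; _∷_; _++_; length; reverse; allFin; map; lookup; tabulate)
open import Function.Base using (_∘_; id; case_of_)
open import Level using (0ℓ)
open import Relation.Binary.PropositionalEquality
open import Relation.Nullary using (¬_; Dec; yes; no; does; contradiction)
open import Relation.Nullary.Decidable using (dec⇒maybe; _⊎-dec_)
open import Tactic.RingSolver using (solve-∀)
open import Tactic.RingSolver.Core.AlmostCommutativeRing using (AlmostCommutativeRing; fromCommutativeRing)
import Algebra.Properties.Semiring.Sum as Sum
open import Algebra.Bundles using (CommutativeRing)
open import Data.List.Membership.Propositional using (_∈_)
open import Data.List.Membership.Propositional.Properties using (∈-allFin; ∈-lookup; ∈-map⁻; ∈-map⁺)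
open import Data.List.Relation.Unary.Any using (here; there; index)
open import Data.List.Relation.Unary.Any.Properties using (lookup-index)
open import Data.List.Relation.Unary.All using (All; []; _∷_)
import Data.List.Relation.Unary.All as All
open import Data.List.Relation.Unary.AllPairs using ([]; _∷_)
open import Data.List.Relation.Unary.Unique.Propositional using (Unique)
open import Data.List.Relation.Unary.Unique.Propositional.Properties using (allFin⁺; map⁻)
open import Data.List.Relation.Binary.Permutation.Propositional using (_↭_; ↭-trans; ↭-sym; ↭-refl; ↭-prep)
import Data.List.Relation.Binary.Permutation.Propositional as Perm
import Data.List.Relation.Binary.Permutation.Propositional.Properties as ↭
import Data.List.Properties as List
import Data.List.Relation.Binary.Permutation.Setoid.Properties as Permutationₛ
open import Data.List.Extrema.Nat using (min≤xs)

-- Reals are Cauchy sequences, whose order and sign are undecidable, and this shapes the argument.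
-- Inequalities are proved index by index between rational sequences and compared up to null
-- sequences; whatever has to be strict, such as a weight or a gap between two weights, is bounded
-- below by one positive rational at all indices. The outcome is always that an eigenvector is null,
-- against its being nonzero; this suffices because it only has to refute the failure of decidable
-- adjacency conditions. Two kinds of weights occur because `i = k` includes the equality case:
-- there `h` must itself be an eigenvalue of the extremal graph, so no slack is left except at a
-- wrongly joined pair. For `i > k` the size of `n` leaves a whole unit of slack at every low
-- vertex, and integer weights are enough. The most demanding row is that of a top vertex at
-- `i = k + 1`, which is where the quadratic bound on `n` comes from. The path statement admits
-- `k = 0`, where the extremal graph is disconnected and has no positive Perron vector, so that case
-- gets weights of its own.

infix 4 _≲_

-- Rational arithmetic

ℚ-ring : AlmostCommutativeRing 0ℓ 0ℓ
ℚ-ring = fromCommutativeRing ℚ.+-*-commutativeRing λ x → dec⇒maybe (0ℚ ℚ.≟ x)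

-- Opaque, since unfolding ι n normalises a fraction with a symbolic numerator.
opaque
  ι : ℕ → ℚ
  ι n = ℤ.+ n ℚ./ 1

  ι-/1 : ∀ n → ι n ≡ ℤ.+ n ℚ./ 1
  ι-/1 n = refl

private
  toℚᵘ-ι : ∀ n → ℚ.toℚᵘ (ι n) ℚᵘ.≃ ℚᵘ.mkℚᵘ (ℤ.+ n) 0
  toℚᵘ-ι n = subst (λ p → ℚ.toℚᵘ p ℚᵘ.≃ ℚᵘ.mkℚᵘ (ℤ.+ n) 0) (sym (ι-/1 n))
    (ℚ.toℚᵘ-fromℚᵘ (ℚᵘ.mkℚᵘ (ℤ.+ n) 0))

ι-+ : ∀ m n → ι (m + n) ≡ ι m +ℚ ι n
ι-+ m n = ℚ.toℚᵘ-injective (begin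
  ℚ.toℚᵘ (ι (m + n))
    ≈⟨ toℚᵘ-ι (m + n) ⟩
  ℚᵘ.mkℚᵘ (ℤ.+ (m + n)) 0
    ≈⟨ ℚᵘ.*≡* (cong (ℤ._* ℤ.1ℤ) (sym (cong₂ ℤ._+_ (ℤ.*-identityʳ (ℤ.+ m)) (ℤ.*-identityʳ (ℤ.+ n))))) ⟩
  ℚᵘ.mkℚᵘ (ℤ.+ m) 0 ℚᵘ.+ ℚᵘ.mkℚᵘ (ℤ.+ n) 0
    ≈⟨ ℚᵘ.+-cong (ℚᵘ.≃-sym (toℚᵘ-ι m)) (ℚᵘ.≃-sym (toℚᵘ-ι n)) ⟩
  ℚ.toℚᵘ (ι m) ℚᵘ.+ ℚ.toℚᵘ (ι n)
    ≈⟨ ℚᵘ.≃-sym (ℚ.toℚᵘ-homo-+ (ι m) (ι n)) ⟩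
  ℚ.toℚᵘ (ι m +ℚ ι n) ∎)
  where open ℚᵘ.≃-Reasoning

ι-* : ∀ m n → ι (m * n) ≡ ι m *ℚ ι n
ι-* m n = ℚ.toℚᵘ-injective (begin
  ℚ.toℚᵘ (ι (m * n))
    ≈⟨ toℚᵘ-ι (m * n) ⟩
  ℚᵘ.mkℚᵘ (ℤ.+ (m * n)) 0
    ≈⟨ ℚᵘ.*≡* (cong (ℤ._* ℤ.1ℤ) (ℤ.pos-* m n)) ⟩
  ℚᵘ.mkℚᵘ (ℤ.+ m) 0 ℚᵘ.* ℚᵘ.mkℚᵘ (ℤ.+ n) 0
    ≈⟨ ℚᵘ.*-cong (ℚᵘ.≃-sym (toℚᵘ-ι m)) (ℚᵘ.≃-sym (toℚᵘ-ι n)) ⟩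
  ℚ.toℚᵘ (ι m) ℚᵘ.* ℚ.toℚᵘ (ι n)
    ≈⟨ ℚᵘ.≃-sym (ℚ.toℚᵘ-homo-* (ι m) (ι n)) ⟩
  ℚ.toℚᵘ (ι m *ℚ ι n) ∎)
  where open ℚᵘ.≃-Reasoning

0≤ι : ∀ n → 0ℚ ≤ℚ ι n
0≤ι n = subst (0ℚ ≤ℚ_) (sym (ι-/1 n)) (ℚ.nonNegative⁻¹ _ {{ℚ.normalize-nonNeg n 1}})

0<ι : ∀ n .{{_ : NonZero n}} → 0ℚ <ℚ ι n
0<ι n = subst (0ℚ <ℚ_) (sym (ι-/1 n)) (ℚ.positive⁻¹ _ {{ℚ.normalize-pos n 1}})

ι-1 : ι 1 ≡ 1ℚ
ι-1 = ι-/1 1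

0≤+ : ∀ {a b} → 0ℚ ≤ℚ a → 0ℚ ≤ℚ b → 0ℚ ≤ℚ a +ℚ b
0≤+ {a} {b} 0≤a 0≤b = ℚ.nonNegative⁻¹ _
  {{ℚ.nonNeg+nonNeg⇒nonNeg a {{ℚ.nonNegative 0≤a}} b {{ℚ.nonNegative 0≤b}}}}

0≤* : ∀ {a b} → 0ℚ ≤ℚ a → 0ℚ ≤ℚ b → 0ℚ ≤ℚ a *ℚ b
0≤* {a} {b} 0≤a 0≤b = ℚ.nonNegative⁻¹ _
  {{ℚ.nonNeg*nonNeg⇒nonNeg a {{ℚ.nonNegative 0≤a}} b {{ℚ.nonNegative 0≤b}}}}

0<* : ∀ {a b} → 0ℚ <ℚ a → 0ℚ <ℚ b → 0ℚ <ℚ a *ℚ b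
0<* {a} {b} 0<a 0<b = ℚ.positive⁻¹ _
  {{ℚ.pos*pos⇒pos a {{ℚ.positive 0<a}} b {{ℚ.positive 0<b}}}}

0≤- : ∀ {a b} → a ≤ℚ b → 0ℚ ≤ℚ b -ℚ a
0≤- {a} {b} a≤b = subst (_≤ℚ b -ℚ a) (ℚ.+-inverseʳ a) (ℚ.+-monoˡ-≤ (-ℚ a) a≤b)

≤-add : ∀ {a b} d → 0ℚ ≤ℚ d → b ≡ a +ℚ d → a ≤ℚ b
≤-add {a} {b} d 0≤d b≡a+d =
  subst₂ _≤ℚ_ (ℚ.+-identityʳ a) (sym b≡a+d) (ℚ.+-monoʳ-≤ a 0≤d)

ι-mono : ∀ {m n} → m ≤ n → ι m ≤ℚ ι n
ι-mono {m} {n} m≤n = ≤-add (ι (n ∸ m)) (0≤ι (n ∸ m))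
  (trans (cong ι (sym (ℕ.m+[n∸m]≡n m≤n))) (ι-+ m (n ∸ m)))

*-monoʳ : ∀ {a b} c → 0ℚ ≤ℚ c → a ≤ℚ b → c *ℚ a ≤ℚ c *ℚ b
*-monoʳ c 0≤c = ℚ.*-monoˡ-≤-nonNeg c {{ℚ.nonNegative 0≤c}}

*-mono : ∀ {a b c d} → 0ℚ ≤ℚ a → 0ℚ ≤ℚ d → a ≤ℚ b → c ≤ℚ d → a *ℚ c ≤ℚ b *ℚ d
*-mono {a} {b} {c} {d} 0≤a 0≤d a≤b c≤d = ℚ.≤-trans (*-monoʳ a 0≤a c≤d)
  (ℚ.*-monoʳ-≤-nonNeg d {{ℚ.nonNegative 0≤d}} a≤b)

divide : ∀ {ε C} → 0ℚ <ℚ ε → 0ℚ <ℚ C → ∃ λ η → 0ℚ <ℚ η × C *ℚ η ≡ ε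
divide {ε} {C} 0<ε 0<C = C⁻¹ *ℚ ε , 0<* (ℚ.positive⁻¹ C⁻¹ {{ℚ.1/pos⇒pos C}}) 0<ε ,
  trans (sym (ℚ.*-assoc C C⁻¹ ε))
    (trans (cong (_*ℚ ε) (ℚ.*-inverseʳ C)) (ℚ.*-identityˡ ε))
  where
  instance
    posC = ℚ.positive 0<C
    nzC  = ℚ.pos⇒nonZero C
  C⁻¹ : ℚ
  C⁻¹ = ℚ.1/ C

halve : ∀ {ε} → 0ℚ <ℚ ε → ∃ λ η → 0ℚ <ℚ η × η +ℚ η ≡ ε
halve {ε} 0<ε = let η , 0<η , eq = divide 0<ε (0<ι 2) in
  η , 0<η , trans (double η) eq
  where
  double : ∀ η → η +ℚ η ≡ ι 2 *ℚ η
  double η = trans (cong₂ _+ℚ_ (sym (ℚ.*-identityˡ η)) (sym (ℚ.*-identityˡ η)))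
    (trans (sym (ℚ.*-distribʳ-+ η 1ℚ 1ℚ)) (cong (_*ℚ η) (sym (ι-/1 2))))

-- With `d` the denominator of `ε`, the product `ε * d` is a positive integer, hence at least 1.
archimedean : ∀ b {ε} → 0ℚ <ℚ ε → ∃ λ n → ι b ≤ℚ ε *ℚ ι n
archimedean b {ε} 0<ε = b * d , (begin
  ι b               ≡⟨ ℚ.*-identityʳ (ι b) ⟨
  ι b *ℚ 1ℚ         ≤⟨ *-monoʳ (ι b) (0≤ι b) 1≤ε*d ⟩
  ι b *ℚ (ε *ℚ ι d) ≡⟨ swap (ι b) ε (ι d) ⟩
  ε *ℚ (ι b *ℚ ι d) ≡⟨ cong (ε *ℚ_) (sym (ι-* b d)) ⟩
  ε *ℚ ι (b * d)    ∎)
  where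
  open ℚ.≤-Reasoning
  d : ℕ
  d = ℚ.↧ₙ ε
  swap : ∀ a b c → a *ℚ (b *ℚ c) ≡ b *ℚ (a *ℚ c)
  swap = solve-∀ ℚ-ring
  1≤ε*d : 1ℚ ≤ℚ ε *ℚ ι d
  1≤ε*d = ℚ.toℚᵘ-cancel-≤ (ℚᵘ.≤-respʳ-≃
    (ℚᵘ.≃-sym (ℚᵘ.≃-trans (ℚ.toℚᵘ-homo-* ε (ι d)) (ℚᵘ.*-congˡ {ℚ.toℚᵘ ε} (toℚᵘ-ι d))))
    (≤-lemma ε (ℚ.positive 0<ε)))
    where
    ≤-lemma : ∀ p → ℚ.Positive p →
      ℚᵘ.1ℚᵘ ℚᵘ.≤ ℚ.toℚᵘ p ℚᵘ.* ℚᵘ.mkℚᵘ (ℤ.+ ℚ.↧ₙ p) 0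
    ≤-lemma (ℚ.mkℚ (ℤ.+ suc a) e _) _ = ℚᵘ.*≤* (subst₂ ℤ._≤_
      (trans (cong (λ x → ℤ.+ suc x) (sym (ℕ.*-identityʳ e))) (sym (ℤ.*-identityˡ (ℤ.+ (suc e * 1)))))
      (sym (ℤ.*-identityʳ (ℤ.+ suc a ℤ.* ℤ.+ suc e)))
      (ℤ.≤-trans (ℤ.+≤+ (ℕ.m≤n*m (suc e) (suc a))) (ℤ.≤-reflexive (ℤ.pos-* (suc a) (suc e)))))

open Sum (CommutativeRing.semiring ℚ.+-*-commutativeRing) public
  using (sum; sum-cong-≗; ∑-distrib-+; ∑-comm; *-distribˡ-sum)

sum-mono : ∀ {n} {a b : Fin n → ℚ} → (∀ i → a i ≤ℚ b i) → sum a ≤ℚ sum b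
sum-mono {zero}  a≤b = ℚ.≤-refl
sum-mono {suc n} a≤b = ℚ.+-mono-≤ (a≤b zero) (sum-mono (a≤b ∘ suc))

-- A wrongly joined pair changes a single term of a neighbourhood sum, so a gap at one index has to
-- survive summation.
sum-mono-gap : ∀ {n} {a b : Fin n → ℚ} {g} i → (∀ j → a j ≤ℚ b j) →
               a i +ℚ g ≤ℚ b i → sum a +ℚ g ≤ℚ sum b
sum-mono-gap {suc n} {a} {b} {g} zero a≤b gap = begin
  a zero +ℚ sum (a ∘ suc) +ℚ g   ≡⟨ swap (a zero) (sum (a ∘ suc)) g ⟩
  a zero +ℚ g +ℚ sum (a ∘ suc)   ≤⟨ ℚ.+-mono-≤ gap (sum-mono (a≤b ∘ suc)) ⟩
  b zero +ℚ sum (b ∘ suc)        ∎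
  where
  open ℚ.≤-Reasoning
  swap : ∀ x y z → x +ℚ y +ℚ z ≡ x +ℚ z +ℚ y
  swap = solve-∀ ℚ-ring
sum-mono-gap {suc n} {a} {b} {g} (suc i) a≤b gap = begin
  a zero +ℚ sum (a ∘ suc) +ℚ g     ≡⟨ ℚ.+-assoc (a zero) (sum (a ∘ suc)) g ⟩
  a zero +ℚ (sum (a ∘ suc) +ℚ g)   ≤⟨ ℚ.+-mono-≤ (a≤b zero) (sum-mono-gap i (a≤b ∘ suc) gap) ⟩
  b zero +ℚ sum (b ∘ suc)          ∎
  where open ℚ.≤-Reasoning

sum-nonneg : ∀ {n} {a : Fin n → ℚ} → (∀ i → 0ℚ ≤ℚ a i) → 0ℚ ≤ℚ sum a
sum-nonneg {zero}  0≤a = ℚ.≤-refl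
sum-nonneg {suc n} 0≤a = 0≤+ (0≤a zero) (sum-nonneg (0≤a ∘ suc))

∣sum∣≤ : ∀ {n} (a : Fin n → ℚ) → ∣ sum a ∣ ≤ℚ sum (∣_∣ ∘ a)
∣sum∣≤ {zero}  a = ℚ.≤-refl
∣sum∣≤ {suc n} a = ℚ.≤-trans (ℚ.∣p+q∣≤∣p∣+∣q∣ (a zero) _)
  (ℚ.+-monoʳ-≤ ∣ a zero ∣ (∣sum∣≤ (a ∘ suc)))

≤-sum : ∀ {n} {a : Fin n → ℚ} → (∀ i → 0ℚ ≤ℚ a i) → ∀ i → a i ≤ℚ sum a
≤-sum {suc n} {a} 0≤a zero = ≤-add _ (sum-nonneg (0≤a ∘ suc)) refl
≤-sum {suc n} {a} 0≤a (suc i) = ℚ.≤-trans (≤-sum (0≤a ∘ suc) i)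
  (≤-add (a zero) (0≤a zero) (ℚ.+-comm (a zero) (sum (a ∘ suc))))

-- Asymptotic comparison of rational sequences

Sequence : Set
Sequence = ℕ → ℚ

-- The order _≤ᴿ_ on the underlying sequences, without the Cauchy condition.
record _≲_ (a b : Sequence) : Set where
  constructor mk≲
  field
    eventually : ∀ ε → 0ℚ <ℚ ε → ∃ λ N → ∀ n → N ≤ n → a n ≤ℚ b n +ℚ ε

open _≲_

Bounded : Sequence → Set
Bounded a = ∃₂ λ B M → 0ℚ <ℚ B × (∀ n → M ≤ n → a n ≤ℚ B)

0ˢ : Sequence
0ˢ _ = 0ℚ

≤⇒≲ : ∀ {a b} → (∀ n → a n ≤ℚ b n) → a ≲ b
≤⇒≲ {a} {b} a≤b = mk≲ λ ε 0<ε → 0 , λ n _ →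
  ℚ.≤-trans (a≤b n) (≤-add ε (ℚ.<⇒≤ 0<ε) refl)

≲-trans : ∀ {a b c} → a ≲ b → b ≲ c → a ≲ c
≲-trans {a} {b} {c} (mk≲ a≲b) (mk≲ b≲c) = mk≲ λ ε 0<ε →
  let η , 0<η , η+η≡ε = halve 0<ε
      M , a≤b+η = a≲b η 0<η
      M′ , b≤c+η = b≲c η 0<η
  in M ⊔ M′ , λ n n≥ → begin
    a n               ≤⟨ a≤b+η n (ℕ.m⊔n≤o⇒m≤o M M′ n≥) ⟩
    b n +ℚ η          ≤⟨ ℚ.+-monoˡ-≤ η (b≤c+η n (ℕ.m⊔n≤o⇒n≤o M M′ n≥)) ⟩
    c n +ℚ η +ℚ η     ≡⟨ ℚ.+-assoc (c n) η η ⟩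
    c n +ℚ (η +ℚ η)   ≡⟨ cong (c n +ℚ_) η+η≡ε ⟩
    c n +ℚ ε          ∎
  where open ℚ.≤-Reasoning

+-mono-≲ : ∀ {a b c d} → a ≲ b → c ≲ d → (λ n → a n +ℚ c n) ≲ (λ n → b n +ℚ d n)
+-mono-≲ {a} {b} {c} {d} (mk≲ a≲b) (mk≲ c≲d) = mk≲ λ ε 0<ε →
  let η , 0<η , η+η≡ε = halve 0<ε
      M , a≤b+η = a≲b η 0<η
      M′ , c≤d+η = c≲d η 0<η
  in M ⊔ M′ , λ n n≥ → begin
    a n +ℚ c n                  ≤⟨ ℚ.+-mono-≤ (a≤b+η n (ℕ.m⊔n≤o⇒m≤o M M′ n≥))
                                              (c≤d+η n (ℕ.m⊔n≤o⇒n≤o M M′ n≥)) ⟩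
    (b n +ℚ η) +ℚ (d n +ℚ η)    ≡⟨ shuffle (b n) (d n) η ⟩
    b n +ℚ d n +ℚ (η +ℚ η)      ≡⟨ cong (b n +ℚ d n +ℚ_) η+η≡ε ⟩
    b n +ℚ d n +ℚ ε             ∎
  where
  open ℚ.≤-Reasoning
  shuffle : ∀ x y z → (x +ℚ z) +ℚ (y +ℚ z) ≡ x +ℚ y +ℚ (z +ℚ z)
  shuffle = solve-∀ ℚ-ring

+-cancelʳ-≲ : ∀ {a b} (c : Sequence) → (λ n → a n +ℚ c n) ≲ (λ n → b n +ℚ c n) → a ≲ b
+-cancelʳ-≲ {a} {b} c (mk≲ a+c≲b+c) = mk≲ λ ε 0<ε → let M , le = a+c≲b+c ε 0<ε in
  M , λ n n≥ → subst₂ _≤ℚ_ (left (a n) (c n)) (right (b n) (c n) ε)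
    (ℚ.+-monoˡ-≤ (-ℚ c n) (le n n≥))
  where
  left : ∀ x y → x +ℚ y -ℚ y ≡ x
  left = solve-∀ ℚ-ring
  right : ∀ x y z → x +ℚ y +ℚ z -ℚ y ≡ x +ℚ z
  right = solve-∀ ℚ-ring

-- The factor varies with the index, so an eventual bound `C` on it is what turns an error `ε / C`
-- into `ε`.
*-mono-≲ : ∀ {a b c} → (∀ n → 0ℚ ≤ℚ c n) → Bounded c → a ≲ b →
           (λ n → c n *ℚ a n) ≲ (λ n → c n *ℚ b n)
*-mono-≲ {a} {b} {c} 0≤c (C , M , 0<C , c≤C) (mk≲ a≲b) = mk≲ λ ε 0<ε →
  let η , 0<η , Cη≡ε = divide 0<ε 0<C
      M′ , a≤b+η = a≲b η 0<η
  in M ⊔ M′ , λ n n≥ → begin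
    c n *ℚ a n                 ≤⟨ *-monoʳ (c n) (0≤c n) (a≤b+η n (ℕ.m⊔n≤o⇒n≤o M M′ n≥)) ⟩
    c n *ℚ (b n +ℚ η)          ≡⟨ ℚ.*-distribˡ-+ (c n) (b n) η ⟩
    c n *ℚ b n +ℚ c n *ℚ η     ≤⟨ ℚ.+-monoʳ-≤ (c n *ℚ b n) (ℚ.*-monoʳ-≤-nonNeg η {{ℚ.nonNegative (ℚ.<⇒≤ 0<η)}}
                                    (c≤C n (ℕ.m⊔n≤o⇒m≤o M M′ n≥))) ⟩
    c n *ℚ b n +ℚ C *ℚ η       ≡⟨ cong (c n *ℚ b n +ℚ_) Cη≡ε ⟩
    c n *ℚ b n +ℚ ε            ∎
  where open ℚ.≤-Reasoning

-- Positivity at each index would not do, since the factor could tend to zero; hence the uniform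
-- lower bound `ω`.
*-cancelˡ-≲ : ∀ {a b} {c : Sequence} {ω} → 0ℚ <ℚ ω → (∀ n → ω ≤ℚ c n) →
              (λ n → c n *ℚ a n) ≲ (λ n → c n *ℚ b n) → a ≲ b
*-cancelˡ-≲ {a} {b} {c} {ω} 0<ω ω≤c (mk≲ ca≲cb) = mk≲ λ ε 0<ε →
  let M , le = ca≲cb (ω *ℚ ε) (0<* 0<ω 0<ε) in
  M , λ n n≥ → ℚ.*-cancelˡ-≤-pos (c n) {{ℚ.positive (ℚ.<-≤-trans 0<ω (ω≤c n))}} (begin
    c n *ℚ a n                 ≤⟨ le n n≥ ⟩
    c n *ℚ b n +ℚ ω *ℚ ε       ≤⟨ ℚ.+-monoʳ-≤ (c n *ℚ b n) (ℚ.*-monoʳ-≤-nonNeg ε {{ℚ.nonNegative (ℚ.<⇒≤ 0<ε)}} (ω≤c n)) ⟩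
    c n *ℚ b n +ℚ c n *ℚ ε     ≡⟨ ℚ.*-distribˡ-+ (c n) (b n) ε ⟨
    c n *ℚ (b n +ℚ ε)          ∎)
  where open ℚ.≤-Reasoning

sum-mono-≲ : ∀ {n} {a b : Fin n → Sequence} → (∀ i → a i ≲ b i) →
             (λ j → sum λ i → a i j) ≲ (λ j → sum λ i → b i j)
sum-mono-≲ {zero}  a≲b = ≤⇒≲ λ _ → ℚ.≤-refl
sum-mono-≲ {suc n} a≲b = +-mono-≲ (a≲b zero) (sum-mono-≲ (a≲b ∘ suc))

≲-refl : ∀ {a} → a ≲ a
≲-refl = ≤⇒≲ λ _ → ℚ.≤-refl

-- All terms but one are ordered against the inequality of the sums, so they can be cancelled from
-- it and leave the remaining term.
sum-squeeze : ∀ {n} {a b : Fin n → Sequence} → (∀ i → b i ≲ a i) →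
              (λ j → sum λ i → a i j) ≲ (λ j → sum λ i → b i j) → ∀ i → a i ≲ b i
sum-squeeze {suc n} {a} {b} b≲a ∑a≲∑b zero = +-cancelʳ-≲ (λ j → sum λ i → a (suc i) j)
  (≲-trans ∑a≲∑b (+-mono-≲ {b zero} ≲-refl (sum-mono-≲ (b≲a ∘ suc))))
sum-squeeze {suc n} {a} {b} b≲a ∑a≲∑b (suc i) = sum-squeeze (b≲a ∘ suc)
  (+-cancelʳ-≲ (a zero) (≲-trans
    (≤⇒≲ λ j → ℚ.≤-reflexive (ℚ.+-comm (sum λ i → a (suc i) j) (a zero j)))
    (≲-trans ∑a≲∑b (≲-trans (+-mono-≲ (b≲a zero) (≲-refl {λ j → sum λ i → b (suc i) j}))
      (≤⇒≲ λ j → ℚ.≤-reflexive (ℚ.+-comm (a zero j) (sum λ i → b (suc i) j))))))) i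

cauchy⇒bounded : ∀ x → Bounded (λ n → ∣ seq x n ∣)
cauchy⇒bounded x = let M , close = cauchy x 1ℚ 0<1 in
  1ℚ +ℚ ∣ seq x M ∣ , M ,
  ℚ.<-≤-trans 0<1 (≤-add ∣ seq x M ∣ (ℚ.0≤∣p∣ (seq x M)) refl) , λ n M≤n → begin
    ∣ seq x n ∣                             ≡⟨ cong ∣_∣ (split (seq x n) (seq x M)) ⟩
    ∣ (seq x n -ℚ seq x M) +ℚ seq x M ∣     ≤⟨ ℚ.∣p+q∣≤∣p∣+∣q∣ (seq x n -ℚ seq x M) (seq x M) ⟩
    ∣ seq x n -ℚ seq x M ∣ +ℚ ∣ seq x M ∣   ≤⟨ ℚ.+-monoˡ-≤ ∣ seq x M ∣ (close n M M≤n ℕ.≤-refl) ⟩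
    1ℚ +ℚ ∣ seq x M ∣                       ∎
  where
  open ℚ.≤-Reasoning
  0<1 : 0ℚ <ℚ 1ℚ
  0<1 = ℚ.positive⁻¹ 1ℚ
  split : ∀ a b → a ≡ (a -ℚ b) +ℚ b
  split = solve-∀ ℚ-ring

-- The operator Q on rational vectors

count : ∀ {n} → (Fin n → Bool) → ℕ
count p = Subset.∣ Vec.tabulate p ∣

count-suc : ∀ {n} (p : Fin (suc n) → Bool) →
            count p ≡ (if p zero then 1 else 0) + count (p ∘ suc)
count-suc p with p zero
... | true  = refl
... | false = refl

infixl 8 _when_

_when_ : ℚ → Bool → ℚ
x when b = if b then x else 0ℚ

sum-indicator : ∀ {n} (p : Fin n → Bool) θ →
                sum (λ i → θ when p i) ≡ ι (count p) *ℚ θ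
sum-indicator {zero}  p θ = sym (trans (cong (_*ℚ θ) (ι-/1 0)) (ℚ.*-zeroˡ θ))
sum-indicator {suc n} p θ = begin
  θ when p zero +ℚ sum (λ i → θ when p (suc i))
    ≡⟨ cong₂ _+ℚ_ (head (p zero)) (sum-indicator (p ∘ suc) θ) ⟩
  ι (if p zero then 1 else 0) *ℚ θ +ℚ ι (count (p ∘ suc)) *ℚ θ
    ≡⟨ ℚ.*-distribʳ-+ θ (ι (if p zero then 1 else 0)) (ι (count (p ∘ suc))) ⟨
  (ι (if p zero then 1 else 0) +ℚ ι (count (p ∘ suc))) *ℚ θ
    ≡⟨ cong (_*ℚ θ) (ι-+ (if p zero then 1 else 0) (count (p ∘ suc))) ⟨
  ι ((if p zero then 1 else 0) + count (p ∘ suc)) *ℚ θ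
    ≡⟨ cong (λ c → ι c *ℚ θ) (count-suc p) ⟨
  ι (count p) *ℚ θ ∎
  where
  open ≡-Reasoning
  head : ∀ b → θ when b ≡ ι (if b then 1 else 0) *ℚ θ
  head true  = sym (trans (cong (_*ℚ θ) ι-1) (ℚ.*-identityˡ θ))
  head false = sym (trans (cong (_*ℚ θ) (ι-/1 0)) (ℚ.*-zeroˡ θ))

sum-zero : ∀ {n} → sum {n} (λ _ → 0ℚ) ≡ 0ℚ
sum-zero {zero}  = refl
sum-zero {suc n} = trans (ℚ.+-identityˡ (sum {n} λ _ → 0ℚ)) (sum-zero {n})

sum-point : ∀ {n} (i : Fin n) (c : Fin n → ℚ) →
            sum (λ j → c j when does (i Fin.≟ j)) ≡ c i
sum-point {suc n} zero c = trans (cong (c zero +ℚ_) (sum-zero {n})) (ℚ.+-identityʳ (c zero))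
sum-point (suc i) c = trans (ℚ.+-identityˡ _) (sum-point i (c ∘ suc))

∑ⁿ : ∀ {n} → Graph n → (Fin n → ℚ) → Fin n → ℚ
∑ⁿ G X v = sum λ u → X u when adj G v u

Q : ∀ {n} → Graph n → (Fin n → ℚ) → Fin n → ℚ
Q G X v = ι (degree G v) *ℚ X v +ℚ ∑ⁿ G X v

seq-∑ : ∀ {n} (f : Fin n → ℝ) j → seq (∑ f) j ≡ sum (λ i → seq (f i) j)
seq-∑ {zero}  f j = refl
seq-∑ {suc n} f j = cong (seq (f zero) j +ℚ_) (seq-∑ (f ∘ suc) j)

-- Real arithmetic acts on each index separately, so the real matrix product is the rational
-- operator `Q` at every index, with no error term.
seq-Q : ∀ {n} (G : Graph n) (x : Fin n → ℝ) v j →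
        seq ((signlessLaplacian G · x) v) j ≡ Q G (λ u → seq (x u) j) v
seq-Q G x v j = begin
  seq ((signlessLaplacian G · x) v) j
    ≡⟨ seq-∑ (λ u → signlessLaplacian G v u *ᴿ x u) j ⟩
  sum (λ u → seq (signlessLaplacian G v u) j *ℚ X u)
    ≡⟨ sum-cong-≗ entry ⟩
  sum (λ u → (d *ℚ X u) when does (v Fin.≟ u) +ℚ X u when adj G v u)
    ≡⟨ ∑-distrib-+ (λ u → (d *ℚ X u) when does (v Fin.≟ u)) (λ u → X u when adj G v u) ⟩
  sum (λ u → (d *ℚ X u) when does (v Fin.≟ u)) +ℚ ∑ⁿ G X v
    ≡⟨ cong (_+ℚ ∑ⁿ G X v) (sum-point v (λ u → d *ℚ X u)) ⟩
  Q G X v ∎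
  where
  open ≡-Reasoning
  X = λ u → seq (x u) j
  d = ι (degree G v)
  entry : ∀ u → seq (signlessLaplacian G v u) j *ℚ X u ≡
          (d *ℚ X u) when does (v Fin.≟ u) +ℚ X u when adj G v u
  entry u = entry′ (adj G v u) (does (v Fin.≟ u)) (X u)
    where
    entry′ : ∀ a b x →
      (seq (if a then 1ᴿ else 0ᴿ) j +ℚ seq (if b then fromℕ (degree G v) else 0ᴿ) j) *ℚ x ≡
      (d *ℚ x) when b +ℚ x when a
    entry′ true true x = trans (cong (λ e → (1ℚ +ℚ e) *ℚ x) (sym (ι-/1 (degree G v)))) (trans
      (ℚ.*-distribʳ-+ x 1ℚ d) (trans
      (ℚ.+-comm (1ℚ *ℚ x) (d *ℚ x)) (cong (d *ℚ x +ℚ_) (ℚ.*-identityˡ x))))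
    entry′ true false x = trans (ℚ.*-identityˡ x) (sym (ℚ.+-identityˡ x))
    entry′ false true x = trans (cong (_*ℚ x) (trans (ℚ.+-identityˡ _) (sym (ι-/1 (degree G v)))))
      (sym (ℚ.+-identityʳ (d *ℚ x)))
    entry′ false false x = ℚ.*-zeroˡ x

-- Self-adjointness, which moves `Q` from the eigenvector to the weight in the pairing.
Q-symmetric : ∀ {n} (G : Graph n) (w X : Fin n → ℚ) →
  sum (λ v → w v *ℚ Q G X v) ≡ sum (λ v → X v *ℚ Q G w v)
Q-symmetric {n} G w X = begin
  sum (λ v → w v *ℚ Q G X v)
    ≡⟨ expand w X ⟩
  sum (λ v → d v *ℚ w v *ℚ X v) +ℚ sum (λ v → sum λ u → w v *ℚ X u when adj G v u)
    ≡⟨ cong₂ _+ℚ_ (sum-cong-≗ λ v → swap (d v) (w v) (X v))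
        (trans (∑-comm (λ v u → w v *ℚ X u when adj G v u))
          (sum-cong-≗ λ u → sum-cong-≗ λ v → exchange u v)) ⟩
  sum (λ v → d v *ℚ X v *ℚ w v) +ℚ sum (λ v → sum λ u → X v *ℚ w u when adj G v u)
    ≡⟨ expand X w ⟨
  sum (λ v → X v *ℚ Q G w v) ∎
  where
  open ≡-Reasoning
  d = λ v → ι (degree G v)
  swap : ∀ a b c → a *ℚ b *ℚ c ≡ a *ℚ c *ℚ b
  swap = solve-∀ ℚ-ring
  distr : ∀ a b c e → b *ℚ (a *ℚ c +ℚ e) ≡ a *ℚ b *ℚ c +ℚ b *ℚ e
  distr = solve-∀ ℚ-ring
  exchange : ∀ u v → w v *ℚ X u when adj G v u ≡ X u *ℚ w v when adj G u v
  exchange u v rewrite symm G v u with adj G u v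
  ... | true  = ℚ.*-comm (w v) (X u)
  ... | false = trans (ℚ.*-zeroʳ (w v)) (sym (ℚ.*-zeroʳ (X u)))
  expand : ∀ a b → sum (λ v → a v *ℚ Q G b v) ≡
    sum (λ v → d v *ℚ a v *ℚ b v) +ℚ sum (λ v → sum λ u → a v *ℚ b u when adj G v u)
  expand a b = trans
    (sum-cong-≗ λ v → trans (distr (d v) (a v) (b v) (∑ⁿ G b v))
      (cong (d v *ℚ a v *ℚ b v +ℚ_) (*-distribˡ-sum (a v) (λ u → b u when adj G v u))))
    (∑-distrib-+ (λ v → d v *ℚ a v *ℚ b v) (λ v → sum λ u → a v *ℚ b u when adj G v u))

∑ⁿ≤Q : ∀ {n} (G : Graph n) {X} → (∀ v → 0ℚ ≤ℚ X v) → ∀ v → ∑ⁿ G X v ≤ℚ Q G X v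
∑ⁿ≤Q G {X} 0≤X v = ≤-add _ (0≤* (0≤ι (degree G v)) (0≤X v)) (ℚ.+-comm _ (∑ⁿ G X v))

neighbour≤Q : ∀ {n} (G : Graph n) {X} → (∀ v → 0ℚ ≤ℚ X v) → ∀ {v u} → Adj G v u → X u ≤ℚ Q G X v
neighbour≤Q G {X} 0≤X {v} {u} v~u = ℚ.≤-trans
  (subst (_≤ℚ ∑ⁿ G X v) (cong (λ b → X u when b) v~u) (≤-sum 0≤[] u))
  (∑ⁿ≤Q G 0≤X v)
  where
  0≤[] : ∀ u → 0ℚ ≤ℚ (X u when adj G v u)
  0≤[] u with adj G v u
  ... | true  = 0≤X u
  ... | false = ℚ.≤-refl

-- A weight w with Q w + s ≤ h w for some h ≲ μ: pairing the eigenvector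
-- inequality μ X ≲ Q X with w makes every slack term s v * X v null.
module CollatzWielandt {n} (G : Graph n) (X w : Fin n → Sequence) (μ h : Sequence) (s : Fin n → ℚ)
  (0≤X : ∀ v j → 0ℚ ≤ℚ X v j) (X-bounded : ∀ v → Bounded (X v))
  (μX≲QX : ∀ v → (λ j → μ j *ℚ X v j) ≲ (λ j → Q G (λ u → X u j) v))
  {ω : ℚ} (0<ω : 0ℚ <ℚ ω) (ω≤w : ∀ v j → ω ≤ℚ w v j) (w-bounded : ∀ v → Bounded (w v))
  (h≲μ : h ≲ μ) (0≤h : ∀ j → 0ℚ ≤ℚ h j) (h-bounded : Bounded h)
  (0≤s : ∀ v → 0ℚ ≤ℚ s v)
  (Qw+s≤hw : ∀ v j → Q G (λ u → w u j) v +ℚ s v ≤ℚ h j *ℚ w v j)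
  where

  private
    QX hX e f t : Fin n → Sequence
    QX v j = Q G (λ u → X u j) v
    hX v j = h j *ℚ X v j
    e v j = w v j *ℚ QX v j
    f v j = w v j *ℚ hX v j
    t v j = s v *ℚ X v j

    0≤w : ∀ v j → 0ℚ ≤ℚ w v j
    0≤w v j = ℚ.≤-trans (ℚ.<⇒≤ 0<ω) (ω≤w v j)

    hX≲QX : ∀ v → hX v ≲ QX v
    hX≲QX v = ≲-trans (≤⇒≲ λ j → ℚ.≤-reflexive (ℚ.*-comm (h j) (X v j)))
      (≲-trans (*-mono-≲ (0≤X v) (X-bounded v) h≲μ)
        (≲-trans (≤⇒≲ λ j → ℚ.≤-reflexive (ℚ.*-comm (X v j) (μ j))) (μX≲QX v)))

    f≲e : ∀ v → f v ≲ e v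
    f≲e v = *-mono-≲ (0≤w v) (w-bounded v) (hX≲QX v)

    0≤t : ∀ v j → 0ℚ ≤ℚ t v j
    0≤t v j = 0≤* (0≤s v) (0≤X v j)

    f≲e+t : ∀ v → f v ≲ (λ j → e v j +ℚ t v j)
    f≲e+t v = ≲-trans (f≲e v) (≤⇒≲ λ j → ≤-add (t v j) (0≤t v j) refl)

    -- Term by term `f` lies below `e + t`. By symmetry of `Q` the sum of `e + t` is the pairing of
    -- `X` with `Q w + s`, which reverses the inequality for the sums and forces equality of all
    -- terms up to null sequences.
    ∑e+t≤∑f : ∀ j → sum (λ v → e v j +ℚ t v j) ≤ℚ sum (λ v → f v j)
    ∑e+t≤∑f j = begin
      sum (λ v → e v j +ℚ t v j)
        ≡⟨ ∑-distrib-+ (λ v → e v j) (λ v → t v j) ⟩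
      sum (λ v → e v j) +ℚ sum (λ v → t v j)
        ≡⟨ cong₂ _+ℚ_ (Q-symmetric G (λ v → w v j) (λ v → X v j))
             (sum-cong-≗ λ v → ℚ.*-comm (s v) (X v j)) ⟩
      sum (λ v → X v j *ℚ Q G (λ u → w u j) v) +ℚ sum (λ v → X v j *ℚ s v)
        ≡⟨ ∑-distrib-+ (λ v → X v j *ℚ Q G (λ u → w u j) v) (λ v → X v j *ℚ s v) ⟨
      sum (λ v → X v j *ℚ Q G (λ u → w u j) v +ℚ X v j *ℚ s v)
        ≤⟨ sum-mono (λ v → subst₂ _≤ℚ_
             (ℚ.*-distribˡ-+ (X v j) _ (s v)) (rotate (X v j) (h j) (w v j))
             (*-monoʳ (X v j) (0≤X v j) (Qw+s≤hw v j))) ⟩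
      sum (λ v → f v j) ∎
      where
      open ℚ.≤-Reasoning
      rotate : ∀ a b c → a *ℚ (b *ℚ c) ≡ c *ℚ (b *ℚ a)
      rotate = solve-∀ ℚ-ring

    e+t≲f : ∀ v → (λ j → e v j +ℚ t v j) ≲ f v
    e+t≲f = sum-squeeze f≲e+t (≤⇒≲ ∑e+t≤∑f)

  slack⇒null : ∀ {v} → 0ℚ <ℚ s v → X v ≲ 0ˢ
  slack⇒null {v} 0<s = *-cancelˡ-≲ {c = λ _ → s v} 0<s (λ _ → ℚ.≤-refl)
    (+-cancelʳ-≲ (e v) (≲-trans
      (≤⇒≲ λ j → ℚ.≤-reflexive (ℚ.+-comm (t v j) (e v j)))
      (≲-trans (e+t≲f v) (≲-trans (f≲e v)
        (≤⇒≲ λ j → ℚ.≤-reflexive (sym (trans (cong (_+ℚ e v j) (ℚ.*-zeroʳ (s v))) (ℚ.+-identityˡ (e v j)))))))))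

  -- Equality of the paired terms gives `Q X` at most `h X` at `v`, where `h X` is null; and `X u`
  -- is one of the nonnegative summands of `Q X` at `v`.
  null⇒neighbour-null : ∀ {v u} → Adj G v u → X v ≲ 0ˢ → X u ≲ 0ˢ
  null⇒neighbour-null {v} {u} v~u Xv≲0 =
    ≲-trans (≤⇒≲ λ j → neighbour≤Q G (λ v → 0≤X v j) v~u)
    (≲-trans QX≲hX
    (≲-trans (*-mono-≲ 0≤h h-bounded Xv≲0)
      (≤⇒≲ λ j → ℚ.≤-reflexive (ℚ.*-zeroʳ (h j)))))
    where
    QX≲hX : QX v ≲ hX v
    QX≲hX = *-cancelˡ-≲ 0<ω (ω≤w v)
      (≲-trans (≤⇒≲ λ j → ≤-add (t v j) (0≤t v j) refl) (e+t≲f v))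

-- Absolute values of an eigenvector

p≤∣p∣ : ∀ p → p ≤ℚ ∣ p ∣
p≤∣p∣ p = [ (λ 0≤p → ℚ.≤-reflexive (sym (ℚ.0≤p⇒∣p∣≡p 0≤p)))
          , (λ p≤0 → ℚ.≤-trans p≤0 (ℚ.0≤∣p∣ p)) ]′ (ℚ.≤-total 0ℚ p)

∣Q∣≤ : ∀ {n} (G : Graph n) (X : Fin n → ℚ) v → ∣ Q G X v ∣ ≤ℚ Q G (∣_∣ ∘ X) v
∣Q∣≤ G X v = begin
  ∣ ι (degree G v) *ℚ X v +ℚ ∑ⁿ G X v ∣
    ≤⟨ ℚ.∣p+q∣≤∣p∣+∣q∣ (ι (degree G v) *ℚ X v) (∑ⁿ G X v) ⟩
  ∣ ι (degree G v) *ℚ X v ∣ +ℚ ∣ ∑ⁿ G X v ∣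
    ≤⟨ ℚ.+-monoʳ-≤ ∣ ι (degree G v) *ℚ X v ∣ (∣sum∣≤ (λ u → X u when adj G v u)) ⟩
  ∣ ι (degree G v) *ℚ X v ∣ +ℚ sum (λ u → ∣ X u when adj G v u ∣)
    ≡⟨ cong₂ _+ℚ_
        (trans (ℚ.∣p*q∣≡∣p∣*∣q∣ (ι (degree G v)) (X v))
          (cong (_*ℚ ∣ X v ∣) (ℚ.0≤p⇒∣p∣≡p (0≤ι (degree G v)))))
        (sum-cong-≗ λ u → ∣when∣ (adj G v u) (X u)) ⟩
  Q G (∣_∣ ∘ X) v ∎
  where
  open ℚ.≤-Reasoning
  ∣when∣ : ∀ b y → ∣ y when b ∣ ≡ ∣ y ∣ when b
  ∣when∣ true  y = refl
  ∣when∣ false y = refl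

Q-abs-bound : ∀ {n} (G : Graph n) (X : Fin n → ℚ) v {y μ ε} → y ≡ Q G X v →
              ∣ y -ℚ μ *ℚ X v ∣ ≤ℚ ε → μ *ℚ ∣ X v ∣ ≤ℚ Q G (∣_∣ ∘ X) v +ℚ ε
Q-abs-bound G X v {y} {μ} {ε} y≡QX close = begin
  μ *ℚ ∣ X v ∣
    ≤⟨ ℚ.*-monoʳ-≤-nonNeg ∣ X v ∣ {{ℚ.nonNegative (ℚ.0≤∣p∣ (X v))}} (p≤∣p∣ μ) ⟩
  ∣ μ ∣ *ℚ ∣ X v ∣
    ≡⟨ ℚ.∣p*q∣≡∣p∣*∣q∣ μ (X v) ⟨
  ∣ μ *ℚ X v ∣
    ≡⟨ cong ∣_∣ (split (μ *ℚ X v) y) ⟩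
  ∣ y -ℚ (y -ℚ μ *ℚ X v) ∣
    ≤⟨ ℚ.∣p-q∣≤∣p∣+∣q∣ y (y -ℚ μ *ℚ X v) ⟩
  ∣ y ∣ +ℚ ∣ y -ℚ μ *ℚ X v ∣
    ≤⟨ ℚ.+-mono-≤ (subst (λ z → ∣ z ∣ ≤ℚ Q G (∣_∣ ∘ X) v) (sym y≡QX) (∣Q∣≤ G X v)) close ⟩
  Q G (∣_∣ ∘ X) v +ℚ ε ∎
  where
  open ℚ.≤-Reasoning
  split : ∀ a b → a ≡ b -ℚ (b -ℚ a)
  split = solve-∀ ℚ-ring

-- The entries of `Q` are nonnegative, so the triangle inequality bounds the modulus of `Q x` by `Q`
-- applied to the moduli; a possibly negative `q` is covered by `q ≤ ∣ q ∣`.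
eigen-abs : ∀ {n} (G : Graph n) (x : Fin n → ℝ) q →
  (∀ v → (signlessLaplacian G · x) v ≈ q *ᴿ x v) → ∀ v →
  (λ j → seq q j *ℚ ∣ seq (x v) j ∣) ≲ (λ j → Q G (λ u → ∣ seq (x u) j ∣) v)
eigen-abs G x q Qx≈qx v = mk≲ λ ε 0<ε → proj₁ (Qx≈qx v ε 0<ε) , λ j M≤j →
  Q-abs-bound G (λ u → seq (x u) j) v {μ = seq q j} (seq-Q G x v j) (proj₂ (Qx≈qx v ε 0<ε) j M≤j)

null⇒≈0 : ∀ x → (λ j → ∣ seq x j ∣) ≲ 0ˢ → x ≈ 0ᴿ
null⇒≈0 x ∣x∣≲0 ε 0<ε = proj₁ (eventually ∣x∣≲0 ε 0<ε) , λ j M≤j → subst₂ _≤ℚ_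
  (cong ∣_∣ (sym (ℚ.+-identityʳ (seq x j)))) (ℚ.+-identityˡ ε)
  (proj₂ (eventually ∣x∣≲0 ε 0<ε) j M≤j)

∣∣-≤ : ∀ {p ε} → p ≤ℚ ε → -ℚ p ≤ℚ ε → ∣ p ∣ ≤ℚ ε
∣∣-≤ {p} {ε} p≤ε -p≤ε = [ (λ eq → subst (_≤ℚ ε) (sym eq) p≤ε) , (λ eq → subst (_≤ℚ ε) (sym eq) -p≤ε) ]′
  (ℚ.∣p∣≡p∨∣p∣≡-p p)

-- Approximating a root by bisection

module Bisection (f : ℚ → ℚ) (a : ℚ) (W : ℕ) (fa≤0 : f a ≤ℚ 0ℚ) (0≤fb : 0ℚ ≤ℚ f (a +ℚ ι W)) where

  -- Halving would give width `W / 2^n`; the weaker rate `W / (n + 1)` in `narrow` is preserved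
  -- because `n + 2 ≤ 2 (n + 1)`, and it avoids powers.
  record Bracket (n : ℕ) : Set where
    field
      lo hi    : ℚ
      a≤lo     : a ≤ℚ lo
      lo≤hi    : lo ≤ℚ hi
      hi≤b     : hi ≤ℚ a +ℚ ι W
      f-lo≤0   : f lo ≤ℚ 0ℚ
      0≤f-hi   : 0ℚ ≤ℚ f hi
      narrow   : (hi -ℚ lo) *ℚ ι (suc n) ≤ℚ ι W

  open Bracket public

  private
    initial : Bracket 0
    initial = record
      { lo = a ; hi = a +ℚ ι W
      ; a≤lo = ℚ.≤-refl ; lo≤hi = ≤-add (ι W) (0≤ι W) refl ; hi≤b = ℚ.≤-refl
      ; f-lo≤0 = fa≤0 ; 0≤f-hi = 0≤fb
      ; narrow = ℚ.≤-reflexive (trans (cong ((a +ℚ ι W -ℚ a) *ℚ_) ι-1) (cancel a (ι W)))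
      }
      where
      cancel : ∀ a w → (a +ℚ w -ℚ a) *ℚ 1ℚ ≡ w
      cancel = solve-∀ ℚ-ring

    module Halve {n} (B : Bracket n) where
      mid r : ℚ
      r = (hi B -ℚ lo B) *ℚ ℚ.½
      mid = lo B +ℚ r

      0≤r : 0ℚ ≤ℚ r
      0≤r = 0≤* (0≤- (lo≤hi B)) (ℚ.nonNegative⁻¹ ℚ.½)

      r+r : r +ℚ r ≡ hi B -ℚ lo B
      r+r = trans (sym (ℚ.*-distribˡ-+ (hi B -ℚ lo B) ℚ.½ ℚ.½)) (ℚ.*-identityʳ (hi B -ℚ lo B))

      hi≡mid+r : hi B ≡ mid +ℚ r
      hi≡mid+r = trans (split (lo B) (hi B)) (trans (cong (lo B +ℚ_) (sym r+r)) (sym (ℚ.+-assoc (lo B) r r)))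
        where
        split : ∀ l h → h ≡ l +ℚ (h -ℚ l)
        split = solve-∀ ℚ-ring

      lo≤mid : lo B ≤ℚ mid
      lo≤mid = ≤-add r 0≤r refl

      mid≤hi : mid ≤ℚ hi B
      mid≤hi = ≤-add r 0≤r hi≡mid+r

      narrow′ : r *ℚ ι (suc (suc n)) ≤ℚ ι W
      narrow′ = begin
        r *ℚ ι (suc (suc n))                       ≤⟨ *-monoʳ r 0≤r (ι-mono (ℕ.+-monoʳ-≤ 1 (ℕ.m≤n+m (suc n) n))) ⟩
        r *ℚ ι (suc n + suc n)                     ≡⟨ cong (r *ℚ_) (ι-+ (suc n) (suc n)) ⟩
        r *ℚ (ι (suc n) +ℚ ι (suc n))              ≡⟨ regroup r (ι (suc n)) ⟩
        (r +ℚ r) *ℚ ι (suc n)                      ≡⟨ cong (_*ℚ ι (suc n)) r+r ⟩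
        (hi B -ℚ lo B) *ℚ ι (suc n)                ≤⟨ narrow B ⟩
        ι W                                        ∎
        where
        open ℚ.≤-Reasoning
        regroup : ∀ x y → x *ℚ (y +ℚ y) ≡ (x +ℚ x) *ℚ y
        regroup = solve-∀ ℚ-ring

      step : Σ[ B′ ∈ Bracket (suc n) ] lo B ≤ℚ lo B′ × hi B′ ≤ℚ hi B
      step = [ right , left ]′ (ℚ.≤-total (f mid) 0ℚ)
        where
        right : f mid ≤ℚ 0ℚ → Σ[ B′ ∈ Bracket (suc n) ] lo B ≤ℚ lo B′ × hi B′ ≤ℚ hi B
        right fm≤0 = record
          { lo = mid ; hi = hi B
          ; a≤lo = ℚ.≤-trans (a≤lo B) lo≤mid ; lo≤hi = mid≤hi ; hi≤b = hi≤b B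
          ; f-lo≤0 = fm≤0 ; 0≤f-hi = 0≤f-hi B
          ; narrow = subst (λ w → w *ℚ ι (suc (suc n)) ≤ℚ ι W)
              (sym (trans (cong (_-ℚ mid) hi≡mid+r) (cancel mid r))) narrow′
          } , lo≤mid , ℚ.≤-refl
          where
          cancel : ∀ m r → m +ℚ r -ℚ m ≡ r
          cancel = solve-∀ ℚ-ring
        left : 0ℚ ≤ℚ f mid → Σ[ B′ ∈ Bracket (suc n) ] lo B ≤ℚ lo B′ × hi B′ ≤ℚ hi B
        left 0≤fm = record
          { lo = lo B ; hi = mid
          ; a≤lo = a≤lo B ; lo≤hi = lo≤mid ; hi≤b = ℚ.≤-trans mid≤hi (hi≤b B)
          ; f-lo≤0 = f-lo≤0 B ; 0≤f-hi = 0≤fm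
          ; narrow = subst (λ w → w *ℚ ι (suc (suc n)) ≤ℚ ι W) (sym (cancel (lo B) r)) narrow′
          } , ℚ.≤-refl , mid≤hi
          where
          cancel : ∀ m r → m +ℚ r -ℚ m ≡ r
          cancel = solve-∀ ℚ-ring

  bracket : ∀ n → Bracket n
  bracket zero    = initial
  bracket (suc n) = proj₁ (Halve.step (bracket n))

  nested : ∀ i n → lo (bracket n) ≤ℚ lo (bracket (i + n)) × hi (bracket (i + n)) ≤ℚ hi (bracket n)
  nested zero    n = ℚ.≤-refl , ℚ.≤-refl
  nested (suc i) n =
    let lo≤ , ≤hi = nested i n
        _ , lo≤′ , ≤hi′ = Halve.step (bracket (i + n))
    in ℚ.≤-trans lo≤ lo≤′ , ℚ.≤-trans ≤hi′ ≤hi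

  inside : ∀ {n m} → n ≤ m → lo (bracket n) ≤ℚ hi (bracket m) × hi (bracket m) ≤ℚ hi (bracket n)
  inside {n} {m} n≤m = subst (λ j → lo (bracket n) ≤ℚ hi (bracket j) × hi (bracket j) ≤ℚ hi (bracket n))
    (ℕ.m∸n+n≡m n≤m)
    (ℚ.≤-trans (proj₁ (nested (m ∸ n) n)) (lo≤hi (bracket (m ∸ n + n))) , proj₂ (nested (m ∸ n) n))

  width-null : ∀ {ε} → 0ℚ <ℚ ε → ∃ λ N → ∀ n → N ≤ n → hi (bracket n) -ℚ lo (bracket n) ≤ℚ ε
  width-null {ε} 0<ε = let N , W≤εN = archimedean W 0<ε in N , λ n N≤n →
    ℚ.*-cancelʳ-≤-pos (ι (suc n)) {{ℚ.positive (0<ι (suc n))}} (begin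
      (hi (bracket n) -ℚ lo (bracket n)) *ℚ ι (suc n)   ≤⟨ narrow (bracket n) ⟩
      ι W                                               ≤⟨ W≤εN ⟩
      ε *ℚ ι N                                          ≤⟨ *-monoʳ ε (ℚ.<⇒≤ 0<ε) (ι-mono (ℕ.m≤n⇒m≤1+n N≤n)) ⟩
      ε *ℚ ι (suc n)                                    ∎)
    where open ℚ.≤-Reasoning

  -- The root is represented by the upper endpoints because `f` is nonnegative at each of them: the
  -- inequality `Q w ≤ h w` will then hold at every index, not just in the limit.
  hi-cauchy : IsCauchy (λ n → hi (bracket n))
  hi-cauchy ε 0<ε = let N , narrow = width-null 0<ε in N , λ m n N≤m N≤n →
    ∣∣-≤ (ℚ.≤-trans (diff (proj₂ (inside N≤m)) (proj₁ (inside N≤n))) (narrow N ℕ.≤-refl))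
         (ℚ.≤-trans (ℚ.≤-reflexive (flip (hi (bracket m)) (hi (bracket n))))
           (ℚ.≤-trans (diff (proj₂ (inside N≤n)) (proj₁ (inside N≤m))) (narrow N ℕ.≤-refl)))
    where
    flip : ∀ x y → -ℚ (x -ℚ y) ≡ y -ℚ x
    flip = solve-∀ ℚ-ring
    diff : ∀ {x y l h} → x ≤ℚ h → l ≤ℚ y → x -ℚ y ≤ℚ h -ℚ l
    diff x≤h l≤y = ℚ.+-mono-≤ x≤h (ℚ.neg-antimono-≤ l≤y)

  module _ {C : ℚ} (0<C : 0ℚ <ℚ C)
    (lipschitz : ∀ {l h} → a ≤ℚ l → l ≤ℚ h → h ≤ℚ a +ℚ ι W → f h -ℚ f l ≤ℚ C *ℚ (h -ℚ l)) where

    f-hi-null : ∀ {ε} → 0ℚ <ℚ ε → ∃ λ N → ∀ n → N ≤ n → f (hi (bracket n)) ≤ℚ ε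
    f-hi-null {ε} 0<ε =
      let η , 0<η , Cη≡ε = divide 0<ε 0<C
          N , narrow = width-null 0<η
      in N , λ n N≤n → let B = bracket n in begin
        f (hi B)                  ≤⟨ ≤-add (-ℚ f (lo B)) (ℚ.neg-antimono-≤ (f-lo≤0 B)) refl ⟩
        f (hi B) -ℚ f (lo B)      ≤⟨ lipschitz (a≤lo B) (lo≤hi B) (hi≤b B) ⟩
        C *ℚ (hi B -ℚ lo B)       ≤⟨ *-monoʳ C (ℚ.<⇒≤ 0<C) (narrow n N≤n) ⟩
        C *ℚ η                    ≡⟨ Cη≡ε ⟩
        ε                         ∎
      where open ℚ.≤-Reasoning

    -- Since `f` has slope at most `C`, climbing from the value `f a` to a nonnegative one takes a
    -- distance of at least `-f a / C`.
    hi-separated : ∀ {σ} → C *ℚ σ ≤ℚ -ℚ f a → ∀ n → a +ℚ σ ≤ℚ hi (bracket n)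
    hi-separated {σ} Cσ≤-fa n = subst (a +ℚ σ ≤ℚ_) (sym (split a (hi B)))
      (ℚ.+-monoʳ-≤ a (ℚ.*-cancelˡ-≤-pos C {{ℚ.positive 0<C}} (begin
        C *ℚ σ                ≤⟨ Cσ≤-fa ⟩
        -ℚ f a                ≤⟨ ≤-add (f (hi B)) (0≤f-hi B) (ℚ.+-comm (f (hi B)) (-ℚ f a)) ⟩
        f (hi B) -ℚ f a       ≤⟨ lipschitz ℚ.≤-refl (ℚ.≤-trans (a≤lo B) (lo≤hi B)) (hi≤b B) ⟩
        C *ℚ (hi B -ℚ a)      ∎)))
      where
      open ℚ.≤-Reasoning
      B : Bracket n
      B = bracket n
      split : ∀ l h → h ≡ l +ℚ (h -ℚ l)
      split = solve-∀ ℚ-ring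

-- The largest root of the characteristic cubic of K k ∨ (K m ∪ s K 1)

module Cubic (k m s : ℕ) (1≤k : 1 ≤ k) (1≤m : 1 ≤ m) (1≤s : 1 ≤ s) where

  κ M S a c L U : ℚ
  κ = ι k
  M = ι m
  S = ι s
  a = κ +ℚ κ +ℚ M +ℚ S -ℚ 1ℚ -ℚ 1ℚ
  c = M +ℚ M +ℚ κ -ℚ 1ℚ -ℚ 1ℚ
  -- `L = 2(k + m - 1)` is twice the degree inside the clique of top and mid vertices, and `U` is
  -- twice the order `k + m + s`. The cubic is negative at `L` and nonnegative at `U`, and
  -- `U - L = 2(s + 1)`.
  L = c +ℚ κ
  U = κ +ℚ κ +ℚ M +ℚ M +ℚ S +ℚ S

  -- The quotient matrix of Q for the three classes has rows
  -- (a, m, s), (k, c, 0) and (k, 0, k).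
  f : ℚ → ℚ
  f h = (h -ℚ a) *ℚ (h -ℚ κ) *ℚ (h -ℚ c) -ℚ M *ℚ κ *ℚ (h -ℚ κ) -ℚ S *ℚ κ *ℚ (h -ℚ c)

  private
    0≤κ : 0ℚ ≤ℚ κ
    0≤κ = 0≤ι k
    0≤M : 0ℚ ≤ℚ M
    0≤M = 0≤ι m
    0≤S : 0ℚ ≤ℚ S
    0≤S = 0≤ι s
    0<κ : 0ℚ <ℚ κ
    0<κ = 0<ι k {{>-nonZero 1≤k}}
    1≤κ : 1ℚ ≤ℚ κ
    1≤κ = subst (_≤ℚ κ) ι-1 (ι-mono 1≤k)
    1≤M : 1ℚ ≤ℚ M
    1≤M = subst (_≤ℚ M) ι-1 (ι-mono 1≤m)
    0≤1 : 0ℚ ≤ℚ 1ℚ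
    0≤1 = ℚ.nonNegative⁻¹ 1ℚ

  κ≤c : κ ≤ℚ c
  κ≤c = ≤-add _ (0≤+ (0≤- 1≤M) (0≤- 1≤M)) (eq κ M)
    where
    eq : ∀ κ M → M +ℚ M +ℚ κ -ℚ 1ℚ -ℚ 1ℚ ≡ κ +ℚ ((M -ℚ 1ℚ) +ℚ (M -ℚ 1ℚ))
    eq = solve-∀ ℚ-ring

  0≤c : 0ℚ ≤ℚ c
  0≤c = ℚ.≤-trans 0≤κ κ≤c

  c≤L : c ≤ℚ L
  c≤L = ≤-add κ 0≤κ refl

  0<L : 0ℚ <ℚ L
  0<L = ℚ.<-≤-trans 0<κ (≤-add c 0≤c (ℚ.+-comm c κ))

  private
    fL : f L ≡ -ℚ (S *ℚ κ *ℚ L)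
    fL = eq κ M S
      where
      eq : ∀ κ M S → let a = κ +ℚ κ +ℚ M +ℚ S -ℚ 1ℚ -ℚ 1ℚ
                         c = M +ℚ M +ℚ κ -ℚ 1ℚ -ℚ 1ℚ
                         h = c +ℚ κ in
        (h -ℚ a) *ℚ (h -ℚ κ) *ℚ (h -ℚ c) -ℚ M *ℚ κ *ℚ (h -ℚ κ) -ℚ S *ℚ κ *ℚ (h -ℚ c)
        ≡ -ℚ (S *ℚ κ *ℚ h)
      eq = solve-∀ ℚ-ring

    0<SκL : 0ℚ <ℚ S *ℚ κ *ℚ L
    0<SκL = 0<* (0<* (0<ι s {{>-nonZero 1≤s}}) 0<κ) 0<L

    fL≤0 : f L ≤ℚ 0ℚ
    fL≤0 = subst (_≤ℚ 0ℚ) (sym fL) (ℚ.neg-antimono-≤ (ℚ.<⇒≤ 0<SκL))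

    W : ℕ
    W = suc s + suc s

    L+W : L +ℚ ι W ≡ U
    L+W = trans (cong (L +ℚ_) (trans (ι-+ (suc s) (suc s)) (cong₂ _+ℚ_ ι-suc ι-suc))) (eq κ M S)
      where
      ι-suc : ι (suc s) ≡ 1ℚ +ℚ S
      ι-suc = trans (ι-+ 1 s) (cong (_+ℚ S) ι-1)
      eq : ∀ κ M S → M +ℚ M +ℚ κ -ℚ 1ℚ -ℚ 1ℚ +ℚ κ +ℚ (1ℚ +ℚ S +ℚ (1ℚ +ℚ S)) ≡ κ +ℚ κ +ℚ M +ℚ M +ℚ S +ℚ S
      eq = solve-∀ ℚ-ring

    0≤fU : 0ℚ ≤ℚ f U
    -- At `h = U` the differences `h - κ` and `h - c` are `B` and `C`, and `h - a` is `M + S + 2`;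
    -- the parts `M B C` and `S B C` of the product absorb the two negative terms.
    0≤fU = subst (0ℚ ≤ℚ_) (sym (eq κ M S))
      (0≤+ (0≤+ (0≤* (0≤* 0≤M 0≤B) 0≤S′) (0≤* (0≤* 0≤S 0≤C) (0≤+ (0≤+ 0≤M 0≤M) (0≤+ 0≤S 0≤S))))
        (0≤+ (0≤* 0≤B 0≤C) (0≤* 0≤B 0≤C)))
      where
      0≤S′ : 0ℚ ≤ℚ S +ℚ S +ℚ 1ℚ +ℚ 1ℚ
      0≤S′ = 0≤+ (0≤+ (0≤+ 0≤S 0≤S) 0≤1) 0≤1
      0≤B : 0ℚ ≤ℚ κ +ℚ (M +ℚ M +ℚ (S +ℚ S))
      0≤B = 0≤+ 0≤κ (0≤+ (0≤+ 0≤M 0≤M) (0≤+ 0≤S 0≤S))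
      0≤C : 0ℚ ≤ℚ κ +ℚ (S +ℚ S +ℚ 1ℚ +ℚ 1ℚ)
      0≤C = 0≤+ 0≤κ 0≤S′
      eq : ∀ κ M S → let a = κ +ℚ κ +ℚ M +ℚ S -ℚ 1ℚ -ℚ 1ℚ
                         c = M +ℚ M +ℚ κ -ℚ 1ℚ -ℚ 1ℚ
                         h = κ +ℚ κ +ℚ M +ℚ M +ℚ S +ℚ S
                         B = κ +ℚ (M +ℚ M +ℚ (S +ℚ S))
                         C = κ +ℚ (S +ℚ S +ℚ 1ℚ +ℚ 1ℚ) in
        (h -ℚ a) *ℚ (h -ℚ κ) *ℚ (h -ℚ c) -ℚ M *ℚ κ *ℚ (h -ℚ κ) -ℚ S *ℚ κ *ℚ (h -ℚ c)
        ≡ M *ℚ B *ℚ (S +ℚ S +ℚ 1ℚ +ℚ 1ℚ) +ℚ S *ℚ C *ℚ (M +ℚ M +ℚ (S +ℚ S)) +ℚ (B *ℚ C +ℚ B *ℚ C)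
      eq = solve-∀ ℚ-ring

    0≤f-L+W : 0ℚ ≤ℚ f (L +ℚ ι W)
    0≤f-L+W = subst (λ u → 0ℚ ≤ℚ f u) (sym L+W) 0≤fU

    L≤U : L ≤ℚ U
    L≤U = subst (L ≤ℚ_) L+W (≤-add (ι W) (0≤ι W) refl)

    G : ℚ
    G = U *ℚ U +ℚ U *ℚ U +ℚ U *ℚ U

    0<G : 0ℚ <ℚ G
    0<G = ℚ.<-≤-trans 0<U² (≤-add _ (0≤+ 0≤U² 0≤U²) (ℚ.+-assoc (U *ℚ U) (U *ℚ U) (U *ℚ U)))
      where
      0<U : 0ℚ <ℚ U
      0<U = ℚ.<-≤-trans 0<L L≤U
      0<U² : 0ℚ <ℚ U *ℚ U
      0<U² = 0<* 0<U 0<U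
      0≤U² : 0ℚ ≤ℚ U *ℚ U
      0≤U² = ℚ.<⇒≤ 0<U²

    ≤-minus : ∀ {x y z} → x ≤ℚ y → 0ℚ ≤ℚ z → x -ℚ z ≤ℚ y
    ≤-minus {x} {y} {z} x≤y 0≤z = ℚ.≤-trans (≤-add z 0≤z (eq x z)) x≤y
      where
      eq : ∀ x z → x ≡ x -ℚ z +ℚ z
      eq = solve-∀ ℚ-ring

    0≤a : 0ℚ ≤ℚ a
    0≤a = subst (0ℚ ≤ℚ_) (eq κ M S) (0≤+ (0≤+ 0≤κ (0≤- 1≤M)) (0≤+ (0≤- 1≤κ) 0≤S))
      where
      eq : ∀ κ M S → κ +ℚ (M -ℚ 1ℚ) +ℚ ((κ -ℚ 1ℚ) +ℚ S) ≡ κ +ℚ κ +ℚ M +ℚ S -ℚ 1ℚ -ℚ 1ℚ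
      eq = solve-∀ ℚ-ring

    -- The product is telescoped one factor at a time, each step costing at most `U * U` per unit.
    -- The bound is one-sided: the linear terms decrease and are dropped, and factors with `a` may
    -- be negative, so they are estimated only from above.
    lipschitz : ∀ {l h} → L ≤ℚ l → l ≤ℚ h → h ≤ℚ L +ℚ ι W → f h -ℚ f l ≤ℚ G *ℚ (h -ℚ l)
    lipschitz {l} {h} L≤l l≤h h≤L+W = ≤-add _
      (0≤* (0≤- l≤h)
        (0≤+ (0≤+ (0≤- BC≤UU) (0≤+ (0≤- CA≤UU) (0≤- BA≤UU))) (0≤+ (0≤* 0≤M 0≤κ) (0≤* 0≤S 0≤κ))))
      (eq κ M S a c U h l)
      where
      h≤U : h ≤ℚ U
      h≤U = subst (h ≤ℚ_) L+W h≤L+W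
      l≤U : l ≤ℚ U
      l≤U = ℚ.≤-trans l≤h h≤U
      0≤U : 0ℚ ≤ℚ U
      0≤U = ℚ.≤-trans (ℚ.<⇒≤ 0<L) L≤U
      L≤h : L ≤ℚ h
      L≤h = ℚ.≤-trans L≤l l≤h
      κ≤L : κ ≤ℚ L
      κ≤L = ≤-add c 0≤c (ℚ.+-comm c κ)
      BC≤UU : (h -ℚ κ) *ℚ (h -ℚ c) ≤ℚ U *ℚ U
      BC≤UU = *-mono (0≤- (ℚ.≤-trans κ≤L L≤h)) 0≤U (≤-minus h≤U 0≤κ) (≤-minus h≤U 0≤c)
      CA≤UU : (h -ℚ c) *ℚ (l -ℚ a) ≤ℚ U *ℚ U
      CA≤UU = *-mono (0≤- (ℚ.≤-trans c≤L L≤h)) 0≤U (≤-minus h≤U 0≤c) (≤-minus l≤U 0≤a)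
      BA≤UU : (l -ℚ κ) *ℚ (l -ℚ a) ≤ℚ U *ℚ U
      BA≤UU = *-mono (0≤- (ℚ.≤-trans κ≤L L≤l)) 0≤U (≤-minus l≤U 0≤κ) (≤-minus l≤U 0≤a)
      eq : ∀ κ M S a c U h l →
        (U *ℚ U +ℚ U *ℚ U +ℚ U *ℚ U) *ℚ (h -ℚ l) ≡
        ((h -ℚ a) *ℚ (h -ℚ κ) *ℚ (h -ℚ c) -ℚ M *ℚ κ *ℚ (h -ℚ κ) -ℚ S *ℚ κ *ℚ (h -ℚ c)
          -ℚ ((l -ℚ a) *ℚ (l -ℚ κ) *ℚ (l -ℚ c) -ℚ M *ℚ κ *ℚ (l -ℚ κ) -ℚ S *ℚ κ *ℚ (l -ℚ c)))
        +ℚ (h -ℚ l) *ℚ (((U *ℚ U -ℚ (h -ℚ κ) *ℚ (h -ℚ c)) +ℚ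
          ((U *ℚ U -ℚ (h -ℚ c) *ℚ (l -ℚ a)) +ℚ (U *ℚ U -ℚ (l -ℚ κ) *ℚ (l -ℚ a)))) +ℚ (M *ℚ κ +ℚ S *ℚ κ))
      eq = solve-∀ ℚ-ring

    module Root = Bisection f L W fL≤0 0≤f-L+W

  opaque
    root : Sequence
    root j = Root.hi (Root.bracket j)

    root-cauchy : IsCauchy root
    root-cauchy = Root.hi-cauchy

    0≤f-root : ∀ j → 0ℚ ≤ℚ f (root j)
    0≤f-root j = Root.0≤f-hi (Root.bracket j)

    f-root-null : ∀ {ε} → 0ℚ <ℚ ε → ∃ λ N → ∀ n → N ≤ n → f (root n) ≤ℚ ε
    f-root-null = Root.f-hi-null 0<G lipschitz

    -- At `L` the cubic equals `-(S κ L)`, so the slope bound `G` keeps every approximation at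
    -- distance `S κ L / G` from `L`. This distance later separates the top weight from the mid
    -- weight.
    root-separated : ∃ λ σ → 0ℚ <ℚ σ × (∀ j → L +ℚ σ ≤ℚ root j)
    root-separated = let σ , 0<σ , Gσ≡SκL = divide 0<SκL 0<G in σ , 0<σ ,
      Root.hi-separated 0<G lipschitz (ℚ.≤-reflexive
        (trans Gσ≡SκL (trans (neg² (S *ℚ κ *ℚ L)) (cong -ℚ_ (sym fL)))))
      where
      neg² : ∀ x → x ≡ -ℚ (-ℚ x)
      neg² = solve-∀ ℚ-ring

-- Graphs with vertices in three classes

data Class : Set where
  top mid low : Class

_==_ : Class → Class → Bool
top == top = true
mid == mid = true
low == low = true
_   == _   = false

joined : Class → Class → Bool
joined top _   = true
joined _   top = true
joined mid mid = true
joined mid low = false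
joined low mid = false
joined low low = false

joined-sym : ∀ c d → joined c d ≡ joined d c
joined-sym top top = refl
joined-sym top mid = refl
joined-sym top low = refl
joined-sym mid top = refl
joined-sym mid mid = refl
joined-sym mid low = refl
joined-sym low top = refl
joined-sym low mid = refl
joined-sym low low = refl

weights : ℚ → ℚ → ℚ → Class → ℚ
weights α β γ top = α
weights α β γ mid = β
weights α β γ low = γ

record Sizes {n} (cls : Fin n → Class) (k m s : ℕ) : Set where
  field
    size-top : count (λ v → cls v == top) ≡ k
    size-mid : count (λ v → cls v == mid) ≡ m
    size-low : count (λ v → cls v == low) ≡ s

  sum-class : ∀ (τ : Class → ℚ) → sum (τ ∘ cls) ≡ ι k *ℚ τ top +ℚ ι m *ℚ τ mid +ℚ ι s *ℚ τ low
  sum-class τ = begin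
    sum (τ ∘ cls)
      ≡⟨ sum-cong-≗ (λ v → split (cls v)) ⟩
    sum (λ v → τ top when (cls v == top) +ℚ τ mid when (cls v == mid) +ℚ τ low when (cls v == low))
      ≡⟨ ∑-distrib-+ (λ v → τ top when (cls v == top) +ℚ τ mid when (cls v == mid)) (λ v → τ low when (cls v == low)) ⟩
    sum (λ v → τ top when (cls v == top) +ℚ τ mid when (cls v == mid)) +ℚ sum (λ v → τ low when (cls v == low))
      ≡⟨ cong (_+ℚ sum (λ v → τ low when (cls v == low)))
          (∑-distrib-+ (λ v → τ top when (cls v == top)) (λ v → τ mid when (cls v == mid))) ⟩
    sum (λ v → τ top when (cls v == top)) +ℚ sum (λ v → τ mid when (cls v == mid)) +ℚ sum (λ v → τ low when (cls v == low))
      ≡⟨ cong₂ _+ℚ_ (cong₂ _+ℚ_ (part size-top) (part size-mid)) (part size-low) ⟩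
    ι k *ℚ τ top +ℚ ι m *ℚ τ mid +ℚ ι s *ℚ τ low ∎
    where
    open ≡-Reasoning
    split : ∀ c → τ c ≡ τ top when (c == top) +ℚ τ mid when (c == mid) +ℚ τ low when (c == low)
    split top = sym (trans (ℚ.+-identityʳ _) (ℚ.+-identityʳ (τ top)))
    split mid = sym (trans (ℚ.+-identityʳ _) (ℚ.+-identityˡ (τ mid)))
    split low = sym (ℚ.+-identityˡ (τ low))
    part : ∀ {c j} → count (λ v → cls v == c) ≡ j → sum (λ v → τ c when (cls v == c)) ≡ ι j *ℚ τ c
    part {c} size = trans (sum-indicator (λ v → cls v == c) (τ c)) (cong (λ j → ι j *ℚ τ c) size)

sum-others : ∀ {n} (a : Fin n → ℚ) v → sum (λ u → a u when not (does (v Fin.≟ u))) ≡ sum a -ℚ a v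
sum-others a v = begin
  sum (λ u → a u when not (does (v Fin.≟ u)))
    ≡⟨ cancel _ (a v) ⟩
  a v +ℚ sum (λ u → a u when not (does (v Fin.≟ u))) -ℚ a v
    ≡⟨ cong (λ b → b +ℚ sum (λ u → a u when not (does (v Fin.≟ u))) -ℚ a v) (sum-point v a) ⟨
  sum (λ u → a u when does (v Fin.≟ u)) +ℚ sum (λ u → a u when not (does (v Fin.≟ u))) -ℚ a v
    ≡⟨ cong (_-ℚ a v) (∑-distrib-+ (λ u → a u when does (v Fin.≟ u)) (λ u → a u when not (does (v Fin.≟ u)))) ⟨
  sum (λ u → a u when does (v Fin.≟ u) +ℚ a u when not (does (v Fin.≟ u))) -ℚ a v
    ≡⟨ cong (_-ℚ a v) (sum-cong-≗ λ u → merge (does (v Fin.≟ u)) (a u)) ⟩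
  sum a -ℚ a v ∎
  where
  open ≡-Reasoning
  cancel : ∀ x y → x ≡ y +ℚ x -ℚ y
  cancel = solve-∀ ℚ-ring
  merge : ∀ b x → x when b +ℚ x when not b ≡ x
  merge true  x = ℚ.+-identityʳ x
  merge false x = ℚ.+-identityˡ x

adj⇒≢ : ∀ {n} (G : Graph n) {u v} → Adj G u v → u ≢ v
adj⇒≢ G {u} u~u refl = case trans (sym u~u) (irrefl G u) of λ ()

≢⇒does : ∀ {n} {u v : Fin n} → u ≢ v → does (u Fin.≟ v) ≡ false
≢⇒does {u = u} {v} u≢v with u Fin.≟ v
... | yes u≡v = contradiction u≡v u≢v
... | no _    = refl

-- Vertices v and u form a defect of G with respect to the graph in which
-- adjacency is given by the classes. The case excluded by the last field
-- is that of a single mid vertex, which may then have the weight of a low one.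
record Defect {n} (G : Graph n) (cls : Fin n → Class) (m : ℕ) (v u : Fin n) : Set where
  constructor defect
  field
    distinct : v ≢ u
    mismatch : adj G v u ≢ joined (cls v) (cls u)
    relevant : cls v ≡ top ⊎ cls u ≡ top ⊎ 2 ≤ m

defect-sym : ∀ {n} {G : Graph n} {cls m v u} → Defect G cls m v u → Defect G cls m u v
defect-sym {G = G} {cls} {m} {v} {u} (defect v≢u ≢joined rel) = defect (v≢u ∘ sym)
  (λ eq → ≢joined (trans (symm G v u) (trans eq (joined-sym (cls u) (cls v)))))
  ([ (λ v∈ → inj₂ (inj₁ v∈)) , [ inj₁ , (λ 2≤m → inj₂ (inj₂ 2≤m)) ]′ ]′ rel)

-- The action of Q on class weights α, β, γ in the graph in which adjacency
-- is given by the classes.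
target : (k m s : ℕ) (α β γ : ℚ) → Class → ℚ
target k m s α β γ top = (ι k +ℚ ι m +ℚ ι s -ℚ 1ℚ) *ℚ α +ℚ (ι k *ℚ α +ℚ ι m *ℚ β +ℚ ι s *ℚ γ -ℚ α)
target k m s α β γ mid = (ι k +ℚ ι m -ℚ 1ℚ) *ℚ β +ℚ (ι k *ℚ α +ℚ ι m *ℚ β -ℚ β)
target k m s α β γ low = ι k *ℚ γ +ℚ ι k *ℚ α

record Dominated {n} (G : Graph n) (cls : Fin n → Class) (k m s : ℕ) : Set where
  field
    sizes      : Sizes cls k m s
    low-degree : ∀ v → cls v ≡ low → degree G v ≤ k
    mid-degree : ∀ v → cls v ≡ mid → degree G v < k + m

  open Sizes sizes public

-- Row bounds from degree domination

module Rows {n} {G : Graph n} {cls : Fin n → Class} {k m s : ℕ} (D : Dominated G cls k m s) where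

  open Dominated D

  private
    d : Fin n → ℚ
    d v = ι (degree G v)

    total : (Class → ℚ) → ℚ
    total τ = ι k *ℚ τ top +ℚ ι m *ℚ τ mid +ℚ ι s *ℚ τ low

    -- How degrees alone control a neighbourhood sum: a neighbour costs at most `θ + τ`, and
    -- charging the nonnegative excess `τ` to all other vertices, adjacent or not, leaves a bound in
    -- which `G` enters only through the degree of `v`.
    module Threshold (w τ : Class → ℚ) (θ : ℚ) (0≤τ : ∀ c → 0ℚ ≤ℚ τ c) (w≤θ+τ : ∀ c → w c ≤ℚ θ +ℚ τ c)
      (v : Fin n) where

      lhs rhs : Fin n → ℚ
      lhs u = w (cls u) when adj G v u
      rhs u = θ when adj G v u +ℚ τ (cls u) when not (does (v Fin.≟ u))

      sum-rhs : sum rhs ≡ d v *ℚ θ +ℚ (total τ -ℚ τ (cls v))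
      sum-rhs = trans (∑-distrib-+ (λ u → θ when adj G v u) (λ u → τ (cls u) when not (does (v Fin.≟ u))))
        (cong₂ _+ℚ_ (sum-indicator (adj G v) θ)
          (trans (sum-others (τ ∘ cls) v) (cong (_-ℚ τ (cls v)) (sum-class τ))))

      lhs≤rhs : ∀ u → lhs u ≤ℚ rhs u
      lhs≤rhs u = term (adj G v u) (does (v Fin.≟ u)) (λ v~u → ≢⇒does (adj⇒≢ G v~u))
        where
        term : ∀ a e → (a ≡ true → e ≡ false) → w (cls u) when a ≤ℚ θ when a +ℚ τ (cls u) when not e
        term true  e a⇒¬e rewrite a⇒¬e refl = w≤θ+τ (cls u)
        term false true  _ = ℚ.≤-refl
        term false false _ = ℚ.≤-trans (0≤τ (cls u)) (ℚ.≤-reflexive (sym (ℚ.+-identityˡ (τ (cls u)))))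

      bound : ∑ⁿ G (w ∘ cls) v ≤ℚ d v *ℚ θ +ℚ (total τ -ℚ τ (cls v))
      bound = subst (sum lhs ≤ℚ_) sum-rhs (sum-mono lhs≤rhs)

      missing-bound : ∀ {u g} → v ≢ u → adj G v u ≡ false → g ≤ℚ τ (cls u) →
        ∑ⁿ G (w ∘ cls) v +ℚ g ≤ℚ d v *ℚ θ +ℚ (total τ -ℚ τ (cls v))
      missing-bound {u} {g} v≢u v≁u g≤τ = subst (sum lhs +ℚ g ≤ℚ_) sum-rhs (sum-mono-gap u lhs≤rhs gap)
        where
        gap : lhs u +ℚ g ≤ℚ rhs u
        gap rewrite v≁u | ≢⇒does v≢u = ℚ.+-monoʳ-≤ 0ℚ g≤τ

      extra-bound : ∀ {u g} → adj G v u ≡ true → w (cls u) +ℚ g ≤ℚ θ +ℚ τ (cls u) →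
        ∑ⁿ G (w ∘ cls) v +ℚ g ≤ℚ d v *ℚ θ +ℚ (total τ -ℚ τ (cls v))
      extra-bound {u} {g} v~u w+g≤ = subst (sum lhs +ℚ g ≤ℚ_) sum-rhs (sum-mono-gap u lhs≤rhs gap)
        where
        gap : lhs u +ℚ g ≤ℚ rhs u
        gap rewrite v~u | ≢⇒does (adj⇒≢ G v~u) = w+g≤

    0≤1 : 0ℚ ≤ℚ 1ℚ
    0≤1 = ℚ.nonNegative⁻¹ 1ℚ

    -- The threshold bound for the constant weight 1 with `θ = 0`, the order being the sum of the
    -- class sizes.
    d≤n-1 : ∀ v → d v ≤ℚ ι k +ℚ ι m +ℚ ι s -ℚ 1ℚ
    d≤n-1 v = subst₂ _≤ℚ_ (trans (sum-indicator (adj G v) 1ℚ) (ℚ.*-identityʳ (d v))) (eq (d v) (ι k) (ι m) (ι s))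
      (Threshold.bound (λ _ → 1ℚ) (λ _ → 1ℚ) 0ℚ (λ _ → 0≤1) (λ _ → ℚ.≤-refl) v)
      where
      eq : ∀ d a b c → d *ℚ 0ℚ +ℚ (a *ℚ 1ℚ +ℚ b *ℚ 1ℚ +ℚ c *ℚ 1ℚ -ℚ 1ℚ) ≡ a +ℚ b +ℚ c -ℚ 1ℚ
      eq = solve-∀ ℚ-ring

    d≤mid : ∀ v → cls v ≡ mid → d v ≤ℚ ι k +ℚ ι m -ℚ 1ℚ
    d≤mid v v∈mid = subst₂ _≤ℚ_ (trans (cong (_-ℚ 1ℚ) (trans (ι-+ 1 (degree G v)) (cong (_+ℚ d v) ι-1))) (eq (d v)))
      (cong (_-ℚ 1ℚ) (ι-+ k m)) (ℚ.+-monoˡ-≤ (-ℚ 1ℚ) (ι-mono (mid-degree v v∈mid)))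
      where
      eq : ∀ d → 1ℚ +ℚ d -ℚ 1ℚ ≡ d
      eq = solve-∀ ℚ-ring

  module Bounds {α β γ : ℚ} (0≤γ : 0ℚ ≤ℚ γ) (γ≤β : γ ≤ℚ β) (β≤α : β ≤ℚ α) where

    private
      w : Class → ℚ
      w = weights α β γ

      0≤β : 0ℚ ≤ℚ β
      0≤β = ℚ.≤-trans 0≤γ γ≤β

      0≤α : 0ℚ ≤ℚ α
      0≤α = ℚ.≤-trans 0≤β β≤α

      0≤w : ∀ c → 0ℚ ≤ℚ w c
      0≤w top = 0≤α
      0≤w mid = 0≤β
      0≤w low = 0≤γ

      split : ∀ x y → y ≡ x +ℚ (y -ℚ x)
      split = solve-∀ ℚ-ring

      -- τ c = max (w c - θ) 0 for the thresholds θ = 0, α, β, γ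
      τ-mid τ-low : Class → ℚ
      τ-mid = weights (α -ℚ β) 0ℚ 0ℚ
      τ-low = weights (α -ℚ γ) (β -ℚ γ) 0ℚ

      +0-≤ : ∀ {x y} → x ≤ℚ y → x ≤ℚ y +ℚ 0ℚ
      +0-≤ {x} {y} = subst (x ≤ℚ_) (sym (ℚ.+-identityʳ y))

      w≤α : ∀ c → w c ≤ℚ α +ℚ 0ℚ
      w≤α top = +0-≤ ℚ.≤-refl
      w≤α mid = +0-≤ β≤α
      w≤α low = +0-≤ (ℚ.≤-trans γ≤β β≤α)

      0≤τ-mid : ∀ c → 0ℚ ≤ℚ τ-mid c
      0≤τ-mid top = 0≤- β≤α
      0≤τ-mid mid = ℚ.≤-refl
      0≤τ-mid low = ℚ.≤-refl

      w≤β+τ : ∀ c → w c ≤ℚ β +ℚ τ-mid c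
      w≤β+τ top = ℚ.≤-reflexive (split β α)
      w≤β+τ mid = +0-≤ ℚ.≤-refl
      w≤β+τ low = +0-≤ γ≤β

      0≤τ-low : ∀ c → 0ℚ ≤ℚ τ-low c
      0≤τ-low top = 0≤- (ℚ.≤-trans γ≤β β≤α)
      0≤τ-low mid = 0≤- γ≤β
      0≤τ-low low = ℚ.≤-refl

      w≤γ+τ : ∀ c → w c ≤ℚ γ +ℚ τ-low c
      w≤γ+τ top = ℚ.≤-reflexive (split γ α)
      w≤γ+τ mid = ℚ.≤-reflexive (split γ β)
      w≤γ+τ low = +0-≤ ℚ.≤-refl

      module AtZero = Threshold w w 0ℚ 0≤w (λ c → ℚ.≤-reflexive (sym (ℚ.+-identityˡ (w c))))
      module AtTop = Threshold w (λ _ → 0ℚ) α (λ _ → ℚ.≤-refl) w≤α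
      module AtMid = Threshold w τ-mid β 0≤τ-mid w≤β+τ
      module AtLow = Threshold w τ-low γ 0≤τ-low w≤γ+τ

      -- Each row bound is affine in the degree with nonnegative slope `x`; raising the degree to
      -- the bound `e` of its class turns it into the corresponding entry of `target`.
      degree-slack : ∀ {d e x r y} → d ≤ℚ e → 0ℚ ≤ℚ x → y ≡ r +ℚ (e -ℚ d) *ℚ x → r ≤ℚ y
      degree-slack d≤e 0≤x eq = ≤-add _ (0≤* (0≤- d≤e) 0≤x) eq

      top-row : ∀ v → cls v ≡ top →
        d v *ℚ α +ℚ (d v *ℚ 0ℚ +ℚ (total w -ℚ w (cls v))) ≤ℚ target k m s α β γ top
      top-row v v∈ rewrite v∈ = degree-slack (d≤n-1 v) 0≤α (eq (d v) (ι k) (ι m) (ι s) α β γ)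
        where
        eq : ∀ d k m s α β γ →
          (k +ℚ m +ℚ s -ℚ 1ℚ) *ℚ α +ℚ (k *ℚ α +ℚ m *ℚ β +ℚ s *ℚ γ -ℚ α) ≡
          d *ℚ α +ℚ (d *ℚ 0ℚ +ℚ (k *ℚ α +ℚ m *ℚ β +ℚ s *ℚ γ -ℚ α)) +ℚ (k +ℚ m +ℚ s -ℚ 1ℚ -ℚ d) *ℚ α
        eq = solve-∀ ℚ-ring

      mid-row-mid : ∀ v → cls v ≡ mid →
        d v *ℚ β +ℚ (d v *ℚ β +ℚ (total τ-mid -ℚ τ-mid (cls v)))
        ≤ℚ target k m s α β γ mid
      mid-row-mid v v∈ rewrite v∈ = degree-slack (d≤mid v v∈) (0≤+ 0≤β 0≤β) (eq (d v) (ι k) (ι m) (ι s) α β)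
        where
        eq : ∀ d k m s α β →
          (k +ℚ m -ℚ 1ℚ) *ℚ β +ℚ (k *ℚ α +ℚ m *ℚ β -ℚ β) ≡
          d *ℚ β +ℚ (d *ℚ β +ℚ (k *ℚ (α -ℚ β) +ℚ m *ℚ 0ℚ +ℚ s *ℚ 0ℚ -ℚ 0ℚ)) +ℚ (k +ℚ m -ℚ 1ℚ -ℚ d) *ℚ (β +ℚ β)
        eq = solve-∀ ℚ-ring

      mid-row-low : ∀ v → cls v ≡ mid →
        d v *ℚ β +ℚ (d v *ℚ γ +ℚ (total τ-low -ℚ τ-low (cls v)))
        ≤ℚ target k m s α β γ mid
      mid-row-low v v∈ rewrite v∈ = degree-slack (d≤mid v v∈) (0≤+ 0≤β 0≤γ) (eq (d v) (ι k) (ι m) (ι s) α β γ)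
        where
        eq : ∀ d k m s α β γ →
          (k +ℚ m -ℚ 1ℚ) *ℚ β +ℚ (k *ℚ α +ℚ m *ℚ β -ℚ β) ≡
          d *ℚ β +ℚ (d *ℚ γ +ℚ (k *ℚ (α -ℚ γ) +ℚ m *ℚ (β -ℚ γ) +ℚ s *ℚ 0ℚ -ℚ (β -ℚ γ)))
            +ℚ (k +ℚ m -ℚ 1ℚ -ℚ d) *ℚ (β +ℚ γ)
        eq = solve-∀ ℚ-ring

      low-row-mid : ∀ v → cls v ≡ low →
        d v *ℚ γ +ℚ (d v *ℚ β +ℚ (total τ-mid -ℚ τ-mid (cls v)))
        ≤ℚ target k m s α β γ low
      low-row-mid v v∈ rewrite v∈ =
        degree-slack (ι-mono (low-degree v v∈)) (0≤+ 0≤γ 0≤β) (eq (d v) (ι k) (ι m) (ι s) α β γ)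
        where
        eq : ∀ d k m s α β γ → k *ℚ γ +ℚ k *ℚ α ≡
          d *ℚ γ +ℚ (d *ℚ β +ℚ (k *ℚ (α -ℚ β) +ℚ m *ℚ 0ℚ +ℚ s *ℚ 0ℚ -ℚ 0ℚ)) +ℚ (k -ℚ d) *ℚ (γ +ℚ β)
        eq = solve-∀ ℚ-ring

      low-row-top : ∀ v → cls v ≡ low →
        d v *ℚ γ +ℚ (d v *ℚ α +ℚ (total (λ _ → 0ℚ) -ℚ 0ℚ)) ≤ℚ target k m s α β γ low
      low-row-top v v∈ =
        degree-slack (ι-mono (low-degree v v∈)) (0≤+ 0≤γ 0≤α) (eq (d v) (ι k) (ι m) (ι s) α γ)
        where
        eq : ∀ d k m s α γ → k *ℚ γ +ℚ k *ℚ α ≡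
          d *ℚ γ +ℚ (d *ℚ α +ℚ (k *ℚ 0ℚ +ℚ m *ℚ 0ℚ +ℚ s *ℚ 0ℚ -ℚ 0ℚ)) +ℚ (k -ℚ d) *ℚ (γ +ℚ α)
        eq = solve-∀ ℚ-ring

      combine-row : ∀ {v x r t g} → cls v ≡ x → ∑ⁿ G (w ∘ cls) v +ℚ g ≤ℚ r →
                    d v *ℚ w x +ℚ r ≤ℚ t → Q G (w ∘ cls) v +ℚ g ≤ℚ t
      combine-row {v} {g = g} refl ∑+g≤r row = ℚ.≤-trans
        (ℚ.≤-trans (ℚ.≤-reflexive (ℚ.+-assoc (d v *ℚ w (cls v)) (∑ⁿ G (w ∘ cls) v) g))
          (ℚ.+-monoʳ-≤ (d v *ℚ w (cls v)) ∑+g≤r)) row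

      +0 : ∀ {x r} → x ≤ℚ r → x +ℚ 0ℚ ≤ℚ r
      +0 {x} = subst (_≤ℚ _) (sym (ℚ.+-identityʳ x))

      shift : ∀ x y {g} → g ≤ℚ y -ℚ x → x +ℚ g ≤ℚ y +ℚ 0ℚ
      shift x y g≤y-x = subst₂ _≤ℚ_ refl (eq x y) (ℚ.+-monoʳ-≤ x g≤y-x)
        where
        eq : ∀ x y → x +ℚ (y -ℚ x) ≡ y +ℚ 0ℚ
        eq = solve-∀ ℚ-ring

    row-bound : ∀ v → Q G (w ∘ cls) v ≤ℚ target k m s α β γ (cls v)
    row-bound v = subst (_≤ℚ target k m s α β γ (cls v)) (ℚ.+-identityʳ (Q G (w ∘ cls) v)) (by-class (cls v) refl)
      where
      by-class : ∀ c → cls v ≡ c → Q G (w ∘ cls) v +ℚ 0ℚ ≤ℚ target k m s α β γ c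
      by-class top v∈ = combine-row v∈ (+0 (AtZero.bound v)) (top-row v v∈)
      by-class mid v∈ = combine-row v∈ (+0 (AtMid.bound v)) (mid-row-mid v v∈)
      by-class low v∈ = combine-row v∈ (+0 (AtMid.bound v)) (low-row-mid v v∈)

    -- On the extremal graph the bound is an equality for every threshold between the largest weight
    -- of a class not joined to that of `v` and the smallest weight of a joined one: up to `γ` for
    -- top, from `γ` to `β` for mid, from `β` to `α` for low. A missing neighbour `u` yields a gap
    -- if its weight exceeds the threshold, an extra one if its weight is below it, so the end of
    -- the range is chosen according to the defect.
    defect-bound : ∀ {g} → g ≤ℚ γ → (2 ≤ m → g ≤ℚ β -ℚ γ) → g ≤ℚ α -ℚ β → ∀ {v u} → Defect G cls m v u →
                   Q G (w ∘ cls) v +ℚ g ≤ℚ target k m s α β γ (cls v)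
    defect-bound {g} g≤γ g≤β-γ g≤α-β {v} {u} (defect v≢u ≢joined rel) =
      by-class (cls v) (cls u) refl refl (adj G v u) refl
        (λ eq → ≢joined eq)
      where
      g≤β : g ≤ℚ β
      g≤β = ℚ.≤-trans g≤γ γ≤β
      g≤w : ∀ c → g ≤ℚ w c
      g≤w top = ℚ.≤-trans g≤β β≤α
      g≤w mid = g≤β
      g≤w low = g≤γ
      g≤α-γ : g ≤ℚ α -ℚ γ
      g≤α-γ = ℚ.≤-trans g≤α-β (ℚ.+-monoʳ-≤ α (ℚ.neg-antimono-≤ γ≤β))
      β-gap : ∀ {c} → cls v ≡ mid → cls u ≡ c → c ≢ top → g ≤ℚ β -ℚ γ
      β-gap v∈ u∈ c≢top = [ (λ v∈top → case trans (sym v∈) v∈top of λ ())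
                          , [ (λ u∈top → ⊥-elim (c≢top (trans (sym u∈) u∈top))) , g≤β-γ ]′ ]′ rel
      by-class : ∀ c c′ → cls v ≡ c → cls u ≡ c′ → ∀ b → adj G v u ≡ b →
        (adj G v u ≡ joined (cls v) (cls u) → ⊥) → Q G (w ∘ cls) v +ℚ g ≤ℚ target k m s α β γ c
      by-class top c′ v∈ u∈ true eq ne = ⊥-elim (ne (trans eq (sym (cong (λ c → joined c (cls u)) v∈))))
      by-class top c′ v∈ u∈ false eq ne =
        combine-row v∈ (AtZero.missing-bound v v≢u eq (g≤w (cls u))) (top-row v v∈)
      by-class mid top v∈ u∈ true eq ne = ⊥-elim (ne (trans eq (sym (cong₂ joined v∈ u∈))))
      by-class mid top v∈ u∈ false eq ne = combine-row v∈
        (AtMid.missing-bound v v≢u eq (subst (λ c → g ≤ℚ τ-mid c) (sym u∈) g≤α-β))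
        (mid-row-mid v v∈)
      by-class mid mid v∈ u∈ true eq ne = ⊥-elim (ne (trans eq (sym (cong₂ joined v∈ u∈))))
      by-class mid mid v∈ u∈ false eq ne = combine-row v∈
        (AtLow.missing-bound v v≢u eq (subst (λ c → g ≤ℚ τ-low c) (sym u∈) (β-gap v∈ u∈ λ ())))
        (mid-row-low v v∈)
      by-class mid low v∈ u∈ true eq ne = combine-row v∈
        (AtMid.extra-bound v eq
          (subst (λ c → w c +ℚ g ≤ℚ β +ℚ τ-mid c) (sym u∈) (shift γ β (β-gap v∈ u∈ λ ()))))
        (mid-row-mid v v∈)
      by-class mid low v∈ u∈ false eq ne = ⊥-elim (ne (trans eq (sym (cong₂ joined v∈ u∈))))
      by-class low top v∈ u∈ true eq ne = ⊥-elim (ne (trans eq (sym (cong₂ joined v∈ u∈))))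
      by-class low top v∈ u∈ false eq ne = combine-row v∈
        (AtMid.missing-bound v v≢u eq (subst (λ c → g ≤ℚ τ-mid c) (sym u∈) g≤α-β))
        (low-row-mid v v∈)
      by-class low mid v∈ u∈ true eq ne = combine-row v∈
        (AtTop.extra-bound v eq (subst (λ c → w c +ℚ g ≤ℚ α +ℚ 0ℚ) (sym u∈) (shift β α g≤α-β)))
        (low-row-top v v∈)
      by-class low mid v∈ u∈ false eq ne = ⊥-elim (ne (trans eq (sym (cong₂ joined v∈ u∈))))
      by-class low low v∈ u∈ true eq ne = combine-row v∈
        (AtTop.extra-bound v eq (subst (λ c → w c +ℚ g ≤ℚ α +ℚ 0ℚ) (sym u∈) (shift γ α g≤α-γ)))
        (low-row-top v v∈)
      by-class low low v∈ u∈ false eq ne = ⊥-elim (ne (trans eq (sym (cong₂ joined v∈ u∈))))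

-- Graphs in which the classes determine adjacency

Model : ∀ {n} → Graph n → (Fin n → Class) → Set
Model G cls = ∀ v u → v ≢ u → adj G v u ≡ joined (cls v) (cls u)

module _ {n} {G : Graph n} {cls : Fin n → Class} {k m s : ℕ} (model : Model G cls) (sizes : Sizes cls k m s) where

  open Sizes sizes

  private
    total : (Class → ℚ) → ℚ
    total τ = ι k *ℚ τ top +ℚ ι m *ℚ τ mid +ℚ ι s *ℚ τ low

    near : (Class → ℚ) → Class → Class → ℚ
    near y c c′ = y c′ when joined c c′

    ∑ⁿ-model : ∀ (y : Class → ℚ) v → ∑ⁿ G (y ∘ cls) v ≡ total (near y (cls v)) -ℚ near y (cls v) (cls v)
    ∑ⁿ-model y v = begin
      sum (λ u → y (cls u) when adj G v u)
        ≡⟨ sum-cong-≗ (λ u → term u (v Fin.≟ u)) ⟩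
      sum (λ u → near y (cls v) (cls u) when not (does (v Fin.≟ u)))
        ≡⟨ sum-others (near y (cls v) ∘ cls) v ⟩
      sum (near y (cls v) ∘ cls) -ℚ near y (cls v) (cls v)
        ≡⟨ cong (_-ℚ near y (cls v) (cls v)) (sum-class (near y (cls v))) ⟩
      total (near y (cls v)) -ℚ near y (cls v) (cls v) ∎
      where
      open ≡-Reasoning
      term : ∀ u (v≟u : Dec (v ≡ u)) → y (cls u) when adj G v u ≡ near y (cls v) (cls u) when not (does v≟u)
      term u (yes refl) = cong (y (cls u) when_) (irrefl G u)
      term u (no v≢u)   = cong (y (cls u) when_) (model v u v≢u)

    degree-model : ∀ v → ι (degree G v) ≡ total (near (λ _ → 1ℚ) (cls v)) -ℚ near (λ _ → 1ℚ) (cls v) (cls v)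
    degree-model v = trans (sym (trans (sum-indicator (adj G v) 1ℚ) (ℚ.*-identityʳ (ι (degree G v)))))
      (∑ⁿ-model (λ _ → 1ℚ) v)

  Q-model : ∀ α β γ v → Q G (weights α β γ ∘ cls) v ≡ target k m s α β γ (cls v)
  Q-model α β γ v = trans
    (cong₂ (λ d b → d *ℚ w (cls v) +ℚ b) (degree-model v) (∑ⁿ-model w v))
    (by-class (cls v))
    where
    w : Class → ℚ
    w = weights α β γ
    by-class : ∀ c → (total (near (λ _ → 1ℚ) c) -ℚ near (λ _ → 1ℚ) c c) *ℚ w c +ℚ (total (near w c) -ℚ near w c c)
               ≡ target k m s α β γ c
    by-class top = eq (ι k) (ι m) (ι s) α β γ
      where
      eq : ∀ k m s α β γ → (k *ℚ 1ℚ +ℚ m *ℚ 1ℚ +ℚ s *ℚ 1ℚ -ℚ 1ℚ) *ℚ α +ℚ (k *ℚ α +ℚ m *ℚ β +ℚ s *ℚ γ -ℚ α) ≡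
        (k +ℚ m +ℚ s -ℚ 1ℚ) *ℚ α +ℚ (k *ℚ α +ℚ m *ℚ β +ℚ s *ℚ γ -ℚ α)
      eq = solve-∀ ℚ-ring
    by-class mid = eq (ι k) (ι m) (ι s) α β
      where
      eq : ∀ k m s α β → (k *ℚ 1ℚ +ℚ m *ℚ 1ℚ +ℚ s *ℚ 0ℚ -ℚ 1ℚ) *ℚ β +ℚ (k *ℚ α +ℚ m *ℚ β +ℚ s *ℚ 0ℚ -ℚ β) ≡
        (k +ℚ m -ℚ 1ℚ) *ℚ β +ℚ (k *ℚ α +ℚ m *ℚ β -ℚ β)
      eq = solve-∀ ℚ-ring
    by-class low = eq (ι k) (ι m) (ι s) α γ
      where
      eq : ∀ k m s α γ → (k *ℚ 1ℚ +ℚ m *ℚ 0ℚ +ℚ s *ℚ 0ℚ -ℚ 0ℚ) *ℚ γ +ℚ (k *ℚ α +ℚ m *ℚ 0ℚ +ℚ s *ℚ 0ℚ -ℚ 0ℚ) ≡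
        k *ℚ γ +ℚ k *ℚ α
      eq = solve-∀ ℚ-ring

  -- A class-constant vector reduces the eigenvalue equation to the three entries of `target`. It is
  -- required only up to null sequences, as a root is known only approximately at each index; one
  -- weight bounded away from zero makes the vector nonzero.
  model-eigenvalue : ∀ (q α β γ : ℝ) →
    (∀ v ε → 0ℚ <ℚ ε → ∃ λ N → ∀ j → N ≤ j →
      ∣ target k m s (seq α j) (seq β j) (seq γ j) (cls v)
        -ℚ seq q j *ℚ weights (seq α j) (seq β j) (seq γ j) (cls v) ∣ ≤ℚ ε) →
    (∃ λ v → ∃ λ ε → 0ℚ <ℚ ε × (∀ j → ε <ℚ weights (seq α j) (seq β j) (seq γ j) (cls v))) →
    IsEigenvalue (signlessLaplacian G) q
  model-eigenvalue q α β γ eigen (v₀ , ε₀ , 0<ε₀ , ε₀<w) = x , nonzero , λ v ε 0<ε →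
    proj₁ (eigen v ε 0<ε) , λ j N≤j → subst₂ (λ a b → ∣ a -ℚ seq q j *ℚ b ∣ ≤ℚ ε)
      (sym (trans (seq-Q G x v j) (trans (Q-cong j v) (Q-model (seq α j) (seq β j) (seq γ j) v))))
      (sym (seq-x j (cls v)))
      (proj₂ (eigen v ε 0<ε) j N≤j)
    where
    weightsᴿ : Class → ℝ
    weightsᴿ top = α
    weightsᴿ mid = β
    weightsᴿ low = γ
    x : Fin n → ℝ
    x = weightsᴿ ∘ cls
    seq-x : ∀ j c → seq (weightsᴿ c) j ≡ weights (seq α j) (seq β j) (seq γ j) c
    seq-x j top = refl
    seq-x j mid = refl
    seq-x j low = refl
    Q-cong : ∀ j v → Q G (λ u → seq (x u) j) v ≡ Q G (weights (seq α j) (seq β j) (seq γ j) ∘ cls) v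
    Q-cong j v = cong₂ (λ a b → ι (degree G v) *ℚ a +ℚ b) (seq-x j (cls v))
      (sum-cong-≗ λ u → cong (_when adj G v u) (seq-x j (cls u)))
    nonzero : ¬ (∀ v → x v ≈ 0ᴿ)
    nonzero x≈0 = let N , close = x≈0 v₀ ε₀ 0<ε₀ in
      ℚ.<-irrefl refl (ℚ.<-≤-trans
        (subst (ε₀ <ℚ_) (sym (trans (ℚ.+-identityʳ _) (seq-x N (cls v₀)))) (ε₀<w N))
        (ℚ.≤-trans (p≤∣p∣ _) (close N ℕ.≤-refl)))

-- Counting classes, isomorphism of models, the extremal graphs

count-cong : ∀ {n} {p q : Fin n → Bool} → (∀ i → p i ≡ q i) → count p ≡ count q
count-cong {zero}  p≗q = refl
count-cong {suc n} {p} {q} p≗q = trans (count-suc p) (trans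
  (cong₂ (λ b c → (if b then 1 else 0) + c) (p≗q zero) (count-cong (p≗q ∘ suc))) (sym (count-suc q)))

count-true : ∀ {n} → count {n} (λ _ → true) ≡ n
count-true {zero}  = refl
count-true {suc n} = cong suc (count-true {n})

count-false : ∀ {n} → count {n} (λ _ → false) ≡ 0
count-false {zero}  = refl
count-false {suc n} = count-false {n}

count-+ : ∀ a {b} (p : Fin (a + b) → Bool) → count p ≡ count (p ∘ (_↑ˡ b)) + count (p ∘ (a ↑ʳ_))
count-+ zero    p = refl
count-+ (suc a) {b} p = begin
  count p
    ≡⟨ count-suc p ⟩
  x + count (p ∘ suc)
    ≡⟨ cong (x +_) (count-+ a (p ∘ suc)) ⟩
  x + (count (p ∘ suc ∘ (_↑ˡ b)) + count (p ∘ suc ∘ (a ↑ʳ_)))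
    ≡⟨ ℕ.+-assoc x _ _ ⟨
  x + count (p ∘ suc ∘ (_↑ˡ b)) + count (p ∘ suc ∘ (a ↑ʳ_))
    ≡⟨ cong (_+ count (p ∘ suc ∘ (a ↑ʳ_))) (count-suc (p ∘ (_↑ˡ b))) ⟨
  count (p ∘ (_↑ˡ b)) + count (p ∘ suc ∘ (a ↑ʳ_)) ∎
  where
  open ≡-Reasoning
  x : ℕ
  x = if p zero then 1 else 0

count-remove : ∀ {n} (p : Fin (suc n) → Bool) i → count p ≡ (if p i then 1 else 0) + count (p ∘ punchIn i)
count-remove p zero = count-suc p
count-remove {suc n} p (suc i) = begin
  count p
    ≡⟨ count-suc p ⟩
  x + count (p ∘ suc)
    ≡⟨ cong (x +_) (count-remove (p ∘ suc) i) ⟩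
  x + (y + count (p ∘ suc ∘ punchIn i))
    ≡⟨ swap x y _ ⟩
  y + (x + count (p ∘ suc ∘ punchIn i))
    ≡⟨ cong (y +_) (count-suc (p ∘ punchIn (suc i))) ⟨
  y + count (p ∘ punchIn (suc i)) ∎
  where
  open ≡-Reasoning
  x y : ℕ
  x = if p zero then 1 else 0
  y = if p (suc i) then 1 else 0
  swap : ∀ a b c → a + (b + c) ≡ b + (a + c)
  swap = solve-ℕ

count⇒∃ : ∀ {n} (p : Fin n → Bool) → 1 ≤ count p → ∃ λ i → p i ≡ true
count⇒∃ {suc n} p 1≤ with p zero in eq
... | true  = zero , eq
... | false = let i , pi = count⇒∃ (p ∘ suc) 1≤ in suc i , pi

∃⇒count : ∀ {n} (p : Fin n → Bool) i → p i ≡ true → 1 ≤ count p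
∃⇒count {suc n} p i pi = subst (1 ≤_) (sym (count-remove p i))
  (subst (λ b → 1 ≤ (if b then 1 else 0) + count (p ∘ punchIn i)) (sym pi) (s≤s z≤n))

==⇒≡ : ∀ {c d} → (c == d) ≡ true → c ≡ d
==⇒≡ {top} {top} _ = refl
==⇒≡ {mid} {mid} _ = refl
==⇒≡ {low} {low} _ = refl

==-refl : ∀ c → (c == c) ≡ true
==-refl top = refl
==-refl mid = refl
==-refl low = refl

-- Pairs the first vertex with some vertex of the same class on the other side, which exists by
-- equality of the counts, and removes both.
matching : ∀ {n n′} (c : Fin n → Class) (c′ : Fin n′ → Class) →
  (∀ x → count (λ v → c v == x) ≡ count (λ v → c′ v == x)) →
  Σ[ π ∈ Permutation n n′ ] (∀ i → c′ (π ⟨$⟩ʳ i) ≡ c i)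
matching {zero} {zero} c c′ counts = idᵖ , λ ()
matching {zero} {suc n′} c c′ counts = contradiction
  (subst (1 ≤_) (sym (counts (c′ zero))) (∃⇒count (λ v → c′ v == c′ zero) zero (==-refl (c′ zero)))) λ ()
matching {suc n} {zero} c c′ counts = contradiction
  (subst (1 ≤_) (counts (c zero)) (∃⇒count (λ v → c v == c zero) zero (==-refl (c zero)))) λ ()
matching {suc n} {suc n′} c c′ counts =
  let j , c′j==c0 = count⇒∃ (λ v → c′ v == c zero)
        (subst (1 ≤_) (counts (c zero)) (∃⇒count (λ v → c v == c zero) zero (==-refl (c zero))))
      c′j≡c0 = ==⇒≡ c′j==c0
      π , c′π≡c = matching (c ∘ suc) (c′ ∘ punchIn j) λ x → ℕ.+-cancelˡ-≡ (if c zero == x then 1 else 0) _ _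
        (trans (sym (count-suc (λ v → c v == x))) (trans (counts x) (trans (count-remove (λ v → c′ v == x) j)
          (cong (λ a → (if a == x then 1 else 0) + count (λ v → c′ (punchIn j v) == x)) c′j≡c0))))
  in insert zero j π , λ
    { zero    → c′j≡c0
    ; (suc i) → trans (cong c′ (insert-punchIn zero j π i)) (c′π≡c i) }

module _ {n n′} {G : Graph n} {H : Graph n′} {c : Fin n → Class} {c′ : Fin n′ → Class} {k m s : ℕ} where

  model-≅ : Model G c → Sizes c k m s → Model H c′ → Sizes c′ k m s → G ≅ H
  model-≅ G-model G-sizes H-model H-sizes = π , λ u v → iso u v (u Fin.≟ v)
    where
    open Sizes
    counts : ∀ x → count (λ v → c v == x) ≡ count (λ v → c′ v == x)
    counts top = trans (size-top G-sizes) (sym (size-top H-sizes))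
    counts mid = trans (size-mid G-sizes) (sym (size-mid H-sizes))
    counts low = trans (size-low G-sizes) (sym (size-low H-sizes))
    π : Permutation n n′
    π = proj₁ (matching c c′ counts)
    c′π≡c : ∀ i → c′ (π ⟨$⟩ʳ i) ≡ c i
    c′π≡c = proj₂ (matching c c′ counts)
    iso : ∀ u v → Dec (u ≡ v) → adj G u v ≡ adj H (π ⟨$⟩ʳ u) (π ⟨$⟩ʳ v)
    iso u .u (yes refl) = trans (irrefl G u) (sym (irrefl H (π ⟨$⟩ʳ u)))
    iso u v (no u≢v) = trans (G-model u v u≢v) (trans
      (sym (cong₂ joined (c′π≡c u) (c′π≡c v)))
      (sym (H-model _ _ λ eq → u≢v (injective eq))))
      where
      injective : ∀ {u v} → π ⟨$⟩ʳ u ≡ π ⟨$⟩ʳ v → u ≡ v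
      injective {u} {v} eq = trans (sym (Inverse.strictlyInverseʳ π u))
        (trans (cong (Inverse.from π) eq) (Inverse.strictlyInverseʳ π v))

-- Common form of the two families: `N n k` has `m = n - 2k` and `s = k`, while `N̲ n k` has
-- `m = n - 2k - 1` and `s = k + 1`.
Extremal : (k m s : ℕ) → Graph (k + (m + s * 1))
Extremal k m s = K k ∨ (K m ∪ copies s (K 1))

copies-empty : ∀ s u v → adj (copies s (K 1)) u v ≡ false
copies-empty (suc s) u v with splitAt 1 u | splitAt 1 v
... | inj₁ zero | inj₁ zero = refl
... | inj₁ zero | inj₂ _    = refl
... | inj₂ _    | inj₁ zero = refl
... | inj₂ u′   | inj₂ v′   = copies-empty s u′ v′

module _ (k m s : ℕ) where

  private
    side : Fin (m + s * 1) → Class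
    side u = [ (λ _ → mid) , (λ _ → low) ]′ (splitAt m u)

  extremalClass : Fin (k + (m + s * 1)) → Class
  extremalClass u = [ (λ _ → top) , side ]′ (splitAt k u)

  private
    counts : ∀ x → count (λ v → extremalClass v == x) ≡
      count {k} (λ _ → top == x) + (count {m} (λ _ → mid == x) + count {s * 1} (λ _ → low == x))
    counts x = trans (count-+ k (λ v → extremalClass v == x)) (cong₂ _+_
      (count-cong λ i → cong (λ z → [ (λ _ → top) , side ]′ z == x) (Fin.splitAt-↑ˡ k i (m + s * 1)))
      (trans (count-cong λ i → cong (λ z → [ (λ _ → top) , side ]′ z == x) (Fin.splitAt-↑ʳ k (m + s * 1) i))
      (trans (count-+ m (λ v → side v == x)) (cong₂ _+_
        (count-cong λ i → cong (λ z → [ (λ _ → mid) , (λ _ → low) ]′ z == x) (Fin.splitAt-↑ˡ m i (s * 1)))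
        (count-cong λ i → cong (λ z → [ (λ _ → mid) , (λ _ → low) ]′ z == x) (Fin.splitAt-↑ʳ m (s * 1) i))))))

  extremal-sizes : Sizes extremalClass k m s
  extremal-sizes = record
    { size-top = trans (counts top) (trans
        (cong₂ _+_ (count-true {k}) (cong₂ _+_ (count-false {m}) (count-false {s * 1}))) (ℕ.+-identityʳ k))
    ; size-mid = trans (counts mid) (trans
        (cong₂ _+_ (count-false {k}) (cong₂ _+_ (count-true {m}) (count-false {s * 1}))) (ℕ.+-identityʳ m))
    ; size-low = trans (counts low) (trans
        (cong₂ _+_ (count-false {k}) (cong₂ _+_ (count-false {m}) (count-true {s * 1}))) (ℕ.*-identityʳ s))
    }

  private
    K-adj : ∀ {n} (u v : Fin n) → u ≢ v → adj (K n) u v ≡ true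
    K-adj u v u≢v = cong not (≢⇒does u≢v)

    side-model : ∀ u v → u ≢ v → adj (K m ∪ copies s (K 1)) u v ≡ joined (side u) (side v)
    side-model u v u≢v with splitAt m u in equ | splitAt m v in eqv
    ... | inj₁ u′ | inj₁ v′ = K-adj u′ v′ λ { refl → u≢v (trans (sym (Fin.splitAt⁻¹-↑ˡ equ)) (Fin.splitAt⁻¹-↑ˡ eqv)) }
    ... | inj₁ u′ | inj₂ v′ = refl
    ... | inj₂ u′ | inj₁ v′ = refl
    ... | inj₂ u′ | inj₂ v′ = copies-empty s u′ v′

  extremal-model : Model (Extremal k m s) extremalClass
  extremal-model u v u≢v with splitAt k u in equ | splitAt k v in eqv
  ... | inj₁ u′ | inj₁ v′ = K-adj u′ v′ λ { refl → u≢v (trans (sym (Fin.splitAt⁻¹-↑ˡ equ)) (Fin.splitAt⁻¹-↑ˡ eqv)) }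
  ... | inj₁ u′ | inj₂ v′ = refl
  ... | inj₂ u′ | inj₁ v′ = joined-sym top (side u′)
  ... | inj₂ u′ | inj₂ v′ = side-model u′ v′
    λ { refl → u≢v (trans (sym (Fin.splitAt⁻¹-↑ʳ equ)) (Fin.splitAt⁻¹-↑ʳ eqv)) }

-- Weights on the three classes that `Q` of the extremal graph multiplies by at most `h`, at every
-- index. The rational `g` is a uniform lower bound for the weights and their gaps, hence the slack
-- earned by a defect; `extra` is slack available at low vertices in any case. A single mid vertex
-- may weigh as much as a low one, and without top vertices their row is void, hence the two
-- conditional fields.
record Stretch (k m s : ℕ) : Set where
  field
    h α β γ : ℝ
    g extra : ℚ
    0<g     : 0ℚ <ℚ g
    0≤extra : 0ℚ ≤ℚ extra
    0≤h     : ∀ j → 0ℚ ≤ℚ seq h j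
    g≤γ     : ∀ j → g ≤ℚ seq γ j
    γ≤β     : ∀ j → seq γ j ≤ℚ seq β j
    g≤β-γ   : 2 ≤ m → ∀ j → g ≤ℚ seq β j -ℚ seq γ j
    g≤α-β   : ∀ j → g ≤ℚ seq α j -ℚ seq β j
    top-row : 1 ≤ k → ∀ j → target k m s (seq α j) (seq β j) (seq γ j) top ≤ℚ seq h j *ℚ seq α j
    mid-row : ∀ j → target k m s (seq α j) (seq β j) (seq γ j) mid ≤ℚ seq h j *ℚ seq β j
    low-row : ∀ j → target k m s (seq α j) (seq β j) (seq γ j) low +ℚ extra ≤ℚ seq h j *ℚ seq γ j

-- Vanishing of an eigenvector whose eigenvalue is at least `h`

real-bounded : ∀ x → Bounded (seq x)
real-bounded x = let B , M , 0<B , ≤B = cauchy⇒bounded x in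
  B , M , 0<B , λ j M≤j → ℚ.≤-trans (p≤∣p∣ (seq x j)) (≤B j M≤j)

defect? : ∀ {n} (G : Graph n) cls m v u → Dec (Defect G cls m v u)
defect? G cls m v u
  with v Fin.≟ u | adj G v u Bool.≟ joined (cls v) (cls u) | relevant? (cls v) (cls u)
  where
  top? : ∀ c → Dec (c ≡ top)
  top? top = yes refl
  top? mid = no λ ()
  top? low = no λ ()
  relevant? : ∀ c c′ → Dec (c ≡ top ⊎ c′ ≡ top ⊎ 2 ≤ m)
  relevant? c c′ = top? c ⊎-dec top? c′ ⊎-dec 2 ℕ.≤? m
... | yes v≡u | _     | _     = no λ d → Defect.distinct d v≡u
... | no _    | yes e | _     = no λ d → Defect.mismatch d e
... | no _    | no _  | no r  = no λ d → r (Defect.relevant d)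
... | no v≢u  | no e  | yes r = yes (defect v≢u e r)

module Nullity {n} {G : Graph n} {cls : Fin n → Class} {k m s : ℕ}
  (D : Dominated G cls k m s) (P : Stretch k m s)
  {x : Fin n → ℝ} {q : ℝ} (Qx≈qx : ∀ v → (signlessLaplacian G · x) v ≈ q *ᴿ x v)
  (h≤q : Stretch.h P ≤ᴿ q) where

  open Dominated D
  open Stretch P

  private
    X : Fin n → Sequence
    X v j = ∣ seq (x v) j ∣

    w : ℕ → Class → ℚ
    w j = weights (seq α j) (seq β j) (seq γ j)

    step : ∀ {a b} → g ≤ℚ b -ℚ a → a ≤ℚ b
    step {a} {b} g≤b-a = ≤-add (b -ℚ a) (ℚ.≤-trans (ℚ.<⇒≤ 0<g) g≤b-a) (split a b)
      where
      split : ∀ a b → b ≡ a +ℚ (b -ℚ a)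
      split = solve-∀ ℚ-ring

    β≤α : ∀ j → seq β j ≤ℚ seq α j
    β≤α j = step (g≤α-β j)

    g≤w : ∀ c j → g ≤ℚ w j c
    g≤w top j = ℚ.≤-trans (g≤γ j) (ℚ.≤-trans (γ≤β j) (β≤α j))
    g≤w mid j = ℚ.≤-trans (g≤γ j) (γ≤β j)
    g≤w low j = g≤γ j

    w-bounded : ∀ c → Bounded (λ j → w j c)
    w-bounded top = real-bounded α
    w-bounded mid = real-bounded β
    w-bounded low = real-bounded γ

    loose? : ∀ v → Dec (∃ λ u → Defect G cls m v u)
    loose? v = Fin.any? (defect? G cls m v)

    slackᶜ : Class → ℚ
    slackᶜ c = extra when (c == low)

    slack : Fin n → ℚ
    slack v = g when does (loose? v) +ℚ slackᶜ (cls v)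

    0≤when : ∀ {y} → 0ℚ ≤ℚ y → ∀ b → 0ℚ ≤ℚ y when b
    0≤when 0≤y true  = 0≤y
    0≤when 0≤y false = ℚ.≤-refl

    0≤slack : ∀ v → 0ℚ ≤ℚ slack v
    0≤slack v = 0≤+ (0≤when (ℚ.<⇒≤ 0<g) (does (loose? v))) (0≤when 0≤extra (cls v == low))

    1≤k : ∀ v → cls v ≡ top → 1 ≤ k
    1≤k v v∈top = subst (1 ≤_) size-top (∃⇒count (λ v → cls v == top) v (cong (_== top) v∈top))

    rows : ∀ j v → target k m s (seq α j) (seq β j) (seq γ j) (cls v) +ℚ slackᶜ (cls v) ≤ℚ seq h j *ℚ w j (cls v)
    rows j v = by-class (cls v) refl
      where
      +0 : ∀ {y z} → y ≤ℚ z → y +ℚ 0ℚ ≤ℚ z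
      +0 {y} = subst (_≤ℚ _) (sym (ℚ.+-identityʳ y))
      by-class : ∀ c → cls v ≡ c →
        target k m s (seq α j) (seq β j) (seq γ j) c +ℚ slackᶜ c ≤ℚ seq h j *ℚ w j c
      by-class top v∈ = +0 (top-row (1≤k v v∈) j)
      by-class mid v∈ = +0 (mid-row j)
      by-class low v∈ = low-row j

    Qw+slack≤hw : ∀ v j → Q G (λ u → w j (cls u)) v +ℚ slack v ≤ℚ seq h j *ℚ w j (cls v)
    Qw+slack≤hw v j = ℚ.≤-trans
      (ℚ.≤-trans (ℚ.≤-reflexive (sym (ℚ.+-assoc (Q G (w j ∘ cls) v) (g when does (loose? v)) (slackᶜ (cls v)))))
        (ℚ.+-monoˡ-≤ (slackᶜ (cls v)) (main (loose? v))))
      (rows j v)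
      where
      open Rows.Bounds D {seq α j} {seq β j} {seq γ j} (ℚ.≤-trans (ℚ.<⇒≤ 0<g) (g≤γ j)) (γ≤β j) (β≤α j)
      main : (l : Dec (∃ λ u → Defect G cls m v u)) →
        Q G (w j ∘ cls) v +ℚ g when does l ≤ℚ target k m s (seq α j) (seq β j) (seq γ j) (cls v)
      main (yes (u , d)) = defect-bound (g≤γ j) (λ 2≤m → g≤β-γ 2≤m j) (g≤α-β j) d
      main (no _) = subst (_≤ℚ target k m s (seq α j) (seq β j) (seq γ j) (cls v))
        (sym (ℚ.+-identityʳ (Q G (w j ∘ cls) v))) (row-bound v)

    open CollatzWielandt G X (λ v j → w j (cls v)) (seq q) (seq h) slack
      (λ v j → ℚ.0≤∣p∣ (seq (x v) j)) (λ v → cauchy⇒bounded (x v)) (eigen-abs G x q Qx≈qx)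
      0<g (λ v → g≤w (cls v)) (λ v → w-bounded (cls v))
      (mk≲ h≤q) 0≤h (real-bounded h) 0≤slack Qw+slack≤hw

  Null : Fin n → Set
  Null v = X v ≲ 0ˢ

  defect⇒null : ∀ {v u} → Defect G cls m v u → Null v
  defect⇒null {v} {u} d = slack⇒null (positive (loose? v))
    where
    positive : (l : Dec (∃ λ u → Defect G cls m v u)) → 0ℚ <ℚ g when does l +ℚ slackᶜ (cls v)
    positive (yes _) = ℚ.<-≤-trans 0<g (≤-add (slackᶜ (cls v)) (0≤when 0≤extra (cls v == low)) refl)
    positive (no ¬l) = contradiction (u , d) ¬l

  low⇒null : 0ℚ <ℚ extra → ∀ {v} → cls v ≡ low → Null v
  low⇒null 0<extra {v} v∈low = slack⇒null (ℚ.<-≤-trans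
    (subst (λ c → 0ℚ <ℚ slackᶜ c) (sym v∈low) 0<extra)
    (≤-add (g when does (loose? v)) (0≤when (ℚ.<⇒≤ 0<g) (does (loose? v)))
      (ℚ.+-comm (g when does (loose? v)) (slackᶜ (cls v)))))

  -- A pair that is joined in the extremal graph is either adjacent or a defect.
  spread : ∀ {v u} → cls v ≡ top ⊎ cls u ≡ top ⊎ 2 ≤ m → Null v → joined (cls v) (cls u) ≡ true → Null u
  spread {v} {u} rel v-null v-u = by-adjacency (v Fin.≟ u) (adj G v u) refl
    where
    by-adjacency : Dec (v ≡ u) → ∀ b → adj G v u ≡ b → Null u
    by-adjacency (yes v≡u) b     _  = subst Null v≡u v-null
    by-adjacency (no v≢u)  true  eq = null⇒neighbour-null eq v-null
    by-adjacency (no v≢u)  false eq = defect⇒null (defect-sym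
      (defect v≢u (λ e → case trans (sym eq) (trans e v-u) of λ ()) rel))

  -- Every vertex is joined to a top vertex, so nullity reaches that vertex from anywhere and passes
  -- from it to all others.
  top-spread : 1 ≤ k → ∀ {v} → Null v → ∀ u → Null u
  top-spread 1≤k {v} v-null u =
    let b , b∈top = count⇒∃ (λ v → cls v == top) (subst (1 ≤_) (sym size-top) 1≤k)
        b≡top = ==⇒≡ b∈top
    in spread (inj₁ b≡top)
        (spread (inj₂ (inj₁ b≡top)) v-null (subst (λ c → joined (cls v) c ≡ true) (sym b≡top) (joined-sym (cls v) top)))
        (cong (λ c → joined c (cls u)) b≡top)

  all-null : (∀ v → Null v) → ∀ v → x v ≈ 0ᴿ
  all-null null v = null⇒≈0 (x v) (null v)

-- An explicit eigenvalue and weights for the extremal graph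

private
  0≤1 : 0ℚ ≤ℚ 1ℚ
  0≤1 = ℚ.nonNegative⁻¹ 1ℚ

  0<1 : 0ℚ <ℚ 1ℚ
  0<1 = ℚ.positive⁻¹ 1ℚ

  1≤* : ∀ {x y} → 1ℚ ≤ℚ x → 1ℚ ≤ℚ y → 1ℚ ≤ℚ x *ℚ y
  1≤* 1≤x 1≤y = *-mono {1ℚ} {_} {1ℚ} 0≤1 (ℚ.≤-trans 0≤1 1≤y) 1≤x 1≤y

  two≤⇒1≤ : ∀ {x} → 1ℚ +ℚ 1ℚ ≤ℚ x → 1ℚ ≤ℚ x
  two≤⇒1≤ = ℚ.≤-trans (≤-add {1ℚ} {1ℚ +ℚ 1ℚ} 1ℚ 0≤1 refl)

  lower-bound : ∀ {σ} → 0ℚ <ℚ σ → ∃ λ g → 0ℚ <ℚ g × g ≤ℚ σ × g ≤ℚ 1ℚ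
  lower-bound {σ} 0<σ = [ (λ σ≤1 → σ , 0<σ , ℚ.≤-refl , σ≤1) , (λ 1≤σ → 1ℚ , 0<1 , 1≤σ , ℚ.≤-refl) ]′
    (ℚ.≤-total σ 1ℚ)

-- Twice the degree in the clique on the top and mid vertices.
cliqueBound : (k m : ℕ) → ℚ
cliqueBound k m = ι m +ℚ ι m +ℚ ι k -ℚ 1ℚ -ℚ 1ℚ +ℚ ι k

-- For k = 0 the eigenvector vanishes on the low vertices, so P has to use other weights.
record Spectral (k m s : ℕ) : Set where
  field
    P          : Stretch k m s
    eigenvalue : IsEigenvalue (signlessLaplacian (Extremal k m s)) (Stretch.h P)
    clique≤h   : ∀ j → cliqueBound k m ≤ℚ seq (Stretch.h P) j
    positive   : 1 ≤ k ⊎ 0ℚ <ℚ Stretch.extra P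

module _ (k m s : ℕ) (1≤k : 1 ≤ k) (2≤m : 2 ≤ m) (1≤s : 1 ≤ s) where

  private
    1≤m : 1 ≤ m
    1≤m = ℕ.≤-trans (s≤s z≤n) 2≤m

    open Cubic k m s 1≤k 1≤m 1≤s

    1≤κ : 1ℚ ≤ℚ κ
    1≤κ = subst (_≤ℚ κ) ι-1 (ι-mono 1≤k)

    2≤M : 1ℚ +ℚ 1ℚ ≤ℚ M
    2≤M = subst (_≤ℚ M) (trans (ι-+ 1 1) (cong₂ _+ℚ_ ι-1 ι-1)) (ι-mono 2≤m)

    h h-κ h-c α β γ : ℝ
    h   = mkℝ root root-cauchy
    h-κ = h +ᴿ fromℚ (-ℚ κ)
    h-c = h +ᴿ fromℚ (-ℚ c)
    -- The mid and low rows of the quotient matrix read `(h - c) β = κ α` and `(h - κ) γ = κ α`;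
    -- clearing denominators gives this polynomial form of the Perron vector, for which both rows
    -- hold exactly at every index.
    α   = h-κ *ᴿ h-c
    β   = fromℚ κ *ᴿ h-κ
    γ   = fromℚ κ *ᴿ h-c

    T : ℕ → Class → ℚ
    T j = target k m s (seq α j) (seq β j) (seq γ j)

    T-low : ∀ j → T j low ≡ seq h j *ℚ seq γ j
    T-low j = eq κ c (root j)
      where
      eq : ∀ κ c h → κ *ℚ (κ *ℚ (h -ℚ c)) +ℚ κ *ℚ ((h -ℚ κ) *ℚ (h -ℚ c)) ≡ h *ℚ (κ *ℚ (h -ℚ c))
      eq = solve-∀ ℚ-ring

    T-mid : ∀ j → T j mid ≡ seq h j *ℚ seq β j
    T-mid j = eq κ M (root j)
      where
      eq : ∀ κ M h → let c = M +ℚ M +ℚ κ -ℚ 1ℚ -ℚ 1ℚ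
                         α = (h -ℚ κ) *ℚ (h -ℚ c)
                         β = κ *ℚ (h -ℚ κ) in
        (κ +ℚ M -ℚ 1ℚ) *ℚ β +ℚ (κ *ℚ α +ℚ M *ℚ β -ℚ β) ≡ h *ℚ β
      eq = solve-∀ ℚ-ring

    -- With two rows solved exactly, the error of the remaining one is the characteristic cubic. At
    -- the approximations of the root it is nonnegative, which gives the row inequality, and null,
    -- which gives the eigenvalue.
    T-top : ∀ j → seq h j *ℚ seq α j ≡ T j top +ℚ f (root j)
    T-top j = eq κ M S (root j)
      where
      eq : ∀ κ M S h → let a = κ +ℚ κ +ℚ M +ℚ S -ℚ 1ℚ -ℚ 1ℚ
                           c = M +ℚ M +ℚ κ -ℚ 1ℚ -ℚ 1ℚ
                           α = (h -ℚ κ) *ℚ (h -ℚ c)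
                           β = κ *ℚ (h -ℚ κ)
                           γ = κ *ℚ (h -ℚ c) in
        h *ℚ α ≡ (κ +ℚ M +ℚ S -ℚ 1ℚ) *ℚ α +ℚ (κ *ℚ α +ℚ M *ℚ β +ℚ S *ℚ γ -ℚ α)
          +ℚ ((h -ℚ a) *ℚ (h -ℚ κ) *ℚ (h -ℚ c) -ℚ M *ℚ κ *ℚ (h -ℚ κ) -ℚ S *ℚ κ *ℚ (h -ℚ c))
      eq = solve-∀ ℚ-ring

    σ : ℚ
    σ = proj₁ root-separated

    0<σ : 0ℚ <ℚ σ
    0<σ = proj₁ (proj₂ root-separated)

    L+σ≤h : ∀ j → L +ℚ σ ≤ℚ root j
    L+σ≤h = proj₂ (proj₂ root-separated)

    L≤h : ∀ j → L ≤ℚ root j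
    L≤h j = ℚ.≤-trans (≤-add σ (ℚ.<⇒≤ 0<σ) refl) (L+σ≤h j)

    κ≤h-c : ∀ j → κ ≤ℚ root j -ℚ c
    κ≤h-c j = subst (_≤ℚ root j -ℚ c) (eq c κ) (ℚ.+-monoˡ-≤ (-ℚ c) (L≤h j))
      where
      eq : ∀ c κ → c +ℚ κ -ℚ c ≡ κ
      eq = solve-∀ ℚ-ring

    1≤h-κ : ∀ j → 1ℚ ≤ℚ root j -ℚ κ
    1≤h-κ j = ℚ.≤-trans 1≤κ (ℚ.≤-trans κ≤c
      (subst (_≤ℚ root j -ℚ κ) (eq c κ) (ℚ.+-monoˡ-≤ (-ℚ κ) (L≤h j))))
      where
      eq : ∀ c κ → c +ℚ κ -ℚ κ ≡ c
      eq = solve-∀ ℚ-ring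

    1≤γ : ∀ j → 1ℚ ≤ℚ seq γ j
    1≤γ j = 1≤* 1≤κ (ℚ.≤-trans 1≤κ (κ≤h-c j))

    1≤β-γ : ∀ j → 1ℚ ≤ℚ seq β j -ℚ seq γ j
    1≤β-γ j = subst (1ℚ ≤ℚ_) (eq κ M (root j))
      (1≤* 1≤κ (≤-add _ (0≤+ (0≤- 2≤M) (0≤- (two≤⇒1≤ 2≤M))) (eq′ M)))
      where
      eq : ∀ κ M h → κ *ℚ (M +ℚ M -ℚ 1ℚ -ℚ 1ℚ) ≡ κ *ℚ (h -ℚ κ) -ℚ κ *ℚ (h -ℚ (M +ℚ M +ℚ κ -ℚ 1ℚ -ℚ 1ℚ))
      eq = solve-∀ ℚ-ring
      eq′ : ∀ M → M +ℚ M -ℚ 1ℚ -ℚ 1ℚ ≡ 1ℚ +ℚ ((M -ℚ (1ℚ +ℚ 1ℚ)) +ℚ (M -ℚ 1ℚ))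
      eq′ = solve-∀ ℚ-ring

    -- The difference factors as `(h - κ)(h - L)`, so the distance of the root from `L` is what
    -- lifts the top weight above the mid weight.
    σ≤α-β : ∀ j → σ ≤ℚ seq α j -ℚ seq β j
    σ≤α-β j = subst₂ _≤ℚ_ (ℚ.*-identityˡ σ) (eq κ c (root j))
      (*-mono 0≤1 (ℚ.≤-trans (ℚ.<⇒≤ 0<σ) σ≤h-L) (1≤h-κ j) σ≤h-L)
      where
      eq : ∀ κ c h → (h -ℚ κ) *ℚ (h -ℚ (c +ℚ κ)) ≡ (h -ℚ κ) *ℚ (h -ℚ c) -ℚ κ *ℚ (h -ℚ κ)
      eq = solve-∀ ℚ-ring
      eq′ : ∀ L σ → L +ℚ σ -ℚ L ≡ σ
      eq′ = solve-∀ ℚ-ring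
      σ≤h-L : σ ≤ℚ root j -ℚ L
      σ≤h-L = subst (_≤ℚ root j -ℚ L) (eq′ L σ) (ℚ.+-monoˡ-≤ (-ℚ L) (L+σ≤h j))

    split : ∀ x y → y ≡ x +ℚ (y -ℚ x)
    split = solve-∀ ℚ-ring

    g : ℚ
    g = proj₁ (lower-bound 0<σ)

    stretch : Stretch k m s
    stretch = record
      { h = h ; α = α ; β = β ; γ = γ ; g = g ; extra = 0ℚ
      ; 0<g     = proj₁ (proj₂ (lower-bound 0<σ))
      ; 0≤extra = ℚ.≤-refl
      ; 0≤h     = λ j → ℚ.≤-trans (ℚ.<⇒≤ 0<L) (L≤h j)
      ; g≤γ     = λ j → ℚ.≤-trans g≤1 (1≤γ j)
      ; γ≤β     = λ j → ≤-add _ (ℚ.≤-trans 0≤1 (1≤β-γ j)) (split (seq γ j) (seq β j))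
      ; g≤β-γ   = λ _ j → ℚ.≤-trans g≤1 (1≤β-γ j)
      ; g≤α-β   = λ j → ℚ.≤-trans (proj₁ (proj₂ (proj₂ (lower-bound 0<σ)))) (σ≤α-β j)
      ; top-row = λ _ j → ≤-add (f (root j)) (0≤f-root j) (T-top j)
      ; mid-row = λ j → ℚ.≤-reflexive (T-mid j)
      ; low-row = λ j → ℚ.≤-reflexive (trans (ℚ.+-identityʳ (T j low)) (T-low j))
      }
      where
      g≤1 : g ≤ℚ 1ℚ
      g≤1 = proj₂ (proj₂ (proj₂ (lower-bound 0<σ)))

    eigen : ∀ c ε → 0ℚ <ℚ ε → ∃ λ N → ∀ j → N ≤ j →
      ∣ T j c -ℚ seq h j *ℚ weights (seq α j) (seq β j) (seq γ j) c ∣ ≤ℚ ε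
    eigen top ε 0<ε = proj₁ (f-root-null 0<ε) , λ j N≤j → subst (_≤ℚ ε)
      (sym (trans (cong (λ y → ∣ T j top -ℚ y ∣) (T-top j)) (trans (cong ∣_∣ (eq (T j top) (f (root j))))
        (trans (ℚ.∣-p∣≡∣p∣ (f (root j))) (ℚ.0≤p⇒∣p∣≡p (0≤f-root j))))))
      (proj₂ (f-root-null 0<ε) j N≤j)
      where
      eq : ∀ x y → x -ℚ (x +ℚ y) ≡ -ℚ y
      eq = solve-∀ ℚ-ring
    eigen mid ε 0<ε = 0 , λ j _ → subst (_≤ℚ ε)
      (sym (cong ∣_∣ (trans (cong (_-ℚ seq h j *ℚ seq β j) (T-mid j)) (ℚ.+-inverseʳ (seq h j *ℚ seq β j)))))
      (ℚ.<⇒≤ 0<ε)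
    eigen low ε 0<ε = 0 , λ j _ → subst (_≤ℚ ε)
      (sym (cong ∣_∣ (trans (cong (_-ℚ seq h j *ℚ seq γ j) (T-low j)) (ℚ.+-inverseʳ (seq h j *ℚ seq γ j)))))
      (ℚ.<⇒≤ 0<ε)

    low-vertex : ∃ λ v → (extremalClass k m s v == low) ≡ true
    low-vertex = count⇒∃ _ (subst (1 ≤_) (sym (Sizes.size-low (extremal-sizes k m s))) 1≤s)

  spectral-cubic : Spectral k m s
  spectral-cubic = record
    { P          = stretch
    ; eigenvalue = model-eigenvalue {G = Extremal k m s} (extremal-model k m s) (extremal-sizes k m s) h α β γ
        (λ v → eigen (extremalClass k m s v))
        (proj₁ low-vertex , ℚ.½ , ℚ.positive⁻¹ ℚ.½ , λ j →
          subst (λ c → ℚ.½ <ℚ weights (seq α j) (seq β j) (seq γ j) c) (sym (==⇒≡ (proj₂ low-vertex)))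
            (ℚ.<-≤-trans ½<1 (1≤γ j)))
    ; clique≤h   = L≤h
    ; positive   = inj₁ 1≤k
    }
    where
    ½<1 : ℚ.½ <ℚ 1ℚ
    ½<1 = ℚ.*<* (ℤ.+<+ (s≤s (s≤s z≤n)))

module _ (m s : ℕ) (2≤m : 2 ≤ m) where

  private
    M h₀ two three : ℚ
    M = ι m
    h₀ = M +ℚ M -ℚ 1ℚ -ℚ 1ℚ
    two = 1ℚ +ℚ 1ℚ
    three = two +ℚ 1ℚ

    ι0 : ι 0 ≡ 0ℚ
    ι0 = ι-/1 0

    2≤M : two ≤ℚ M
    2≤M = subst (_≤ℚ M) (trans (ι-+ 1 1) (cong₂ _+ℚ_ ι-1 ι-1)) (ι-mono 2≤m)

    0<h₀ : 0ℚ <ℚ h₀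
    0<h₀ = ℚ.<-≤-trans 0<1 (≤-add _ (0≤+ (0≤- 2≤M) (0≤- (two≤⇒1≤ 2≤M))) (eq M))
      where
      eq : ∀ M → M +ℚ M -ℚ 1ℚ -ℚ 1ℚ ≡ 1ℚ +ℚ ((M -ℚ (1ℚ +ℚ 1ℚ)) +ℚ (M -ℚ 1ℚ))
      eq = solve-∀ ℚ-ring

    -- For `k = 0` the classes are a clique and isolated vertices: the mid row is an equality for
    -- any mid weight, and the low row has left side zero, which leaves all of `h₀` as slack. So any
    -- increasing positive weights serve.
    stretch : Stretch 0 m s
    stretch = record
      { h = fromℚ h₀ ; α = fromℚ three ; β = fromℚ two ; γ = fromℚ 1ℚ ; g = 1ℚ ; extra = h₀
      ; 0<g     = 0<1
      ; 0≤extra = ℚ.<⇒≤ 0<h₀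
      ; 0≤h     = λ _ → ℚ.<⇒≤ 0<h₀
      ; g≤γ     = λ _ → ℚ.≤-refl {1ℚ}
      ; γ≤β     = λ _ → ≤-add {1ℚ} {two} 1ℚ 0≤1 refl
      ; g≤β-γ   = λ _ _ → ℚ.≤-refl
      ; g≤α-β   = λ _ → ℚ.≤-refl
      ; top-row = λ ()
      ; mid-row = λ _ → ℚ.≤-reflexive (trans
          (cong (λ z → (z +ℚ M -ℚ 1ℚ) *ℚ two +ℚ (z *ℚ three +ℚ M *ℚ two -ℚ two)) ι0) (mid-eq M))
      ; low-row = λ _ → ℚ.≤-reflexive (trans (cong (λ z → z *ℚ 1ℚ +ℚ z *ℚ three +ℚ h₀) ι0) (low-eq h₀))
      }
      where
      mid-eq : ∀ M → (0ℚ +ℚ M -ℚ 1ℚ) *ℚ (1ℚ +ℚ 1ℚ) +ℚ (0ℚ *ℚ (1ℚ +ℚ 1ℚ +ℚ 1ℚ) +ℚ M *ℚ (1ℚ +ℚ 1ℚ) -ℚ (1ℚ +ℚ 1ℚ))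
        ≡ (M +ℚ M -ℚ 1ℚ -ℚ 1ℚ) *ℚ (1ℚ +ℚ 1ℚ)
      mid-eq = solve-∀ ℚ-ring
      low-eq : ∀ h → 0ℚ *ℚ 1ℚ +ℚ 0ℚ *ℚ (1ℚ +ℚ 1ℚ +ℚ 1ℚ) +ℚ h ≡ h *ℚ 1ℚ
      low-eq = solve-∀ ℚ-ring

    eigen : ∀ c → (c ≡ top → ⊥) → target 0 m s 0ℚ 1ℚ 0ℚ c -ℚ h₀ *ℚ weights 0ℚ 1ℚ 0ℚ c ≡ 0ℚ
    eigen top c≢top = ⊥-elim (c≢top refl)
    eigen mid _ = trans (cong (λ z → (z +ℚ M -ℚ 1ℚ) *ℚ 1ℚ +ℚ (z *ℚ 0ℚ +ℚ M *ℚ 1ℚ -ℚ 1ℚ) -ℚ h₀ *ℚ 1ℚ) ι0) (eq M)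
      where
      eq : ∀ M → (0ℚ +ℚ M -ℚ 1ℚ) *ℚ 1ℚ +ℚ (0ℚ *ℚ 0ℚ +ℚ M *ℚ 1ℚ -ℚ 1ℚ) -ℚ (M +ℚ M -ℚ 1ℚ -ℚ 1ℚ) *ℚ 1ℚ ≡ 0ℚ
      eq = solve-∀ ℚ-ring
    eigen low _ = eq (ι 0) h₀
      where
      eq : ∀ z h → z *ℚ 0ℚ +ℚ z *ℚ 0ℚ -ℚ h *ℚ 0ℚ ≡ 0ℚ
      eq = solve-∀ ℚ-ring

    not-top : ∀ v → extremalClass 0 m s v ≡ top → ⊥
    not-top v v∈top = case subst (1 ≤_) (Sizes.size-top (extremal-sizes 0 m s))
      (∃⇒count (λ v → extremalClass 0 m s v == top) v (cong (_== top) v∈top)) of λ ()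

    mid-vertex : ∃ λ v → (extremalClass 0 m s v == mid) ≡ true
    mid-vertex = count⇒∃ _ (subst (1 ≤_) (sym (Sizes.size-mid (extremal-sizes 0 m s))) (ℕ.≤-trans (s≤s z≤n) 2≤m))

  spectral-clique : Spectral 0 m s
  spectral-clique = record
    { P          = stretch
    ; eigenvalue = model-eigenvalue {G = Extremal 0 m s} (extremal-model 0 m s) (extremal-sizes 0 m s)
        (fromℚ h₀) (fromℚ 0ℚ) (fromℚ 1ℚ) (fromℚ 0ℚ)
        (λ v ε 0<ε → 0 , λ _ _ → subst (_≤ℚ ε)
          (sym (cong ∣_∣ (eigen (extremalClass 0 m s v) (not-top v)))) (ℚ.<⇒≤ 0<ε))
        (proj₁ mid-vertex , ℚ.½ , ℚ.positive⁻¹ ℚ.½ , λ _ →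
          subst (λ c → ℚ.½ <ℚ weights 0ℚ 1ℚ 0ℚ c) (sym (==⇒≡ (proj₂ mid-vertex))) (ℚ.*<* (ℤ.+<+ (s≤s (s≤s z≤n)))))
    ; clique≤h   = λ _ → ℚ.≤-reflexive (trans (cong (λ z → M +ℚ M +ℚ z -ℚ 1ℚ -ℚ 1ℚ +ℚ z) ι0) (eq M))
    ; positive   = inj₂ 0<h₀
    }
    where
    eq : ∀ M → M +ℚ M +ℚ 0ℚ -ℚ 1ℚ -ℚ 1ℚ +ℚ 0ℚ ≡ M +ℚ M -ℚ 1ℚ -ℚ 1ℚ
    eq = solve-∀ ℚ-ring

spectral : ∀ k m s → 2 ≤ m → 1 ≤ s → Spectral k m s
spectral zero    m s 2≤m 1≤s = spectral-clique m s 2≤m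
spectral (suc k) m s 2≤m 1≤s = spectral-cubic (suc k) m s (s≤s z≤n) 2≤m 1≤s

-- Integer weights

module _ (k μ s : ℕ) {a b c L : ℕ}
  (top-row : (k + μ + s) * a + (k * a + suc μ * b + s * c) ≤ L * a + a)
  (mid-row : (k + μ) * b + (k * a + μ * b) ≤ L * b)
  (low-row : k * c + k * a + 1 ≤ L * c)
  (1≤c : 1 ≤ c) (c+μ≤b : c + μ ≤ b) (b<a : b < a)
  where

  private
    infixl 6 _⟨+⟩_
    _⟨+⟩_ : ∀ {x y p q} → ι x ≡ p → ι y ≡ q → ι (x + y) ≡ p +ℚ q
    _⟨+⟩_ {x} {y} e f = trans (ι-+ x y) (cong₂ _+ℚ_ e f)

    _⟨*⟩_ : ∀ {x y p q} → ι x ≡ p → ι y ≡ q → ι (x * y) ≡ p *ℚ q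
    _⟨*⟩_ {x} {y} e f = trans (ι-* x y) (cong₂ _*ℚ_ e f)

    1≤ι : ∀ {x} → 1 ≤ x → 1ℚ ≤ℚ ι x
    1≤ι {x} 1≤x = subst (_≤ℚ ι x) ι-1 (ι-mono 1≤x)

    gap : ∀ {x y} → suc x ≤ y → 1ℚ ≤ℚ ι y -ℚ ι x
    gap {x} {y} x<y = subst (_≤ℚ ι y -ℚ ι x) (trans (cong (_-ℚ ι x) (ι-+ 1 x)) (trans (eq (ι 1) (ι x)) ι-1))
      (ℚ.+-monoˡ-≤ (-ℚ ι x) (ι-mono x<y))
      where
      eq : ∀ a b → a +ℚ b -ℚ b ≡ a
      eq = solve-∀ ℚ-ring

    ι-suc : ι (suc μ) ≡ 1ℚ +ℚ ι μ
    ι-suc = ι-1 ⟨+⟩ refl {x = ι μ}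

  -- The hypotheses are the rows over the naturals, with `m = suc μ` and the subtracted `α` of the
  -- top row moved to the right, so that no truncated subtraction occurs. The `+ 1` of the low row
  -- becomes `extra`.
  integer-stretch : Stretch k (suc μ) s
  integer-stretch = record
    { h = fromℚ (ι L) ; α = fromℚ (ι a) ; β = fromℚ (ι b) ; γ = fromℚ (ι c) ; g = 1ℚ ; extra = 1ℚ
    ; 0<g     = 0<1
    ; 0≤extra = 0≤1
    ; 0≤h     = λ _ → 0≤ι L
    ; g≤γ     = λ _ → 1≤ι 1≤c
    ; γ≤β     = λ _ → ι-mono (ℕ.≤-trans (ℕ.m≤m+n c μ) c+μ≤b)
    ; g≤β-γ   = λ { (s≤s 1≤μ) _ → gap (ℕ.≤-trans (ℕ.≤-trans (ℕ.≤-reflexive (ℕ.+-comm 1 c)) (ℕ.+-monoʳ-≤ c 1≤μ)) c+μ≤b) }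
    ; g≤α-β   = λ _ → gap b<a
    ; top-row = λ _ _ → subst₂ _≤ℚ_
        (trans (cong (_-ℚ A) (((refl ⟨+⟩ refl ⟨+⟩ refl) ⟨*⟩ refl) ⟨+⟩
            ((refl ⟨*⟩ refl) ⟨+⟩ (ι-suc ⟨*⟩ refl) ⟨+⟩ (refl ⟨*⟩ refl))))
          (trans (top-eq κ (ι μ) S A B C)
            (cong (λ m → (κ +ℚ m +ℚ S -ℚ 1ℚ) *ℚ A +ℚ (κ *ℚ A +ℚ m *ℚ B +ℚ S *ℚ C -ℚ A)) (sym ι-suc))))
        (trans (cong (_-ℚ A) ((refl ⟨*⟩ refl) ⟨+⟩ refl)) (cancel (ι L *ℚ A) A))
        (ℚ.+-monoˡ-≤ (-ℚ A) (ι-mono top-row))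
    ; mid-row = λ _ → subst₂ _≤ℚ_
        (trans (((refl ⟨+⟩ refl) ⟨*⟩ refl) ⟨+⟩ ((refl ⟨*⟩ refl) ⟨+⟩ (refl ⟨*⟩ refl)))
          (trans (mid-eq κ (ι μ) A B) (cong (λ m → (κ +ℚ m -ℚ 1ℚ) *ℚ B +ℚ (κ *ℚ A +ℚ m *ℚ B -ℚ B)) (sym ι-suc))))
        (ι-* L b) (ι-mono mid-row)
    ; low-row = λ _ → subst₂ _≤ℚ_ ((refl ⟨*⟩ refl) ⟨+⟩ (refl ⟨*⟩ refl) ⟨+⟩ ι-1) (ι-* L c) (ι-mono low-row)
    }
    where
    κ S A B C : ℚ
    κ = ι k
    S = ι s
    A = ι a
    B = ι b
    C = ι c
    cancel : ∀ x y → x +ℚ y -ℚ y ≡ x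
    cancel = solve-∀ ℚ-ring
    top-eq : ∀ k μ s a b c → (k +ℚ μ +ℚ s) *ℚ a +ℚ (k *ℚ a +ℚ (1ℚ +ℚ μ) *ℚ b +ℚ s *ℚ c) -ℚ a ≡
      (k +ℚ (1ℚ +ℚ μ) +ℚ s -ℚ 1ℚ) *ℚ a +ℚ (k *ℚ a +ℚ (1ℚ +ℚ μ) *ℚ b +ℚ s *ℚ c -ℚ a)
    top-eq = solve-∀ ℚ-ring
    mid-eq : ∀ k μ a b → (k +ℚ μ) *ℚ b +ℚ (k *ℚ a +ℚ μ *ℚ b) ≡
      (k +ℚ (1ℚ +ℚ μ) -ℚ 1ℚ) *ℚ b +ℚ (k *ℚ a +ℚ (1ℚ +ℚ μ) *ℚ b -ℚ b)
    mid-eq = solve-∀ ℚ-ring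

-- Walks, Hamiltonian cycles and Hamiltonian paths

data Walk {A : Set} (R : A → A → Set) : A → A → List A → Set where
  stop : ∀ {a} → Walk R a a (a ∷ [])
  step : ∀ {a b c xs} → R a b → Walk R b c xs → Walk R a c (a ∷ xs)

module _ {A : Set} {R : A → A → Set} where

  append : ∀ {a b c d xs ys} → Walk R a b xs → R b c → Walk R c d ys → Walk R a d (xs ++ ys)
  append stop       r w = step r w
  append (step s v) r w = step s (append v r w)

  walk-reverse : (∀ {a b} → R a b → R b a) → ∀ {a b xs} → Walk R a b xs → Walk R b a (reverse xs)
  walk-reverse sym-R stop = stop
  walk-reverse sym-R (step {a} {xs = xs} r w) = subst (Walk R _ a) (sym (List.unfold-reverse a xs))
    (append (walk-reverse sym-R w) (sym-R r) stop)

  start∈ : ∀ {a b xs} → Walk R a b xs → a ∈ xs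
  start∈ stop       = here refl
  start∈ (step _ _) = here refl

  end∈ : ∀ {a b xs} → Walk R a b xs → b ∈ xs
  end∈ stop       = here refl
  end∈ (step _ w) = there (end∈ w)

  split-at : ∀ {a b x xs} → Walk R a b xs → x ∈ xs →
    a ≡ x ⊎ ∃₂ λ ys zs → ∃ λ c → Walk R a c ys × R c x × Walk R x b zs × xs ≡ ys ++ zs
  split-at stop       (here refl) = inj₁ refl
  split-at (step r w) (here refl) = inj₁ refl
  split-at (step {a} {xs = xs} r w) (there x∈xs) with split-at w x∈xs
  ... | inj₁ refl = inj₂ (a ∷ [] , xs , a , stop , r , w , refl)
  ... | inj₂ (ys , zs , c , w₁ , s , w₂ , refl) = inj₂ (a ∷ ys , zs , c , step r w₁ , s , w₂ , refl)

  loop-trivial : ∀ {a xs} → Walk R a a xs → Unique xs → length xs ≡ 1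
  loop-trivial stop       _       = refl
  loop-trivial (step _ w) (a∉ ∷ _) = contradiction refl (All.lookup a∉ (end∈ w))

walk-map : ∀ {A : Set} {R S : A → A → Set} {P : A → Set} → (∀ {a b} → P a → P b → R a b → S a b) →
           ∀ {a b xs} → All P xs → Walk R a b xs → Walk S a b xs
walk-map f ps       stop       = stop
walk-map f (p ∷ ps) (step r w) = step (f p (All.lookup ps (start∈ w)) r) (walk-map f ps w)

-- Spanning lists and counting along them

countᴸ : ∀ {A : Set} → (A → Bool) → List A → ℕ
countᴸ p []       = 0
countᴸ p (x ∷ xs) = (if p x then 1 else 0) + countᴸ p xs

countᴸ-↭ : ∀ {A : Set} (p : A → Bool) {xs ys} → xs ↭ ys → countᴸ p xs ≡ countᴸ p ys
countᴸ-↭ p Perm.refl         = refl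
countᴸ-↭ p (Perm.prep x σ)   = cong ((if p x then 1 else 0) +_) (countᴸ-↭ p σ)
countᴸ-↭ p (Perm.swap x y σ) = trans
  (cong (λ c → (if p x then 1 else 0) + ((if p y then 1 else 0) + c)) (countᴸ-↭ p σ))
  (exchange (if p x then 1 else 0) (if p y then 1 else 0) _)
  where
  exchange : ∀ a b c → a + (b + c) ≡ b + (a + c)
  exchange = solve-ℕ
countᴸ-↭ p (Perm.trans σ τ)  = trans (countᴸ-↭ p σ) (countᴸ-↭ p τ)

unique-↭ : ∀ {A : Set} {xs ys : List A} → xs ↭ ys → Unique xs → Unique ys
unique-↭ σ = ↭ₛ.Unique-resp-↭ (Perm.↭⇒↭ₛ σ)
  where
  module ↭ₛ = Permutationₛ (setoid _)

countᴸ-tabulate : ∀ {A : Set} {n} (p : A → Bool) (f : Fin n → A) → countᴸ p (tabulate f) ≡ count (p ∘ f)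
countᴸ-tabulate {n = zero}  p f = refl
countᴸ-tabulate {n = suc n} p f = trans
  (cong ((if p (f zero) then 1 else 0) +_) (countᴸ-tabulate p (f ∘ suc))) (sym (count-suc (p ∘ f)))

Spanning : ∀ {n} → List (Fin n) → Set
Spanning {n} xs = xs ↭ allFin n

spanning-count : ∀ {n} (p : Fin n → Bool) {xs} → Spanning xs → countᴸ p xs ≡ count p
spanning-count p σ = trans (countᴸ-↭ p σ) (countᴸ-tabulate p id)

spanning-unique : ∀ {n} {xs : List (Fin n)} → Spanning xs → Unique xs
spanning-unique {n} σ = unique-↭ (↭-sym σ) (allFin⁺ n)

spanning-length : ∀ {n} {xs : List (Fin n)} → Spanning xs → length xs ≡ n
spanning-length {n} σ = trans (↭.↭-length σ) (List.length-tabulate id)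

spanning-∈ : ∀ {n} {xs : List (Fin n)} → Spanning xs → ∀ v → v ∈ xs
spanning-∈ σ v = ↭.∈-resp-↭ (↭-sym σ) (∈-allFin v)

count-mono : ∀ {n} {p q : Fin n → Bool} → (∀ i → p i ≡ true → q i ≡ true) → count p ≤ count q
count-mono {zero}  p⇒q = z≤n
count-mono {suc n} {p} {q} p⇒q = subst₂ _≤_ (sym (count-suc p)) (sym (count-suc q))
  (ℕ.+-mono-≤ (bit (p zero) (q zero) (p⇒q zero)) (count-mono (p⇒q ∘ suc)))
  where
  bit : ∀ a b → (a ≡ true → b ≡ true) → (if a then 1 else 0) ≤ (if b then 1 else 0)
  bit true  b a⇒b rewrite a⇒b refl = ℕ.≤-refl
  bit false b a⇒b = z≤n

count-mono-< : ∀ {n} {p q : Fin n → Bool} i → (∀ i → p i ≡ true → q i ≡ true) →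
               p i ≡ false → q i ≡ true → count p < count q
count-mono-< {suc n} {p} {q} i p⇒q pi qi = subst₂ _<_ (sym (count-remove p i)) (sym (count-remove q i))
  (subst₂ (λ a b → (if a then 1 else 0) + count (p ∘ punchIn i) < (if b then 1 else 0) + count (q ∘ punchIn i))
    (sym pi) (sym qi) (s≤s (count-mono (p⇒q ∘ punchIn i))))

count-not : ∀ {n} (p : Fin n → Bool) → count p + count (not ∘ p) ≡ n
count-not {zero}  p = refl
count-not {suc n} p = trans (cong₂ _+_ (count-suc p) (count-suc (not ∘ p)))
  (trans (swap (if p zero then 1 else 0) _ (if not (p zero) then 1 else 0) _)
    (cong₂ _+_ (bits (p zero)) (count-not (p ∘ suc))))
  where
  swap : ∀ a b c d → a + b + (c + d) ≡ (a + c) + (b + d)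
  swap = solve-ℕ
  bits : ∀ b → (if b then 1 else 0) + (if not b then 1 else 0) ≡ 1
  bits true  = refl
  bits false = refl

HamCycle : ∀ {n} → Graph n → Set
HamCycle G = ∃₂ λ a b → ∃ λ xs → Walk (Adj G) a b xs × Adj G b a × Spanning xs

HamPath : ∀ {n} → Graph n → Fin n → Fin n → Set
HamPath G a b = ∃ λ xs → Walk (Adj G) a b xs × Spanning xs

adj-sym : ∀ {n} (G : Graph n) {u v} → Adj G u v → Adj G v u
adj-sym G {u} {v} u~v = trans (symm G v u) u~v

rotate : ∀ {n} {R : Fin n → Fin n → Set} {a b xs} → Walk R a b xs → R b a → Spanning xs → ∀ u →
         ∃₂ λ e ws → Walk R u e ws × R e u × Spanning ws
rotate {R = R} {b = b} {xs} w r σ u with split-at w (spanning-∈ σ u)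
... | inj₁ refl = b , xs , w , r , σ
... | inj₂ (ys , zs , c , w₁ , s , w₂ , refl) = c , zs ++ ys , append w₂ r w₁ , s , ↭-trans (↭.++-comm zs ys) σ

module _ {n} (G : Graph n) (u v : Fin n) (u≢v : u ≢ v) where

  private
    new : Fin n → Fin n → Bool
    new x y = (does (x Fin.≟ u) 𝔹.∧ does (y Fin.≟ v)) 𝔹.∨ (does (x Fin.≟ v) 𝔹.∧ does (y Fin.≟ u))

  addEdge : Graph n
  adj    addEdge x y = adj G x y 𝔹.∨ new x y
  irrefl addEdge x = trans (cong (𝔹._∨ new x x) (irrefl G x)) (new-irrefl (x Fin.≟ u) (x Fin.≟ v))
    where
    new-irrefl : (d : Dec (x ≡ u)) (e : Dec (x ≡ v)) → (does d 𝔹.∧ does e) 𝔹.∨ (does e 𝔹.∧ does d) ≡ false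
    new-irrefl (yes refl) (yes u≡v) = contradiction u≡v u≢v
    new-irrefl (yes _) (no _)  = refl
    new-irrefl (no _)  (yes _) = refl
    new-irrefl (no _)  (no _)  = refl
  symm   addEdge x y = cong₂ 𝔹._∨_ (symm G x y) (trans
    (cong₂ 𝔹._∨_ (Bool.∧-comm (does (x Fin.≟ u)) _) (Bool.∧-comm (does (x Fin.≟ v)) _))
    (Bool.∨-comm (does (y Fin.≟ v) 𝔹.∧ does (x Fin.≟ u)) _))

  adj⇒addEdge : ∀ {x y} → Adj G x y → Adj addEdge x y
  adj⇒addEdge {x} {y} x~y = cong (𝔹._∨ new x y) x~y

  addEdge-new : Adj addEdge u v
  addEdge-new with u Fin.≟ u | v Fin.≟ v
  ... | yes _  | yes _  = Bool.∨-zeroʳ (adj G u v)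
  ... | no u≢u | _      = contradiction refl u≢u
  ... | yes _  | no v≢v = contradiction refl v≢v

  addEdge⇒ : ∀ x y → Adj addEdge x y → Adj G x y ⊎ (x ≡ u × y ≡ v) ⊎ (x ≡ v × y ≡ u)
  addEdge⇒ x y x~y with adj G x y | x Fin.≟ u | y Fin.≟ v | x Fin.≟ v | y Fin.≟ u
  ... | true  | _     | _     | _     | _     = inj₁ refl
  ... | false | yes p | yes q | _     | _     = inj₂ (inj₁ (p , q))
  ... | false | _     | _     | yes p | yes q = inj₂ (inj₂ (p , q))
  ... | false | yes _ | no _  | yes _ | no _  = contradiction x~y λ ()
  ... | false | yes _ | no _  | no _  | _     = contradiction x~y λ ()
  ... | false | no _  | _     | yes _ | no _  = contradiction x~y λ ()
  ... | false | no _  | _     | no _  | _     = contradiction x~y λ ()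

  -- Once the cycle is rotated to start at `u`, the edge `u v` can occur only as its first or its
  -- closing edge, and all other edges avoid `u` and so lie in `G`. If `u v` is the first edge,
  -- reversing the rest of the cycle gives the path.
  remove-edge : 3 ≤ n → HamCycle addEdge → HamCycle G ⊎ HamPath G u v
  remove-edge 3≤n (a , b , xs , w , r , σ) = from-u (rotate w r σ u)
    where
    other : ∀ {x y} → x ≢ u → y ≢ u → Adj addEdge x y → Adj G x y
    other {x} {y} x≢u y≢u x~y = [ id
      , [ (λ (x≡u , _) → contradiction x≡u x≢u) , (λ (_ , y≡u) → contradiction y≡u y≢u) ]′ ]′
      (addEdge⇒ x y x~y)
    at-u : ∀ {y} → Adj addEdge u y → Adj G u y ⊎ y ≡ v
    at-u {y} u~y = [ inj₁ , [ (λ (_ , y≡v) → inj₂ y≡v) , (λ (u≡v , _) → contradiction u≡v u≢v) ]′ ]′ (addEdge⇒ u y u~y)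
    from-u : (∃₂ λ e ws → Walk (Adj addEdge) u e ws × Adj addEdge e u × Spanning ws) → HamCycle G ⊎ HamPath G u v
    from-u (e , ws , stop , _ , τ) = contradiction (subst (3 ≤_) (sym (spanning-length τ)) 3≤n) λ { (s≤s ()) }
    from-u (e , .(u ∷ ws) , step {b = f} {xs = ws} u~f walk , e~u , τ) = cases (spanning-unique τ)
      where
      cases : Unique (u ∷ ws) → HamCycle G ⊎ HamPath G u v
      cases (u∉ws ∷ ws-unique) = ends (at-u u~f) (at-u (adj-sym addEdge e~u))
        where
        walkᴳ : Walk (Adj G) f e ws
        walkᴳ = walk-map (λ u≢x u≢y → other (u≢x ∘ sym) (u≢y ∘ sym)) u∉ws walk
        ends : Adj G u f ⊎ f ≡ v → Adj G u e ⊎ e ≡ v → HamCycle G ⊎ HamPath G u v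
        ends (inj₁ u~f) (inj₁ u~e)  = inj₁ (u , e , u ∷ ws , step u~f walkᴳ , adj-sym G u~e , τ)
        ends (inj₁ u~f) (inj₂ refl) = inj₂ (u ∷ ws , step u~f walkᴳ , τ)
        ends (inj₂ refl) (inj₁ u~e) = inj₂ (u ∷ reverse ws , step u~e (walk-reverse (adj-sym G) walkᴳ) ,
          ↭-trans (↭-prep u (↭.↭-reverse ws)) τ)
        -- Both edges at `u` lead to `v`, so the rest of the cycle is the single vertex `v` and
        -- there are only two vertices.
        ends (inj₂ refl) (inj₂ refl) = contradiction
          (subst (3 ≤_) (trans (sym (spanning-length τ)) (cong suc (loop-trivial walkᴳ ws-unique))) 3≤n)
          λ { (s≤s (s≤s ())) }

-- Chvátal's condition

≤ᵇ-intro : ∀ {a b} → a ≤ b → (a ≤ᵇ b) ≡ true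
≤ᵇ-intro a≤b = Equivalence.to Bool.T-≡ (ℕ.≤⇒≤ᵇ a≤b)

≤ᵇ-elim : ∀ {a b} → (a ≤ᵇ b) ≡ true → a ≤ b
≤ᵇ-elim {a} eq = ℕ.≤ᵇ⇒≤ a _ (Equivalence.from Bool.T-≡ eq)

-- The failure of Chvátal's condition at i (t = 0), or of its analogue for paths
-- (t = 1). By large, at most i vertices have degree n - i - t or more.
record Bad {n} (G : Graph n) (t i : ℕ) : Set where
  field
    small   : t + i ≤ count (λ v → degree G v ≤ᵇ i)
    large   : n ≤ i + count (λ v → suc (degree G v + (t + i)) ≤ᵇ n)
    bound   : t + i + i < n
    witness : ∃ λ u → degree G u ≤ i

-- Adding edges only raises degrees, so a failure found after adding edges was already present
-- before.
bad-antitone : ∀ {n} {G H : Graph n} {t i} → (∀ v → degree G v ≤ degree H v) → Bad H t i → Bad G t i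
bad-antitone {n} {H = H} {t} {i} G≤H bad = record
  { small   = ℕ.≤-trans small (count-mono λ v e → ≤ᵇ-intro (ℕ.≤-trans (G≤H v) (≤ᵇ-elim e)))
  ; large   = ℕ.≤-trans large (ℕ.+-monoʳ-≤ i (count-mono λ v e →
      ≤ᵇ-intro (ℕ.≤-trans (s≤s (ℕ.+-monoˡ-≤ (t + i) (G≤H v))) (≤ᵇ-elim {suc (degree H v + (t + i))} {n} e))))
  ; bound   = bound
  ; witness = proj₁ witness , ℕ.≤-trans (G≤H (proj₁ witness)) (proj₂ witness)
  }
  where open Bad bad

module _ {n} (G : Graph n) (u v : Fin n) where

  -- A crossing turns the path u … a b … v into the cycle u … a v … b u.
  Crossing : Set
  Crossing = ∃₂ λ xs ys → ∃₂ λ a b →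
    Walk (Adj G) u a xs × Walk (Adj G) b v ys × Adj G u b × Adj G a v × Spanning (xs ++ ys)

  crossing⇒cycle : Crossing → HamCycle G
  crossing⇒cycle (xs , ys , a , b , w₁ , w₂ , u~b , a~v , σ) =
    u , b , xs ++ reverse ys , append w₁ a~v (walk-reverse (adj-sym G) w₂) , adj-sym G u~b ,
    ↭-trans (↭.++⁺ˡ xs (↭.↭-reverse ys)) σ

  data NoCrossing : ∀ {a xs} → Walk (Adj G) a v xs → Set where
    stop : NoCrossing stop
    step : ∀ {a b xs} {a~b : Adj G a b} {w : Walk (Adj G) b v xs} →
           (Adj G u b → Adj G a v → ⊥) → NoCrossing w → NoCrossing (step a~b w)

  -- The last argument holds the part of the path already passed, so that a crossing found further
  -- on can be returned as two complete walks; nothing has been passed when the walk still starts at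
  -- `u`.
  crossing? : ∀ {a ys} (w : Walk (Adj G) a v ys) →
    (∃ λ xs → (∃ λ c → Walk (Adj G) u c xs × Adj G c a) × Spanning (xs ++ ys)) ⊎ (a ≡ u × Spanning ys) →
    Crossing ⊎ NoCrossing w
  crossing? stop _ = inj₂ stop
  crossing? (step {a} {b} {xs = ys} a~b w) before = by-adjacency (adj G u b Bool.≟ true) (adj G a v Bool.≟ true)
    where
    extended : ∃ λ xs → Walk (Adj G) u a xs × Spanning (xs ++ ys)
    extended = extend before
      where
      extend : (∃ λ xs → (∃ λ c → Walk (Adj G) u c xs × Adj G c a) × Spanning (xs ++ a ∷ ys))
        ⊎ (a ≡ u × Spanning (a ∷ ys)) → ∃ λ xs → Walk (Adj G) u a xs × Spanning (xs ++ ys)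
      extend (inj₁ (xs , (c , w₀ , c~a) , σ)) = xs ++ a ∷ [] , append w₀ c~a stop ,
        subst Spanning (sym (List.++-assoc xs (a ∷ []) ys)) σ
      extend (inj₂ (refl , σ)) = a ∷ [] , stop , σ
    continue : (Adj G u b → Adj G a v → ⊥) → Crossing ⊎ NoCrossing (step a~b w)
    continue no-cross = let xs , w₀ , σ = extended in
      [ inj₁ , (λ nc → inj₂ (step no-cross nc)) ]′ (crossing? w (inj₁ (xs , (a , w₀ , a~b) , σ)))
    by-adjacency : Dec (Adj G u b) → Dec (Adj G a v) → Crossing ⊎ NoCrossing (step a~b w)
    by-adjacency (yes u~b) (yes a~v) = let xs , w₀ , σ = extended in inj₁ (xs , ys , a , b , w₀ , w , u~b , a~v , σ)
    by-adjacency (no u≁b)  _         = continue λ u~b _ → u≁b u~b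
    by-adjacency (yes _)   (no a≁v)  = continue λ _ a~v → a≁v a~v

  -- On each step from `a` to `b` at most one of `u ~ b` and `a ~ v` holds, so shifting the
  -- neighbours of `u` back by one place makes them disjoint from those of `v`. The first vertex has
  -- no predecessor and gets the separate term; strictness comes from the end `v`, which is not its
  -- own neighbour.
  degree-sum : ∀ {a xs} {w : Walk (Adj G) a v xs} → NoCrossing w →
    countᴸ (adj G u) xs + countᴸ (adj G v) xs < (if adj G u a then 1 else 0) + length xs
  degree-sum stop rewrite irrefl G v = ℕ.≤-reflexive (eq (if adj G u v then 1 else 0))
    where
    eq : ∀ x → suc (x + 0 + 0) ≡ x + 1
    eq = solve-ℕ
  degree-sum (step {a} {b} {xs} no-cross nc) = begin-strict
    A + countᴸ (adj G u) xs + (V + countᴸ (adj G v) xs)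
      ≡⟨ swap A (countᴸ (adj G u) xs) V (countᴸ (adj G v) xs) ⟩
    A + (V + (countᴸ (adj G u) xs + countᴸ (adj G v) xs))
      <⟨ ℕ.+-monoʳ-< A (ℕ.+-monoʳ-< V (degree-sum nc)) ⟩
    A + (V + (B + length xs))
      ≡⟨ cong (A +_) (sym (ℕ.+-assoc V B _)) ⟩
    A + (V + B + length xs)
      ≤⟨ ℕ.+-monoʳ-≤ A (ℕ.+-monoˡ-≤ _ V+B≤1) ⟩
    A + suc (length xs) ∎
    where
    open ℕ.≤-Reasoning
    A B V : ℕ
    A = if adj G u a then 1 else 0
    B = if adj G u b then 1 else 0
    V = if adj G v a then 1 else 0
    swap : ∀ a b c d → a + b + (c + d) ≡ a + (c + (b + d))
    swap = solve-ℕ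
    V+B≤1 : V + B ≤ 1
    V+B≤1 = bits (adj G v a) (adj G u b) (λ v~a u~b → no-cross u~b (adj-sym G v~a))
      where
      bits : ∀ x y → (x ≡ true → y ≡ true → ⊥) → (if x then 1 else 0) + (if y then 1 else 0) ≤ 1
      bits true  true  h = ⊥-elim (h refl refl)
      bits true  false _ = ℕ.≤-refl
      bits false true  _ = ℕ.≤-refl
      bits false false _ = z≤n

  -- The predecessor on the path of a neighbour of `u` is not adjacent to `v`, as there is no
  -- crossing, and therefore satisfies `r`.
  predecessors : ∀ (r : Fin n → Bool) {a xs} {w : Walk (Adj G) a v xs} → NoCrossing w → Unique xs →
    (∀ x → x ≢ v → adj G x v ≡ false → r x ≡ true) →
    countᴸ (adj G u) xs ≤ (if adj G u a then 1 else 0) + countᴸ r xs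
  predecessors r {a} stop _ _ = ℕ.+-monoʳ-≤ (if adj G u a then 1 else 0) z≤n
  predecessors r (step {a} {b} {xs} {w = w} no-cross nc) (a∉ ∷ unique) far =
    ℕ.+-monoʳ-≤ (if adj G u a then 1 else 0) (begin
    countᴸ (adj G u) xs                              ≤⟨ predecessors r nc unique far ⟩
    (if adj G u b then 1 else 0) + countᴸ r xs       ≤⟨ ℕ.+-monoˡ-≤ (countᴸ r xs) (bit (adj G u b) (r a) good) ⟩
    (if r a then 1 else 0) + countᴸ r xs             ∎)
    where
    open ℕ.≤-Reasoning
    good : adj G u b ≡ true → r a ≡ true
    good u~b = far a (All.lookup a∉ (end∈ w)) (Bool.¬-not (λ a~v → no-cross u~b a~v))
    bit : ∀ x y → (x ≡ true → y ≡ true) → (if x then 1 else 0) ≤ (if y then 1 else 0)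
    bit true  y x⇒y rewrite x⇒y refl = ℕ.≤-refl
    bit false y _   = z≤n

  -- Maximality of the degree sum, compared with non-edges `x v`, gives every predecessor of a
  -- neighbour of `u` degree at most that of `u`; compared with non-edges `u x`, it gives `x` degree
  -- at most that of `v`. So Chvátal's condition fails at the degree of `u`.
  cycle-or-bad : adj G u v ≡ false → degree G u ≤ degree G v →
    (∀ x y → x ≢ y → adj G x y ≡ false → degree G x + degree G y ≤ degree G u + degree G v) →
    HamPath G u v → HamCycle G ⊎ Bad G 0 (degree G u)
  cycle-or-bad u≁v du≤dv maximal (xs , w , σ) =
    [ (λ c → inj₁ (crossing⇒cycle c)) , (λ nc → inj₂ (bad nc)) ]′ (crossing? w (inj₂ (refl , σ)))
    where
    bad : NoCrossing w → Bad G 0 (degree G u)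
    bad nc = record
      { small   = subst₂ _≤_ (spanning-count (adj G u) σ)
          (cong₂ _+_ (cong (if_then 1 else 0) (irrefl G u)) (spanning-count (λ x → degree G x ≤ᵇ degree G u) σ))
          (predecessors (λ x → degree G x ≤ᵇ degree G u) nc (spanning-unique σ) far)
      -- The vertices not adjacent to `u`, among them `u` itself, number `n` minus the degree of
      -- `u`, and each of them has the required small degree.
      ; large   = ℕ.≤-trans (ℕ.≤-reflexive (sym (count-not (adj G u))))
          (ℕ.+-monoʳ-≤ (degree G u) (count-mono λ x u≁x →
            ≤ᵇ-intro (nonadjacent x (x Fin.≟ u) (Bool.not-injective u≁x))))
      ; bound   = ℕ.≤-<-trans (ℕ.+-monoʳ-≤ (degree G u) du≤dv) du+dv<n
      ; witness = u , ℕ.≤-refl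
      }
      where
      du+dv<n : degree G u + degree G v < n
      du+dv<n = subst₂ _<_
        (cong₂ _+_ (spanning-count (adj G u) σ) (spanning-count (adj G v) σ))
        (cong₂ _+_ (cong (if_then 1 else 0) (irrefl G u)) (spanning-length σ))
        (degree-sum nc)
      far : ∀ x → x ≢ v → adj G x v ≡ false → (degree G x ≤ᵇ degree G u) ≡ true
      far x x≢v x≁v = ≤ᵇ-intro (ℕ.+-cancelʳ-≤ (degree G v) _ _ (maximal x v x≢v x≁v))
      nonadjacent : ∀ x → Dec (x ≡ u) → adj G u x ≡ false → degree G x + degree G u < n
      nonadjacent x (yes refl) _ = ℕ.≤-<-trans (ℕ.+-monoʳ-≤ (degree G u) du≤dv) du+dv<n
      nonadjacent x (no x≢u) u≁x = ℕ.≤-<-trans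
        (ℕ.≤-trans (ℕ.≤-reflexive (ℕ.+-comm (degree G x) (degree G u))) (maximal u x (x≢u ∘ sym) u≁x)) du+dv<n

maximise : ∀ {n} (p : Fin n → Bool) (f : Fin n → ℕ) →
  (∀ i → p i ≡ false) ⊎ (∃ λ i → p i ≡ true × (∀ j → p j ≡ true → f j ≤ f i))
maximise {zero}  p f = inj₁ λ ()
maximise {suc n} p f with p zero in eq | maximise (p ∘ suc) (f ∘ suc)
... | false | inj₁ none = inj₁ λ { zero → eq ; (suc i) → none i }
... | true  | inj₁ none = inj₂ (zero , eq ,
  λ { zero _ → ℕ.≤-refl ; (suc j) pj → case trans (sym pj) (none j) of λ () })
... | false | inj₂ (i , pi , max) = inj₂ (suc i , pi ,
  λ { zero p0 → case trans (sym p0) eq of λ () ; (suc j) pj → max j pj })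
... | true  | inj₂ (i , pi , max) =
  [ (λ f0≤fi → inj₂ (suc i , pi , λ { zero _ → f0≤fi ; (suc j) pj → max j pj }))
  , (λ fi≤f0 → inj₂ (zero , eq , λ { zero _ → ℕ.≤-refl ; (suc j) pj → ℕ.≤-trans (max j pj) fi≤f0 })) ]′
  (ℕ.≤-total (f zero) (f (suc i)))

module _ {n} (G : Graph n) where

  nonEdge : Fin n → Fin n → Bool
  nonEdge x y = not (adj G x y) 𝔹.∧ not (does (x Fin.≟ y))

  nonEdge-intro : ∀ {x y} → x ≢ y → adj G x y ≡ false → nonEdge x y ≡ true
  nonEdge-intro x≢y x≁y = cong₂ 𝔹._∧_ (cong not x≁y) (cong not (≢⇒does x≢y))

  nonEdge-elim : ∀ x y → nonEdge x y ≡ true → x ≢ y × adj G x y ≡ false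
  nonEdge-elim x y e with adj G x y | x Fin.≟ y
  ... | false | no x≢y = x≢y , refl

  private
    pair : Fin (n * n) → Fin n × Fin n
    pair = Fin.remQuot n

    at : ∀ {A : Set} (f : Fin n → Fin n → A) x y →
      f (proj₁ (pair (Fin.combine x y))) (proj₂ (pair (Fin.combine x y))) ≡ f x y
    at f x y = cong (λ (a , b) → f a b) (Fin.remQuot-combine x y)

  nonEdges : ℕ
  nonEdges = count (λ i → nonEdge (proj₁ (pair i)) (proj₂ (pair i)))

  MaximalNonEdge : Fin n → Fin n → Set
  MaximalNonEdge u v = u ≢ v × adj G u v ≡ false ×
    (∀ x y → x ≢ y → adj G x y ≡ false → degree G x + degree G y ≤ degree G u + degree G v)

  complete-or-maximal : (∀ x y → x ≢ y → Adj G x y) ⊎ ∃₂ MaximalNonEdge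
  complete-or-maximal = from (maximise (λ i → nonEdge (proj₁ (pair i)) (proj₂ (pair i)))
    (λ i → sum′ (proj₁ (pair i)) (proj₂ (pair i))))
    where
    sum′ : Fin n → Fin n → ℕ
    sum′ x y = degree G x + degree G y
    from : _ → (∀ x y → x ≢ y → Adj G x y) ⊎ ∃₂ MaximalNonEdge
    from (inj₁ none) = inj₁ λ x y x≢y → Bool.¬-not λ x≁y →
      case trans (sym (nonEdge-intro x≢y x≁y)) (trans (sym (at nonEdge x y)) (none (Fin.combine x y))) of λ ()
    from (inj₂ (i , pi , max)) = let u≢v , u≁v = nonEdge-elim (proj₁ (pair i)) (proj₂ (pair i)) pi in
      inj₂ (proj₁ (pair i) , proj₂ (pair i) , u≢v , u≁v , λ x y x≢y x≁y →
        subst (_≤ sum′ (proj₁ (pair i)) (proj₂ (pair i))) (at sum′ x y)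
          (max (Fin.combine x y) (trans (at nonEdge x y) (nonEdge-intro x≢y x≁y))))

nonEdges-addEdge : ∀ {n} (G : Graph n) {u v} (u≢v : u ≢ v) → adj G u v ≡ false →
                   nonEdges (addEdge G u v u≢v) < nonEdges G
nonEdges-addEdge {n} G {u} {v} u≢v u≁v = count-mono-< (Fin.combine u v)
  (λ i e → let x≢y , x≁y = nonEdge-elim G⁺ _ _ e in nonEdge-intro G x≢y (Bool.¬-not λ x~y →
    case trans (sym x≁y) (adj⇒addEdge G u v u≢v x~y) of λ ()))
  (trans (at (nonEdge G⁺)) (cong (λ b → not b 𝔹.∧ not (does (u Fin.≟ v))) (addEdge-new G u v u≢v)))
  (trans (at (nonEdge G)) (nonEdge-intro G u≢v u≁v))
  where
  G⁺ : Graph n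
  G⁺ = addEdge G u v u≢v
  at : ∀ (f : Fin n → Fin n → Bool) →
    f (proj₁ (Fin.remQuot n (Fin.combine u v))) (proj₂ (Fin.remQuot {n} n (Fin.combine u v))) ≡ f u v
  at f = cong (λ (a , b) → f a b) (Fin.remQuot-combine u v)

complete-walk : ∀ {n} (G : Graph n) → (∀ x y → x ≢ y → Adj G x y) → ∀ a xs → Unique (a ∷ xs) →
                ∃ λ b → Walk (Adj G) a b (a ∷ xs)
complete-walk G complete a [] _ = a , stop
complete-walk G complete a (x ∷ xs) ((a≢x ∷ _) ∷ unique) =
  let b , w = complete-walk G complete x xs unique in b , step (complete a x a≢x) w

complete⇒cycle : ∀ {n} (G : Graph n) → 3 ≤ n → (∀ x y → x ≢ y → Adj G x y) → HamCycle G
complete⇒cycle {suc n} G 3≤n complete = close (complete-walk G complete zero (tabulate suc) (allFin⁺ (suc n)))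
  where
  close : (∃ λ b → Walk (Adj G) zero b (allFin (suc n))) → HamCycle G
  close (b , w) = zero , b , allFin (suc n) , w , complete b zero (λ { refl → no-loop w }) , ↭-refl
    where
    no-loop : Walk (Adj G) zero zero (allFin (suc n)) → ⊥
    no-loop w = case ℕ.≤-trans 3≤n (ℕ.≤-reflexive
      (trans (sym (List.length-tabulate id)) (loop-trivial w (allFin⁺ (suc n))))) of λ { (s≤s ()) }

-- Induction on the number of non-edges replaces an edge-maximal non-Hamiltonian graph: a non-edge
-- of maximal degree sum is added, and the result for the larger graph gives either a failure,
-- inherited by `G`, or a cycle, which supplies the Hamiltonian path between the ends of that
-- non-edge.
chvatal : ∀ {n} (G : Graph n) → 3 ≤ n → HamCycle G ⊎ ∃ (Bad G 0)
chvatal {n} G 3≤n = by-fuel (suc (nonEdges G)) G ℕ.≤-refl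
  where
  by-fuel : ∀ N (G : Graph n) → nonEdges G < N → HamCycle G ⊎ ∃ (Bad G 0)
  by-fuel (suc N) G (s≤s fuel) =
    [ (λ complete → inj₁ (complete⇒cycle G 3≤n complete)) , (λ (u , v , max) → non-edge u v max) ]′
    (complete-or-maximal G)
    where
    ordered : ∀ u v → degree G u ≤ degree G v → MaximalNonEdge G u v → HamCycle G ⊎ ∃ (Bad G 0)
    ordered u v du≤dv (u≢v , u≁v , maximal) =
      [ (λ cycle → [ inj₁ , (λ path →
            [ inj₁ , (λ bad → inj₂ (degree G u , bad)) ]′ (cycle-or-bad G u v u≁v du≤dv maximal path)) ]′
          (remove-edge G u v u≢v 3≤n cycle))
      , (λ (i , bad) → inj₂ (i , bad-antitone
          (λ x → count-mono {p = adj G x} {q = adj (addEdge G u v u≢v) x} λ y → adj⇒addEdge G u v u≢v) bad)) ]′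
      (by-fuel N (addEdge G u v u≢v) (ℕ.<-≤-trans (nonEdges-addEdge G u≢v u≁v) fuel))
    non-edge : ∀ u v → MaximalNonEdge G u v → HamCycle G ⊎ ∃ (Bad G 0)
    non-edge u v max@(u≢v , u≁v , maximal) = [ (λ du≤dv → ordered u v du≤dv max)
      , (λ dv≤du → ordered v u dv≤du (u≢v ∘ sym , trans (symm G v u) u≁v , λ x y x≢y x≁y →
          ℕ.≤-trans (maximal x y x≢y x≁y) (ℕ.≤-reflexive (ℕ.+-comm (degree G u) (degree G v))))) ]′
      (ℕ.≤-total (degree G u) (degree G v))

-- From walks to the defined cycles and paths; the cone over a graph

module _ {n} {G : Graph n} where

  walk-first : ∀ {a b xs} → Walk (Adj G) a b xs → ∀ i → toℕ i ≡ 0 → lookup xs i ≡ a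
  walk-first stop       zero _ = refl
  walk-first (step _ _) zero _ = refl

  walk-steps : ∀ {a b xs} → Walk (Adj G) a b xs → ∀ i j → toℕ j ≡ suc (toℕ i) → Adj G (lookup xs i) (lookup xs j)
  walk-steps stop       zero    zero    ()
  walk-steps (step r w) zero    (suc j) eq = subst (Adj G _) (sym (walk-first w j (ℕ.suc-injective eq))) r
  walk-steps (step r w) (suc i) (suc j) eq = walk-steps w i j (ℕ.suc-injective eq)

  walk-last : ∀ {a b xs} → Walk (Adj G) a b xs → ∀ j → suc (toℕ j) ≡ length xs → lookup xs j ≡ b
  walk-last stop                zero    _  = refl
  walk-last (step _ stop)       zero    ()
  walk-last (step _ (step _ _)) zero    ()
  walk-last (step _ w)          (suc j) eq = walk-last w j (ℕ.suc-injective eq)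

  lookup-injective : ∀ {xs : List (Fin n)} → Unique xs → ∀ {i j} → lookup xs i ≡ lookup xs j → i ≡ j
  lookup-injective (_ ∷ _) {zero} {zero} _ = refl
  lookup-injective (x∉ ∷ _) {zero} {suc j} eq = contradiction eq (All.lookup x∉ (∈-lookup j))
  lookup-injective (x∉ ∷ _) {suc i} {zero} eq = contradiction (sym eq) (All.lookup x∉ (∈-lookup i))
  lookup-injective (_ ∷ unique) {suc i} {suc j} eq = cong suc (lookup-injective unique eq)

  cycle⇒hamiltonian : 3 ≤ n → HamCycle G → Hamiltonian G
  cycle⇒hamiltonian 3≤n (a , b , xs , w , b~a , σ) = length xs , lookup xs ,
    ( subst (3 ≤_) (sym (spanning-length σ)) 3≤n
    , (lookup-injective (spanning-unique σ) , walk-steps w)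
    , λ i j i≡0 j≡l → subst₂ (Adj G) (sym (walk-last w j j≡l)) (sym (walk-first w i i≡0)) b~a )
    , λ v → index (spanning-∈ σ v) , sym (lookup-index (spanning-∈ σ v))

  path⇒traceable : ∀ {a b xs} → Walk (Adj G) a b xs → Unique xs → (∀ v → v ∈ xs) → Traceable G
  path⇒traceable {xs = xs} w unique complete = length xs , lookup xs , (lookup-injective unique , walk-steps w) ,
    λ v → index (complete v) , sym (lookup-index (complete v))

cone : ∀ {n} → Graph n → Graph (suc n)
cone G = K 1 ∨ G

cone-walk : ∀ {n} (G : Graph n) {a b xs} → Walk (Adj (cone G)) a b xs → All (zero ≢_) xs →
            ∃₂ λ c d → ∃ λ ys → Walk (Adj G) c d ys × xs ≡ map suc ys × a ≡ suc c
cone-walk G {zero} stop (0≢0 ∷ _) = contradiction refl 0≢0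
cone-walk G {suc a} stop _ = a , a , a ∷ [] , stop , refl , refl
cone-walk G {zero} (step _ _) (0≢0 ∷ _) = contradiction refl 0≢0
cone-walk G {suc a} (step r w) (_ ∷ 0∉) with cone-walk G w 0∉
... | c , d , ys , w′ , refl , refl = a , d , a ∷ ys , step r w′ , refl , refl

cone-cycle⇒traceable : ∀ {n} {G : Graph n} → 1 ≤ n → HamCycle (cone G) → Traceable G
cone-cycle⇒traceable {n} {G} 1≤n (a , b , xs , w , r , σ) = from-zero (rotate w r σ zero)
  where
  from-zero : (∃₂ λ e ws → Walk (Adj (cone G)) zero e ws × Adj (cone G) e zero × Spanning ws) → Traceable G
  from-zero (e , ws , stop , _ , τ) = contradiction
    (ℕ.≤-trans (s≤s 1≤n) (ℕ.≤-reflexive (sym (spanning-length τ)))) λ { (s≤s ()) }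
  from-zero (e , .(zero ∷ ws) , step {xs = ws} _ walk , _ , τ) = cases (spanning-unique τ)
    where
    cases : Unique (zero ∷ ws) → Traceable G
    cases (0∉ws ∷ unique) with cone-walk G walk 0∉ws
    ... | _ , _ , ys , w′ , refl , _ = path⇒traceable {G = G} w′ (map⁻ {f = suc} unique) complete
      where
      complete : ∀ v → v ∈ ys
      complete v with spanning-∈ τ (suc v)
      ... | there sv∈ with ∈-map⁻ suc sv∈
      ... | _ , v∈ys , refl = v∈ys

-- In the cone every old degree and the order grow by one, so `i` becomes `j + 1`. The apex has
-- degree `n`, too large to enter either count or to be the witness.
cone-bad : ∀ {n} {G : Graph n} → 1 ≤ n → ∀ {i} → Bad (cone G) 0 i → ∃ λ j → Bad G 1 j
cone-bad {n} {G} 1≤n {i} bad = from-witness (proj₁ witness) (proj₂ witness)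
  where
  open Bad bad
  degree-zero : degree (cone G) zero ≡ n
  degree-zero = count-true {n}
  i<n : i < n
  i<n = ℕ.≰⇒> λ n≤i → ℕ.<⇒≱ bound (ℕ.≤-trans (ℕ.+-mono-≤ (ℕ.≤-trans 1≤n n≤i) n≤i) ℕ.≤-refl)
  from-witness : ∀ u → degree (cone G) u ≤ i → ∃ λ j → Bad G 1 j
  from-witness zero    d≤i = contradiction (ℕ.≤-trans (ℕ.≤-reflexive (sym degree-zero)) d≤i) (ℕ.<⇒≱ i<n)
  from-witness (suc u) d≤i = shifted i d≤i small large bound i<n
    where
    shifted : ∀ i → suc (degree G u) ≤ i →
      i ≤ count (λ v → degree (cone G) v ≤ᵇ i) →
      suc n ≤ i + count (λ v → suc (degree (cone G) v + i) ≤ᵇ suc n) →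
      i + i < suc n → i < n → ∃ λ j → Bad G 1 j
    -- An old vertex has positive degree in the cone, which rules out `i = 0`.
    shifted (suc j) (s≤s d≤j) small large bound i<n = j , record
      { small   = ℕ.≤-trans small (ℕ.≤-trans
          (ℕ.≤-reflexive (trans (count-suc (λ v → degree (cone G) v ≤ᵇ suc j))
            (cong (λ b → (if b then 1 else 0) + count (λ v → suc (degree G v) ≤ᵇ suc j))
              (Bool.¬-not λ e → ℕ.<⇒≱ i<n (subst (_≤ suc j) degree-zero (≤ᵇ-elim {degree (cone G) zero} e))))))
          (count-mono λ v e → ≤ᵇ-intro (ℕ.≤-pred (≤ᵇ-elim {suc (degree G v)} e))))
      ; large   = ℕ.≤-pred (ℕ.≤-trans large (ℕ.≤-reflexive (cong (suc j +_)
          (trans (count-suc (λ v → suc (degree (cone G) v + suc j) ≤ᵇ suc n))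
            (cong (λ b → (if b then 1 else 0) + count (λ v → suc (degree G v + suc j) ≤ᵇ n))
              (Bool.¬-not λ e → ℕ.m+1+n≰m n (subst (λ d → d + suc j ≤ n) degree-zero
                (ℕ.≤-pred (≤ᵇ-elim {suc (degree (cone G) zero + suc j)} e)))))))))
      ; bound   = ℕ.≤-trans (ℕ.≤-reflexive (cong suc (sym (ℕ.+-suc j j)))) (ℕ.≤-pred bound)
      ; witness = u , d≤j
      }

-- Classes from a failure of Chvátal's condition

shrink : ∀ {n} (p : Fin n → Bool) c → c ≤ count p → ∃ λ q → (∀ i → q i ≡ true → p i ≡ true) × count q ≡ c
shrink {n} p zero _ = (λ _ → false) , (λ _ ()) , count-false {n}
shrink {suc n} p (suc c) c≤ = by-head (p zero) refl
  where
  by-head : ∀ b → p zero ≡ b → ∃ λ q → (∀ i → q i ≡ true → p i ≡ true) × count q ≡ suc c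
  by-head true eq =
    let q , q⇒p , size = shrink (p ∘ suc) c (ℕ.≤-pred (subst (suc c ≤_)
          (trans (count-suc p) (cong (λ b → (if b then 1 else 0) + count (p ∘ suc)) eq)) c≤))
    in (λ { zero → true ; (suc i) → q i }) , (λ { zero _ → eq ; (suc i) → q⇒p i }) , cong suc size
  by-head false eq =
    let q , q⇒p , size = shrink (p ∘ suc) (suc c) (subst (suc c ≤_)
          (trans (count-suc p) (cong (λ b → (if b then 1 else 0) + count (p ∘ suc)) eq)) c≤)
    in (λ { zero → false ; (suc i) → q i }) , (λ { zero () ; (suc i) → q⇒p i }) , size

count-∧-not : ∀ {n} (p q : Fin n → Bool) → count p ≤ count (λ i → p i 𝔹.∧ not (q i)) + count q
count-∧-not {zero}  p q = z≤n
count-∧-not {suc n} p q = subst₂ _≤_ (sym (count-suc p))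
  (trans (exchange (if r zero then 1 else 0) (if q zero then 1 else 0) (count (r ∘ suc)) (count (q ∘ suc)))
    (sym (cong₂ _+_ (count-suc r) (count-suc q))))
  (ℕ.+-mono-≤ (bits (p zero) (q zero)) (count-∧-not (p ∘ suc) (q ∘ suc)))
  where
  r : Fin (suc n) → Bool
  r i = p i 𝔹.∧ not (q i)
  exchange : ∀ a b c d → (a + b) + (c + d) ≡ (a + c) + (b + d)
  exchange = solve-ℕ
  bits : ∀ a b → (if a then 1 else 0) ≤ (if a 𝔹.∧ not b then 1 else 0) + (if b then 1 else 0)
  bits true  true  = ℕ.≤-refl
  bits true  false = ℕ.≤-refl
  bits false b     = z≤n

count-classes : ∀ {n} (cls : Fin n → Class) →
  count (λ v → cls v == top) + count (λ v → cls v == mid) + count (λ v → cls v == low) ≡ n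
count-classes {zero}  cls = refl
count-classes {suc n} cls = trans
  (cong₂ _+_ (cong₂ _+_ (count-suc (λ v → cls v == top)) (count-suc (λ v → cls v == mid)))
    (count-suc (λ v → cls v == low)))
  (trans (exchange (bit top) (bit mid) (bit low) _ _ _) (cong₂ _+_ (one (cls zero)) (count-classes (cls ∘ suc))))
  where
  bit : Class → ℕ
  bit c = if cls zero == c then 1 else 0
  exchange : ∀ a b c d e f → (a + d) + (b + e) + (c + f) ≡ (a + b + c) + (d + e + f)
  exchange = solve-ℕ
  one : ∀ x → (if x == top then 1 else 0) + (if x == mid then 1 else 0) + (if x == low then 1 else 0) ≡ 1
  one top = refl
  one mid = refl
  one low = refl

-- Exactly `t + i` of the vertices of degree at most `i` become low, and exactly `m` of the
-- remaining ones that satisfy the second degree bound become mid. There are enough of the latter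
-- because at most `i` vertices violate that bound; the `i` left over are top.
bad⇒dominated : ∀ {n} {G : Graph n} {t i m} → n ≡ t + i + i + m → Bad G t i →
                ∃ λ cls → Dominated G cls i m (t + i)
bad⇒dominated {n} {G} {t} {i} {m} n≡ bad = cls , record
  { sizes = record
    { size-top = ℕ.+-cancelʳ-≡ (m + (t + i)) _ _ (trans (sym (ℕ.+-assoc (count (λ v → cls v == top)) m (t + i)))
        (trans (cong₂ (λ a b → count (λ v → cls v == top) + a + b) (sym size-mid) (sym size-low))
          (trans (count-classes cls) (trans n≡ (exchange t i m)))))
    ; size-mid = size-mid
    ; size-low = size-low
    }
  ; low-degree = λ v v∈low → ≤ᵇ-elim (isLow⇒ v (class-low (isLow v) (isMid v) v∈low))
  ; mid-degree = λ v v∈mid → ℕ.+-cancelʳ-≤ (t + i) _ _ (ℕ.≤-trans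
      (≤ᵇ-elim {suc (degree G v + (t + i))} {n}
        (Bool.∧-conicalˡ (large? v) _ (isMid⇒ v (class-mid (isLow v) (isMid v) v∈mid))))
      (ℕ.≤-reflexive (trans n≡ (rearrange t i m))))
  }
  where
  open Bad bad
  small? large? : Fin n → Bool
  small? v = degree G v ≤ᵇ i
  large? v = suc (degree G v + (t + i)) ≤ᵇ n

  isLow : Fin n → Bool
  isLow = proj₁ (shrink small? (t + i) small)
  isLow⇒ : ∀ v → isLow v ≡ true → small? v ≡ true
  isLow⇒ = proj₁ (proj₂ (shrink small? (t + i) small))
  count-low : count isLow ≡ t + i
  count-low = proj₂ (proj₂ (shrink small? (t + i) small))

  candidate : Fin n → Bool
  candidate v = large? v 𝔹.∧ not (isLow v)

  enough-mid : m ≤ count candidate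
  enough-mid = ℕ.+-cancelʳ-≤ (i + (t + i)) _ _ (begin
    m + (i + (t + i))                                                  ≡⟨ exchange′ m i t ⟩
    t + i + i + m                                                      ≡⟨ n≡ ⟨
    n                                                                  ≤⟨ large ⟩
    i + count large?                                                   ≤⟨ ℕ.+-monoʳ-≤ i (count-∧-not large? isLow) ⟩
    i + (count candidate + count isLow)       ≡⟨ cong (λ c → i + (count candidate + c)) count-low ⟩
    i + (count candidate + (t + i))           ≡⟨ exchange″ i (count candidate) (t + i) ⟩
    count candidate + (i + (t + i))           ∎)
    where
    open ℕ.≤-Reasoning
    exchange′ : ∀ m i t → m + (i + (t + i)) ≡ t + i + i + m
    exchange′ = solve-ℕ
    exchange″ : ∀ a b c → a + (b + c) ≡ b + (a + c)
    exchange″ = solve-ℕ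

  isMid : Fin n → Bool
  isMid = proj₁ (shrink candidate m enough-mid)
  isMid⇒ : ∀ v → isMid v ≡ true → large? v 𝔹.∧ not (isLow v) ≡ true
  isMid⇒ = proj₁ (proj₂ (shrink candidate m enough-mid))
  count-mid : count isMid ≡ m
  count-mid = proj₂ (proj₂ (shrink candidate m enough-mid))

  classOf : Bool → Bool → Class
  classOf true  _     = low
  classOf false true  = mid
  classOf false false = top
  cls : Fin n → Class
  cls v = classOf (isLow v) (isMid v)

  class-low : ∀ a b → classOf a b ≡ low → a ≡ true
  class-low true  _     _ = refl
  class-low false true  ()
  class-low false false ()
  class-mid : ∀ a b → classOf a b ≡ mid → b ≡ true
  class-mid false true _ = refl
  class-mid true  b    ()
  class-mid false false ()

  size-low : count (λ v → cls v == low) ≡ t + i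
  size-low = trans (count-cong λ v → eq (isLow v) (isMid v)) count-low
    where
    eq : ∀ a b → (classOf a b == low) ≡ a
    eq true  _     = refl
    eq false true  = refl
    eq false false = refl
  size-mid : count (λ v → cls v == mid) ≡ m
  size-mid = trans (count-cong λ v → eq (isLow v) (isMid v) (λ e → Bool.∧-conicalʳ (large? v) _ (isMid⇒ v e))) count-mid
    where
    eq : ∀ a b → (b ≡ true → not a ≡ true) → (classOf a b == mid) ≡ b
    eq true  true  h = case h refl of λ ()
    eq true  false _ = refl
    eq false true  _ = refl
    eq false false _ = refl
  exchange : ∀ t i m → t + i + i + m ≡ i + (m + (t + i))
  exchange = solve-ℕ
  rearrange : ∀ t i m → t + i + i + m ≡ i + m + (t + i)
  rearrange = solve-ℕ

-- The spectral comparison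

record IntegerRows (k t i μ D : ℕ) : Set where
  field
    i≡k+D : i ≡ k + D
    1≤i   : 1 ≤ i
    lows  : i + t + 1 ≤ 2 * D + μ
    mids  : i * i + i * t ≤ 2 * D * (i + μ)
    tops  : (i + t) * (3 * i + t) ≤ 2 * D * (2 * i + t + μ) + (i + t)

  -- With `n = t + 2i + μ + 1` the weights are the degrees of top, mid and low vertices in the graph
  -- with parameter `i`, and `2(i + D + μ)` is twice the clique degree in the one with parameter
  -- `k`. The fields of the record are what is left of the three rows after common terms cancel.
  weights-stretch : Stretch i (suc μ) (t + i)
  weights-stretch = integer-stretch i μ (t + i) {a = 2 * i + t + μ} {i + μ} {i} {2 * (i + D + μ)}
    (ℕ.+-cancelʳ-≤ (2 * D * (2 * i + t + μ) + (i + t)) _ _ (ℕ.≤-trans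
      (ℕ.≤-reflexive (top-eq i t μ D)) (ℕ.+-monoʳ-≤ (2 * (i + D + μ) * (2 * i + t + μ) + (2 * i + t + μ)) tops)))
    (ℕ.+-cancelʳ-≤ (2 * D * (i + μ)) _ _ (ℕ.≤-trans
      (ℕ.≤-reflexive (mid-eq i t μ D)) (ℕ.+-monoʳ-≤ (2 * (i + D + μ) * (i + μ)) mids)))
    (begin
      -- Enlarging the unit of slack to `i` makes the whole row divisible by `i`, which reduces it
      -- to `lows`.
      i * i + i * (2 * i + t + μ) + 1             ≤⟨ ℕ.+-monoʳ-≤ (i * i + i * (2 * i + t + μ)) 1≤i ⟩
      i * i + i * (2 * i + t + μ) + i             ≡⟨ low-eq i t μ ⟩
      i * (2 * i + μ + (i + t + 1))               ≤⟨ ℕ.*-monoʳ-≤ i (ℕ.+-monoʳ-≤ (2 * i + μ) lows) ⟩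
      i * (2 * i + μ + (2 * D + μ))               ≡⟨ low-eq′ i μ D ⟩
      2 * (i + D + μ) * i                         ∎)
    1≤i ℕ.≤-refl
    (ℕ.≤-trans (ℕ.+-monoˡ-≤ (i + μ) 1≤i) (ℕ.≤-trans (ℕ.m≤m+n _ t) (ℕ.≤-reflexive (wide i t μ))))
    where
    open ℕ.≤-Reasoning
    top-eq : ∀ i t μ D → (i + μ + (t + i)) * (2 * i + t + μ) + (i * (2 * i + t + μ) + suc μ * (i + μ) + (t + i) * i)
      + (2 * D * (2 * i + t + μ) + (i + t))
      ≡ 2 * (i + D + μ) * (2 * i + t + μ) + (2 * i + t + μ) + (i + t) * (3 * i + t)
    top-eq = solve-ℕ
    mid-eq : ∀ i t μ D → (i + μ) * (i + μ) + (i * (2 * i + t + μ) + μ * (i + μ)) + 2 * D * (i + μ)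
      ≡ 2 * (i + D + μ) * (i + μ) + (i * i + i * t)
    mid-eq = solve-ℕ
    low-eq : ∀ i t μ → i * i + i * (2 * i + t + μ) + i ≡ i * (2 * i + μ + (i + t + 1))
    low-eq = solve-ℕ
    low-eq′ : ∀ i μ D → i * (2 * i + μ + (2 * D + μ)) ≡ 2 * (i + D + μ) * i
    low-eq′ = solve-ℕ
    wide : ∀ i t μ → i + (i + μ) + t ≡ 2 * i + t + μ
    wide = solve-ℕ

module Comparison {n} (G : Graph n) {k t m : ℕ} (n≡ : n ≡ t + k + k + m) (2≤m : 2 ≤ m) (1≤s : 1 ≤ t + k)
  {q q₀ : ℝ} (q-eigen : IsEigenvalue (signlessLaplacian G) q)
  (q₀-largest : Is-q (Extremal k m (t + k)) q₀) (q₀≤q : q₀ ≤ᴿ q) where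

  private
    x : Fin n → ℝ
    x = proj₁ q-eigen

    x≉0 : ¬ (∀ v → x v ≈ 0ᴿ)
    x≉0 = proj₁ (proj₂ q-eigen)

    open Spectral (spectral k m (t + k) 2≤m 1≤s)
    module P = Stretch P

    -- `h` is an eigenvalue of the extremal graph, hence at most its largest eigenvalue `q₀`, which
    -- is at most `q`.
    h≲q : seq P.h ≲ seq q
    h≲q = ≲-trans (mk≲ (proj₂ q₀-largest P.h eigenvalue)) (mk≲ q₀≤q)

  module _ {cls : Fin n → Class} (D : Dominated G cls k m (t + k)) where

    private
      open Dominated D
      open Nullity D P {x} {q} (proj₂ (proj₂ q-eigen)) (eventually h≲q)

      not-top : k ≡ 0 → ∀ {v} → cls v ≡ top → ⊥
      not-top k≡0 {v} v∈top = case subst (1 ≤_) (trans size-top k≡0)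
        (∃⇒count (λ v → cls v == top) v (cong (_== top) v∈top)) of λ ()

      -- For `k = 0` there is no top vertex to spread nullity through, but a low vertex has degree
      -- 0, so a defect cannot lie between two low vertices and one of its ends is mid.
      mid-null : k ≡ 0 → (∀ {v} → cls v ≡ low → Null v) → ∀ {v u} → Defect G cls m v u → ∃ λ v → cls v ≡ mid × Null v
      mid-null k≡0 lows {v} {u} d = by-class (cls v) (cls u) refl refl
        where
        by-class : ∀ a b → cls v ≡ a → cls u ≡ b → ∃ λ v → cls v ≡ mid × Null v
        by-class top b   v∈ u∈ = ⊥-elim (not-top k≡0 v∈)
        by-class mid b   v∈ u∈ = v , v∈ , defect⇒null d
        by-class low top v∈ u∈ = ⊥-elim (not-top k≡0 u∈)
        by-class low mid v∈ u∈ = u , u∈ , defect⇒null (defect-sym d)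
        by-class low low v∈ u∈ = contradiction
          (ℕ.≤-trans (∃⇒count (adj G v) u (Bool.¬-not λ v≁u → Defect.mismatch d (trans v≁u (sym (cong₂ joined v∈ u∈)))))
            (subst (degree G v ≤_) k≡0 (low-degree v v∈))) λ ()

      clique-null : k ≡ 0 → (∀ {v} → cls v ≡ low → Null v) → ∀ {v u} → Defect G cls m v u → ∀ u → Null u
      clique-null k≡0 lows d u = let v , v∈mid , v-null = mid-null k≡0 lows d in by-class v v∈mid v-null (cls u) refl
        where
        by-class : ∀ v → cls v ≡ mid → Null v → ∀ c → cls u ≡ c → Null u
        by-class v v∈ v-null top u∈ = ⊥-elim (not-top k≡0 u∈)
        by-class v v∈ v-null mid u∈ = spread (inj₂ (inj₂ 2≤m)) v-null (cong₂ joined v∈ u∈)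
        by-class v v∈ v-null low u∈ = lows u∈

      defect⇒all-null : ∀ {v u} → Defect G cls m v u → ∀ u → Null u
      defect⇒all-null d = [ (λ 1≤k → top-spread 1≤k (defect⇒null d))
                          , (λ 0<extra → [ (λ 1≤k → top-spread 1≤k (defect⇒null d))
                                         , (λ k≡0 → clique-null k≡0 (low⇒null 0<extra) d) ]′ (positive-or-zero k)) ]′ positive
        where
        positive-or-zero : ∀ k → 1 ≤ k ⊎ k ≡ 0
        positive-or-zero zero    = inj₂ refl
        positive-or-zero (suc _) = inj₁ (s≤s z≤n)

    extremal : G ≅ Extremal k m (t + k)
    extremal = model-≅ {G = G} {H = Extremal k m (t + k)} model sizes
      (extremal-model k m (t + k)) (extremal-sizes k m (t + k))
      where
      model : Model G cls
      model v u v≢u = by-dec (adj G v u Bool.≟ joined (cls v) (cls u))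
        where
        by-dec : Dec (adj G v u ≡ joined (cls v) (cls u)) → adj G v u ≡ joined (cls v) (cls u)
        by-dec (yes eq) = eq
        -- Adjacency is decidable, so refuting a single wrongly joined pair establishes the model.
        by-dec (no ne)  = ⊥-elim (x≉0 (all-null (defect⇒all-null (defect v≢u ne (inj₂ (inj₂ 2≤m))))))

  module _ {i μ D : ℕ} (rows : IntegerRows k t i μ D) (n≡′ : n ≡ t + i + i + suc μ) where

    open IntegerRows rows

    no-dominated : ∀ {cls} → Dominated G cls i (suc μ) (t + i) → ⊥
    no-dominated {cls} Dom = x≉0 (all-null (top-spread 1≤i low-null))
      where
      -- Both sides are `n - t - k`, the order of the clique in the extremal graph; this identifies
      -- the integer `h` of the degree weights with its clique bound.
      m≡ : suc (i + D + μ) ≡ m + k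
      m≡ = ℕ.+-cancelˡ-≡ (t + k) _ _ (trans (cong (λ j → t + k + suc (j + D + μ)) i≡k+D)
        (trans (eq t k D μ) (trans (cong (λ j → t + j + j + suc μ) (sym i≡k+D))
          (trans (sym n≡′) (trans n≡ (eq′ t k m))))))
        where
        eq : ∀ t k D μ → t + k + suc (k + D + D + μ) ≡ t + (k + D) + (k + D) + suc μ
        eq = solve-ℕ
        eq′ : ∀ t k m → t + k + k + m ≡ t + k + (m + k)
        eq′ = solve-ℕ

      ιL : ι (2 * (i + D + μ)) ≡ cliqueBound k m
      ιL = begin
        ι (2 * (i + D + μ))                       ≡⟨ cong ι (double (i + D + μ)) ⟩
        ι (l + l)                                 ≡⟨ ι-+ l l ⟩
        ι l +ℚ ι l                                ≡⟨ add-sub (ι l) ⟩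
        (1ℚ +ℚ ι l) +ℚ (1ℚ +ℚ ι l) -ℚ 1ℚ -ℚ 1ℚ    ≡⟨ cong (λ y → y +ℚ y -ℚ 1ℚ -ℚ 1ℚ) 1+l ⟩
        (ι m +ℚ ι k) +ℚ (ι m +ℚ ι k) -ℚ 1ℚ -ℚ 1ℚ  ≡⟨ rearrange (ι m) (ι k) ⟩
        cliqueBound k m                           ∎
        where
        open ≡-Reasoning
        l : ℕ
        l = i + D + μ
        double : ∀ l → 2 * l ≡ l + l
        double = solve-ℕ
        add-sub : ∀ x → x +ℚ x ≡ (1ℚ +ℚ x) +ℚ (1ℚ +ℚ x) -ℚ 1ℚ -ℚ 1ℚ
        add-sub = solve-∀ ℚ-ring
        rearrange : ∀ m k → (m +ℚ k) +ℚ (m +ℚ k) -ℚ 1ℚ -ℚ 1ℚ ≡ m +ℚ m +ℚ k -ℚ 1ℚ -ℚ 1ℚ +ℚ k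
        rearrange = solve-∀ ℚ-ring
        1+l : 1ℚ +ℚ ι l ≡ ι m +ℚ ι k
        1+l = trans (cong (_+ℚ ι l) (sym ι-1)) (trans (sym (ι-+ 1 l)) (trans (cong ι m≡) (ι-+ m k)))

      L≲q : (λ _ → ι (2 * (i + D + μ))) ≲ seq q
      L≲q = ≲-trans (≤⇒≲ λ j → subst (_≤ℚ seq P.h j) (sym ιL) (clique≤h j)) h≲q

      open Dominated Dom
      open Nullity Dom weights-stretch {x} {q} (proj₂ (proj₂ q-eigen)) (eventually L≲q)

      low-vertex : ∃ λ v → (cls v == low) ≡ true
      low-vertex = count⇒∃ (λ v → cls v == low) (subst (1 ≤_) (sym size-low) (ℕ.≤-trans 1≤i (ℕ.m≤n+m i t)))

      low-null : Null (proj₁ low-vertex)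
      low-null = low⇒null 0<1 (==⇒≡ (proj₂ low-vertex))

  bad⇒extremal : (∀ {i μ D} → n ≡ t + i + i + suc μ → i ≡ k + D → 1 ≤ D → IntegerRows k t i μ D) →
                 ∀ {i} → k ≤ i → Bad G t i → G ≅ Extremal k m (t + k)
  bad⇒extremal rows {i} k≤i bad = by-order (k ℕ.≟ i)
    where
    by-order : Dec (k ≡ i) → G ≅ Extremal k m (t + k)
    by-order (yes refl) = extremal (proj₂ (bad⇒dominated n≡ bad))
    by-order (no k≢i) = ⊥-elim (no-dominated (rows n≡′ (sym (ℕ.m+[n∸m]≡n k≤i)) (ℕ.m<n⇒0<n∸m (ℕ.≤∧≢⇒< k≤i k≢i))) n≡′
      (proj₂ (bad⇒dominated n≡′ bad)))
      where
      n≡′ : n ≡ t + i + i + suc (n ∸ suc (t + i + i))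
      n≡′ = trans (sym (ℕ.m+[n∸m]≡n (Bad.bound bad))) (sym (ℕ.+-suc (t + i + i) _))

-- The inequalities behind the bounds on `n`

module _ {k i μ D : ℕ} (i≡ : i ≡ k + D) (1≤D : 1 ≤ D) where

  private
    open ℕ.≤-Reasoning

    D≡ : D ≡ suc (pred D)
    D≡ = sym (ℕ.suc-pred D {{>-nonZero 1≤D}})

    halve-≤ : ∀ {a} → 2 * a ≤ 2 * D + μ → a ≤ D + 2 * μ
    halve-≤ {a} le = ℕ.*-cancelˡ-≤ 2 (ℕ.≤-trans le (ℕ.≤-trans (ℕ.m≤m+n (2 * D + μ) (3 * μ)) (ℕ.≤-reflexive (eq D μ))))
      where
      eq : ∀ D μ → 2 * D + μ + 3 * μ ≡ 2 * (D + 2 * μ)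
      eq = solve-ℕ

    -- With e = D - 1, the slack in the conclusion is that in quad plus e times
    -- that in lin.
    tops₀ : ∀ e → 3 * (k * k) + k + 2 ≤ 4 * suc e + 2 * μ → 2 * k + 2 ≤ suc e + 2 * μ →
            3 * (k + suc e) * (k + suc e) ≤ 2 * suc e * (2 * (k + suc e) + μ) + (k + suc e)
    tops₀ e quad lin = ℕ.+-cancelʳ-≤ (3 * (k * k) + k + 2 + e * (2 * k + 2)) _ _ (begin
      3 * (k + suc e) * (k + suc e) + (3 * (k * k) + k + 2 + e * (2 * k + 2))
        ≤⟨ ℕ.+-monoʳ-≤ (3 * (k + suc e) * (k + suc e)) (ℕ.+-mono-≤ quad (ℕ.*-monoʳ-≤ e lin)) ⟩
      3 * (k + suc e) * (k + suc e) + (4 * suc e + 2 * μ + e * (suc e + 2 * μ))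
        ≡⟨ eq k e μ ⟩
      2 * suc e * (2 * (k + suc e) + μ) + (k + suc e) + (3 * (k * k) + k + 2 + e * (2 * k + 2)) ∎)
      where
      eq : ∀ k e μ → 3 * (k + suc e) * (k + suc e) + (4 * suc e + 2 * μ + e * (suc e + 2 * μ)) ≡
        2 * suc e * (2 * (k + suc e) + μ) + (k + suc e) + (3 * (k * k) + k + 2 + e * (2 * k + 2))
      eq = solve-ℕ

    tops₁ : ∀ e → 3 * (k * k) + 5 * k + 4 ≤ 4 * suc e + 2 * μ → 2 * k + 4 ≤ suc e + 2 * μ →
            (k + suc e + 1) * (3 * (k + suc e) + 1) ≤ 2 * suc e * (2 * (k + suc e) + 1 + μ) + (k + suc e + 1)
    tops₁ e quad lin = ℕ.+-cancelʳ-≤ (3 * (k * k) + 5 * k + 4 + e * (2 * k + 4)) _ _ (begin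
      (k + suc e + 1) * (3 * (k + suc e) + 1) + (3 * (k * k) + 5 * k + 4 + e * (2 * k + 4))
        ≤⟨ ℕ.+-monoʳ-≤ ((k + suc e + 1) * (3 * (k + suc e) + 1)) (ℕ.+-mono-≤ quad (ℕ.*-monoʳ-≤ e lin)) ⟩
      (k + suc e + 1) * (3 * (k + suc e) + 1) + (4 * suc e + 2 * μ + e * (suc e + 2 * μ))
        ≡⟨ eq k e μ ⟩
      2 * suc e * (2 * (k + suc e) + 1 + μ) + (k + suc e + 1) + (3 * (k * k) + 5 * k + 4 + e * (2 * k + 4)) ∎)
      where
      eq : ∀ k e μ → (k + suc e + 1) * (3 * (k + suc e) + 1) + (4 * suc e + 2 * μ + e * (suc e + 2 * μ)) ≡
        2 * suc e * (2 * (k + suc e) + 1 + μ) + (k + suc e + 1) + (3 * (k * k) + 5 * k + 4 + e * (2 * k + 4))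
      eq = solve-ℕ

    lows-from : ∀ {t} → 4 * k + 4 + 4 * t ≤ 2 * D + μ → i + t + 1 ≤ 2 * D + μ
    lows-from {t} lin = ℕ.≤-trans (ℕ.≤-reflexive (cong (λ j → j + t + 1) i≡))
      (ℕ.≤-trans (ℕ.≤-reflexive (eq k D t)) (ℕ.≤-trans (ℕ.+-monoʳ-≤ D k+t+1≤D+μ) (ℕ.≤-reflexive (eq″ D μ))))
      where
      eq : ∀ k D t → k + D + t + 1 ≡ D + (k + t + 1)
      eq = solve-ℕ
      eq′ : ∀ k t → 2 * (k + t + 1) + (2 * k + 2 + 2 * t) ≡ 4 * k + 4 + 4 * t
      eq′ = solve-ℕ
      eq‴ : ∀ D μ → 2 * D + μ + μ ≡ 2 * (D + μ)
      eq‴ = solve-ℕ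
      eq″ : ∀ D μ → D + (D + μ) ≡ 2 * D + μ
      eq″ = solve-ℕ
      k+t+1≤D+μ : k + t + 1 ≤ D + μ
      k+t+1≤D+μ = ℕ.*-cancelˡ-≤ 2 (begin
        2 * (k + t + 1)                            ≤⟨ ℕ.m≤m+n (2 * (k + t + 1)) (2 * k + 2 + 2 * t) ⟩
        2 * (k + t + 1) + (2 * k + 2 + 2 * t)      ≡⟨ eq′ k t ⟩
        4 * k + 4 + 4 * t                          ≤⟨ lin ⟩
        2 * D + μ                                  ≤⟨ ℕ.m≤m+n (2 * D + μ) μ ⟩
        2 * D + μ + μ                              ≡⟨ eq‴ D μ ⟩
        2 * (D + μ)                                ∎)

    1≤i : 1 ≤ i
    1≤i = ℕ.≤-trans 1≤D (ℕ.≤-trans (ℕ.m≤n+m D k) (ℕ.≤-reflexive (sym i≡)))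

  -- The hypotheses are the two bounds on `n` rewritten by `n = 2k + 2D + μ + 1`. At `D = 1` the top
  -- row is equivalent to the quadratic one; the linear one carries it to larger `D`.
  rows₀ : 1 ≤ k → 3 * (k * k) + k + 2 ≤ 4 * D + 2 * μ → 4 * k + 4 ≤ 2 * D + μ → IntegerRows k 0 i μ D
  rows₀ 1≤k quad lin = record
    { i≡k+D = i≡
    ; 1≤i   = 1≤i
    ; lows  = lows-from {0} (ℕ.≤-trans (ℕ.≤-reflexive (ℕ.+-identityʳ (4 * k + 4))) lin)
    -- The mid row is deduced from the top row: the surplus `i (2D + 1)` on its right is at most
    -- `2 i * i` because `D + 1 ≤ i`.
    ; mids  = ℕ.+-cancelʳ-≤ (2 * i * i) _ _ (begin
        i * i + i * 0 + 2 * i * i                    ≡⟨ eq i ⟩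
        3 * i * i                                    ≤⟨ tops′ ⟩
        2 * D * (2 * i + μ) + i                      ≡⟨ eq′ i D μ ⟩
        2 * D * (i + μ) + i * (2 * D + 1)            ≤⟨ ℕ.+-monoʳ-≤ (2 * D * (i + μ)) (ℕ.*-monoʳ-≤ i 2D+1≤2i) ⟩
        2 * D * (i + μ) + i * (2 * i)                ≡⟨ cong (2 * D * (i + μ) +_) (eq″ i) ⟩
        2 * D * (i + μ) + 2 * i * i                  ∎)
    ; tops  = ℕ.≤-trans (ℕ.≤-reflexive (eq‴ i)) (ℕ.≤-trans tops′ (ℕ.≤-reflexive (eq⁗ i D μ)))
    }
    where
    tops′ : 3 * i * i ≤ 2 * D * (2 * i + μ) + i
    tops′ = subst₂ (λ i D → 3 * i * i ≤ 2 * D * (2 * i + μ) + i)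
      (trans (cong (k +_) (sym D≡)) (sym i≡)) (sym D≡)
      (tops₀ (pred D) (subst (λ D → 3 * (k * k) + k + 2 ≤ 4 * D + 2 * μ) D≡ quad)
        (subst (λ D → 2 * k + 2 ≤ D + 2 * μ) D≡ (halve-≤ (ℕ.≤-trans (ℕ.≤-reflexive (eq k)) lin))))
      where
      eq : ∀ k → 2 * (2 * k + 2) ≡ 4 * k + 4
      eq = solve-ℕ
    2D+1≤2i : 2 * D + 1 ≤ 2 * i
    2D+1≤2i = ℕ.≤-trans (ℕ.+-monoʳ-≤ (2 * D) (ℕ.≤-trans 1≤k (ℕ.m≤n*m k 2)))
      (ℕ.≤-reflexive (trans (eq k D) (cong (2 *_) (sym i≡))))
      where
      eq : ∀ k D → 2 * D + 2 * k ≡ 2 * (k + D)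
      eq = solve-ℕ
    eq : ∀ i → i * i + i * 0 + 2 * i * i ≡ 3 * i * i
    eq = solve-ℕ
    eq′ : ∀ i D μ → 2 * D * (2 * i + μ) + i ≡ 2 * D * (i + μ) + i * (2 * D + 1)
    eq′ = solve-ℕ
    eq″ : ∀ i → i * (2 * i) ≡ 2 * i * i
    eq″ = solve-ℕ
    eq‴ : ∀ i → (i + 0) * (3 * i + 0) ≡ 3 * i * i
    eq‴ = solve-ℕ
    eq⁗ : ∀ i D μ → 2 * D * (2 * i + μ) + i ≡ 2 * D * (2 * i + 0 + μ) + (i + 0)
    eq⁗ = solve-ℕ

  rows₁ : 3 * (k * k) + 5 * k + 4 ≤ 4 * D + 2 * μ → 4 * k + 8 ≤ 2 * D + μ → IntegerRows k 1 i μ D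
  rows₁ quad lin = record
    { i≡k+D = i≡
    ; 1≤i   = 1≤i
    ; lows  = lows-from {1} (ℕ.≤-trans (ℕ.≤-reflexive (ℕ.+-assoc (4 * k) 4 4)) lin)
    ; mids  = ℕ.+-cancelʳ-≤ (2 * i * (i + 1) + (i + 1)) _ _ (begin
        i * i + i * 1 + (2 * i * (i + 1) + (i + 1))             ≡⟨ eq i ⟩
        (i + 1) * (3 * i + 1)                                   ≤⟨ tops′ ⟩
        2 * D * (2 * i + 1 + μ) + (i + 1)                       ≡⟨ eq′ i D μ ⟩
        2 * D * (i + μ) + (2 * D * (i + 1) + (i + 1))           ≤⟨ ℕ.+-monoʳ-≤ (2 * D * (i + μ)) (ℕ.+-monoˡ-≤ (i + 1)
                                                                     (ℕ.*-monoˡ-≤ (i + 1) (ℕ.*-monoʳ-≤ 2 D≤i))) ⟩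
        2 * D * (i + μ) + (2 * i * (i + 1) + (i + 1))           ∎)
    ; tops  = tops′
    }
    where
    D≤i : D ≤ i
    D≤i = ℕ.≤-trans (ℕ.m≤n+m D k) (ℕ.≤-reflexive (sym i≡))
    tops′ : (i + 1) * (3 * i + 1) ≤ 2 * D * (2 * i + 1 + μ) + (i + 1)
    tops′ = subst₂ (λ i D → (i + 1) * (3 * i + 1) ≤ 2 * D * (2 * i + 1 + μ) + (i + 1))
      (trans (cong (k +_) (sym D≡)) (sym i≡)) (sym D≡)
      (tops₁ (pred D) (subst (λ D → 3 * (k * k) + 5 * k + 4 ≤ 4 * D + 2 * μ) D≡ quad)
        (subst (λ D → 2 * k + 4 ≤ D + 2 * μ) D≡ (halve-≤ (ℕ.≤-trans (ℕ.≤-reflexive (eq k)) lin))))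
      where
      eq : ∀ k → 2 * (2 * k + 4) ≡ 4 * k + 8
      eq = solve-ℕ
    eq : ∀ i → i * i + i * 1 + (2 * i * (i + 1) + (i + 1)) ≡ (i + 1) * (3 * i + 1)
    eq = solve-ℕ
    eq′ : ∀ i D μ → 2 * D * (2 * i + 1 + μ) + (i + 1) ≡ 2 * D * (i + μ) + (2 * D * (i + 1) + (i + 1))
    eq′ = solve-ℕ

-- From the hypotheses on `n` to the theorem

half₀ half₁ : ℕ → ℕ
half₀ zero    = 2
half₀ (suc k) = half₀ k + 3 * k + 4
half₁ zero    = 4
half₁ (suc k) = half₁ k + 3 * k + 6

-- The quadratic is always even, so the rounded division in the hypothesis on `n` loses nothing. Its
-- half is defined by successive differences to make this an induction.
half₀-double : ∀ k → 3 * (k * k) + 5 * k + 4 ≡ half₀ k * 2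
half₀-double zero    = refl
half₀-double (suc k) = trans (eq k) (trans (cong (_+ (3 * k + 4) * 2) (half₀-double k)) (eq′ (half₀ k) k))
  where
  eq : ∀ k → 3 * (suc k * suc k) + 5 * suc k + 4 ≡ 3 * (k * k) + 5 * k + 4 + (3 * k + 4) * 2
  eq = solve-ℕ
  eq′ : ∀ h k → h * 2 + (3 * k + 4) * 2 ≡ (h + 3 * k + 4) * 2
  eq′ = solve-ℕ

half₁-double : ∀ k → 3 * (k * k) + 9 * k + 8 ≡ half₁ k * 2
half₁-double zero    = refl
half₁-double (suc k) = trans (eq k) (trans (cong (_+ (3 * k + 6) * 2) (half₁-double k)) (eq′ (half₁ k) k))
  where
  eq : ∀ k → 3 * (suc k * suc k) + 9 * suc k + 8 ≡ 3 * (k * k) + 9 * k + 8 + (3 * k + 6) * 2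
  eq = solve-ℕ
  eq′ : ∀ h k → h * 2 + (3 * k + 6) * 2 ≡ (h + 3 * k + 6) * 2
  eq′ = solve-ℕ

halved-≤ : ∀ {n} k b c h → 3 * (k * k) + b * k + c ≡ h * 2 →
           (3 * k ^ 2 + b * k + c) / 2 ≤ n → 3 * (k * k) + b * k + c ≤ n * 2
halved-≤ {n} k b c h a≡2h le = ℕ.≤-trans (ℕ.≤-reflexive a≡2h) (ℕ.*-monoˡ-≤ 2
  (subst (_≤ n) (trans (cong (_/ 2) (trans (cong (λ s → 3 * (k * s) + b * k + c) (ℕ.*-identityʳ k)) a≡2h))
    (ℕ.m*n/n≡m h 2)) le))

δ≤degree : ∀ {n} (G : Graph n) v → δ G ≤ degree G v
δ≤degree {n} G v = All.lookup (min≤xs n (map (degree G) (allFin n))) (∈-map⁺ (degree G) (∈-allFin v))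

-- Used as casts, since comparing Is-q or _≅_ of the two sides by conversion
-- unfolds the graphs.
N≡Extremal : ∀ n k → N n k ≡ Extremal k (n ∸ 2 * k) (0 + k)
N≡Extremal n k = refl

N̲≡Extremal : ∀ n k → N̲ n k ≡ Extremal k (n ∸ 2 * k ∸ 1) (1 + k)
N̲≡Extremal n k = refl

theorem1p8 : (k n : ℕ) (G : Graph n) (q : ℝ) → Is-q G q →
    ((q₀ : ℝ) → Is-q (N̲ n k) q₀ →
    k ≤ δ G → q₀ ≤ᴿ q →
    (6 * k + 10) ⊔ ((3 * k ^ 2 + 9 * k + 8) / 2) ≤ n →
    Traceable G ⊎ G ≅ N̲ n k)
    ×
    ((q₀ : ℝ) → Is-q (N n k) q₀ →
    k ≤ δ G → 1 ≤ k → q₀ ≤ᴿ q →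
    (6 * k + 5) ⊔ ((3 * k ^ 2 + 5 * k + 4) / 2) ≤ n →
    Hamiltonian G ⊎ G ≅ N n k)
theorem1p8 k n G q q-largest = traceable , hamiltonian
  where
  -- This relies on the `witness` of `Bad`: for `t + i = 0` the count of small degrees would be an
  -- empty condition and bound no degree.
  k≤ : ∀ {t i} → k ≤ δ G → Bad G t i → k ≤ i
  k≤ k≤δ bad = let u , du≤i = Bad.witness bad in ℕ.≤-trans k≤δ (ℕ.≤-trans (δ≤degree G u) du≤i)

  traceable : (q₀ : ℝ) → Is-q (N̲ n k) q₀ → k ≤ δ G → q₀ ≤ᴿ q →
    (6 * k + 10) ⊔ ((3 * k ^ 2 + 9 * k + 8) / 2) ≤ n → Traceable G ⊎ G ≅ N̲ n k
  traceable q₀ q₀-largest k≤δ q₀≤q n-large = [ (λ cycle → inj₁ (cone-cycle⇒traceable {G = G} 1≤n cycle))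
    , (λ (_ , bad) → let _ , bad₁ = cone-bad 1≤n bad in inj₂ (extremal (k≤ k≤δ bad₁) bad₁)) ]′
    (chvatal (cone G) (s≤s (ℕ.≤-trans (s≤s (s≤s z≤n)) 10≤n)))
    where
    lin : 6 * k + 10 ≤ n
    lin = ℕ.m⊔n≤o⇒m≤o (6 * k + 10) _ n-large
    quad : 3 * (k * k) + 9 * k + 8 ≤ n * 2
    quad = halved-≤ k 9 8 (half₁ k) (half₁-double k) (ℕ.m⊔n≤o⇒n≤o (6 * k + 10) _ n-large)
    10≤n : 10 ≤ n
    10≤n = ℕ.≤-trans (ℕ.m≤n+m 10 (6 * k)) lin
    1≤n : 1 ≤ n
    1≤n = ℕ.≤-trans (s≤s z≤n) 10≤n
    -- Makes both truncated subtractions in the clique size `n ∸ 2 * k ∸ 1` exact.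
    2k+1≤n : 2 * k + 1 ≤ n
    2k+1≤n = ℕ.≤-trans (ℕ.+-mono-≤ (ℕ.*-monoˡ-≤ k {2} {6} (s≤s (s≤s z≤n))) (s≤s z≤n)) lin
    n≡ : n ≡ 1 + k + k + (n ∸ 2 * k ∸ 1)
    n≡ = trans (sym (ℕ.m+[n∸m]≡n 2k+1≤n)) (trans
      (cong (2 * k + 1 +_) (sym (ℕ.∸-+-assoc n (2 * k) 1))) (eq k (n ∸ 2 * k ∸ 1)))
      where
      eq : ∀ k m → 2 * k + 1 + m ≡ 1 + k + k + m
      eq = solve-ℕ
    2≤m : 2 ≤ n ∸ 2 * k ∸ 1
    2≤m = ℕ.+-cancelˡ-≤ (1 + k + k) _ _ (ℕ.≤-trans (ℕ.≤-trans (ℕ.m≤m+n _ (4 * k + 7)) (ℕ.≤-reflexive (eq k)))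
      (ℕ.≤-trans lin (ℕ.≤-reflexive n≡)))
      where
      eq : ∀ k → 1 + k + k + 2 + (4 * k + 7) ≡ 6 * k + 10
      eq = solve-ℕ
    rows : ∀ {i μ D} → n ≡ 1 + i + i + suc μ → i ≡ k + D → 1 ≤ D → IntegerRows k 1 i μ D
    rows {μ = μ} {D} n≡′ refl 1≤D = rows₁ refl 1≤D
      (ℕ.+-cancelˡ-≤ (4 * k + 4) _ _ (ℕ.≤-trans (ℕ.≤-reflexive (eq k))
        (ℕ.≤-trans quad (ℕ.≤-reflexive (trans (cong (_* 2) n≡′) (eq′ k D μ))))))
      (ℕ.+-cancelˡ-≤ (2 * k + 2) _ _ (ℕ.≤-trans (ℕ.≤-reflexive (eq″ k))
        (ℕ.≤-trans lin (ℕ.≤-reflexive (trans n≡′ (eq‴ k D μ))))))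
      where
      eq : ∀ k → 4 * k + 4 + (3 * (k * k) + 5 * k + 4) ≡ 3 * (k * k) + 9 * k + 8
      eq = solve-ℕ
      eq′ : ∀ k D μ → (1 + (k + D) + (k + D) + suc μ) * 2 ≡ 4 * k + 4 + (4 * D + 2 * μ)
      eq′ = solve-ℕ
      eq″ : ∀ k → 2 * k + 2 + (4 * k + 8) ≡ 6 * k + 10
      eq″ = solve-ℕ
      eq‴ : ∀ k D μ → 1 + (k + D) + (k + D) + suc μ ≡ 2 * k + 2 + (2 * D + μ)
      eq‴ = solve-ℕ
    extremal : ∀ {i} → k ≤ i → Bad G 1 i → G ≅ N̲ n k
    extremal k≤i bad = subst (G ≅_) (sym (N̲≡Extremal n k))
      (Comparison.bad⇒extremal G {k} {1} {n ∸ 2 * k ∸ 1} n≡ 2≤m (s≤s z≤n)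
      {q} {q₀} (proj₁ q-largest) (subst (λ H → Is-q H q₀) (N̲≡Extremal n k) q₀-largest) q₀≤q rows k≤i bad)

  hamiltonian : (q₀ : ℝ) → Is-q (N n k) q₀ → k ≤ δ G → 1 ≤ k → q₀ ≤ᴿ q →
    (6 * k + 5) ⊔ ((3 * k ^ 2 + 5 * k + 4) / 2) ≤ n → Hamiltonian G ⊎ G ≅ N n k
  hamiltonian q₀ q₀-largest k≤δ 1≤k q₀≤q n-large = [ (λ cycle → inj₁ (cycle⇒hamiltonian {G = G} 3≤n cycle))
    , (λ (_ , bad) → inj₂ (extremal (k≤ k≤δ bad) bad)) ]′
    (chvatal G 3≤n)
    where
    lin : 6 * k + 5 ≤ n
    lin = ℕ.m⊔n≤o⇒m≤o (6 * k + 5) _ n-large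
    quad : 3 * (k * k) + 5 * k + 4 ≤ n * 2
    quad = halved-≤ k 5 4 (half₀ k) (half₀-double k) (ℕ.m⊔n≤o⇒n≤o (6 * k + 5) _ n-large)
    3≤n : 3 ≤ n
    3≤n = ℕ.≤-trans (s≤s (s≤s (s≤s z≤n))) (ℕ.≤-trans (ℕ.m≤n+m 5 (6 * k)) lin)
    2k≤n : 2 * k ≤ n
    2k≤n = ℕ.≤-trans (ℕ.≤-trans (ℕ.*-monoˡ-≤ k {2} {6} (s≤s (s≤s z≤n))) (ℕ.m≤m+n (6 * k) 5)) lin
    n≡ : n ≡ 0 + k + k + (n ∸ 2 * k)
    n≡ = trans (sym (ℕ.m+[n∸m]≡n 2k≤n)) (eq k (n ∸ 2 * k))
      where
      eq : ∀ k m → 2 * k + m ≡ 0 + k + k + m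
      eq = solve-ℕ
    2≤m : 2 ≤ n ∸ 2 * k
    2≤m = ℕ.+-cancelˡ-≤ (0 + k + k) _ _ (ℕ.≤-trans (ℕ.≤-trans (ℕ.m≤m+n _ (4 * k + 3)) (ℕ.≤-reflexive (eq k)))
      (ℕ.≤-trans lin (ℕ.≤-reflexive n≡)))
      where
      eq : ∀ k → 0 + k + k + 2 + (4 * k + 3) ≡ 6 * k + 5
      eq = solve-ℕ
    rows : ∀ {i μ D} → n ≡ 0 + i + i + suc μ → i ≡ k + D → 1 ≤ D → IntegerRows k 0 i μ D
    rows {μ = μ} {D} n≡′ refl 1≤D = rows₀ refl 1≤D 1≤k
      (ℕ.+-cancelˡ-≤ (4 * k + 2) _ _ (ℕ.≤-trans (ℕ.≤-reflexive (eq k))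
        (ℕ.≤-trans quad (ℕ.≤-reflexive (trans (cong (_* 2) n≡′) (eq′ k D μ))))))
      (ℕ.+-cancelˡ-≤ (2 * k + 1) _ _ (ℕ.≤-trans (ℕ.≤-reflexive (eq″ k))
        (ℕ.≤-trans lin (ℕ.≤-reflexive (trans n≡′ (eq‴ k D μ))))))
      where
      eq : ∀ k → 4 * k + 2 + (3 * (k * k) + k + 2) ≡ 3 * (k * k) + 5 * k + 4
      eq = solve-ℕ
      eq′ : ∀ k D μ → (0 + (k + D) + (k + D) + suc μ) * 2 ≡ 4 * k + 2 + (4 * D + 2 * μ)
      eq′ = solve-ℕ
      eq″ : ∀ k → 2 * k + 1 + (4 * k + 4) ≡ 6 * k + 5
      eq″ = solve-ℕ
      eq‴ : ∀ k D μ → 0 + (k + D) + (k + D) + suc μ ≡ 2 * k + 1 + (2 * D + μ)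
      eq‴ = solve-ℕ
    extremal : ∀ {i} → k ≤ i → Bad G 0 i → G ≅ N n k
    extremal k≤i bad = subst (G ≅_) (sym (N≡Extremal n k))
      (Comparison.bad⇒extremal G {k} {0} {n ∸ 2 * k} n≡ 2≤m 1≤k
      {q} {q₀} (proj₁ q-largest) (subst (λ H → Is-q H q₀) (N≡Extremal n k) q₀-largest) q₀≤q rows k≤i bad)
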